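{- There exists $g>0$ such that for every positive integer $n$, every $n$-vertex subcubic graph with girth at least $g$ contains an independent set of size at least $0.4352\,n$.
   Context: Graphs are finite and simple. A graph is subcubic if every vertex has degree at most three. The girth of a graph is the length of its shortest cycle (infinite if there is no cycle). An independent set is a set of pairwise non-adjacent vertices. -}

module Defs where

open import Data.Fin.Base using (Fin)
open import Data.Fin.Subset using (Subset; _∈_; ∣_∣)
open import Data.List.Base using (List; _∷_; _∷ʳ_; length)
open import Data.List.Relation.Unary.Linked using (Linked)
open import Data.List.Relation.Unary.Unique.Propositional using (Unique)
open import Data.Nat.Base using (ℕ; _≤_)
open import Data.Product.Base using (_×_)
open import Data.Vec.Base using (tabulate)
open import Level using (0ℓ)
open import Relation.Binary.Core using (Rel)
open import Relation.Binary.Definitions using (Decidable; Irreflexive; Symmetric)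
open import Relation.Binary.PropositionalEquality.Core using (_≡_)
open import Relation.Nullary using (¬_; does)
open import Relation.Nullary.Construct.Add.Supremum using (_⁺; [_]; ⊤⁺)

record Graph (n : ℕ) : Set₁ where
  field
    Adj    : Rel (Fin n) 0ℓ
    adj?   : Decidable Adj
    sym    : Symmetric Adj
    irrefl : Irreflexive _≡_ Adj

open Graph public using (Adj)

neighbourhood : ∀ {n} → Graph n → Fin n → Subset n
neighbourhood G v = tabulate λ w → does (Graph.adj? G v w)

degree : ∀ {n} → Graph n → Fin n → ℕ
degree G v = ∣ neighbourhood G v ∣

Subcubic : ∀ {n} → Graph n → Set
Subcubic G = ∀ v → degree G v ≤ 3

-- The vertices are listed in cyclic order; repeating the first one at the end
-- makes Linked include the closing edge.  Without the bound 3 ≤ k a single edge,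
-- traversed back and forth, would be a cycle of length 2.
record Cycle {n} (G : Graph n) (k : ℕ) : Set where
  field
    start    : Fin n
    rest     : List (Fin n)
    closed   : Linked (Adj G) (start ∷ (rest ∷ʳ start))
    distinct : Unique (start ∷ rest)
    length≡k : length (start ∷ rest) ≡ k
    3≤k      : 3 ≤ k

-- The girth takes values in ℕ ⁺, where ⊤⁺ stands for infinity.
IsGirth : ∀ {n} → Graph n → ℕ ⁺ → Set
IsGirth G [ k ] = Cycle G k × (∀ {l} → Cycle G l → k ≤ l)
IsGirth G ⊤⁺    = ∀ {l} → ¬ Cycle G l

Independent : ∀ {n} → Graph n → Subset n → Set
Independent G S = ∀ {u v} → u ∈ S → v ∈ S → ¬ Adj G u v

{-# OPTIONS --safe #-}
-- A local randomised algorithm is run on a cubic graph without short cycles.  At any time the surviving vertices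
-- form a cubic graph whose edges stand for paths, called even or odd by the number of their inner vertices.  An odd
-- path contributes one more chosen vertex if neither of its ends is chosen, so both ends are deleted together; a
-- vertex that loses one of its edges becomes an inner vertex of a path joining its two other neighbours.  In each
-- round a dart (half-edge) rings with a small probability, mainly when its edge is odd, and deletes its vertex; the
-- deletion of one end of an odd edge forces the deletion of the other end in the next round, while the deletion of
-- one end of an even edge removes that edge.
--
-- Seen from a surviving vertex, the three half trees behind its darts are independent, and each remains a random
-- binary tree with independent states under a round.  The expected gain is therefore given by a recursion for the
-- masses l, κ, p, d of the four states of a dart, which is enclosed by interval arithmetic with 1250 digits.
--
-- A subcubic graph is first made cubic: copies of it are joined along their missing darts, and a tower of coverings
-- of the set of copies removes the short closed walks through the joining edges.  Some copy then contains its share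
-- of the independent set.
module Submission where

import Data.Bool.Properties as Bool
import Data.Fin.Properties as Fin
import Data.Integer.Properties as ℤ
import Data.Nat.DivMod as ℕ
import Data.Nat.Properties as ℕ
import Data.Nat.Solver as ℕ-Solver
import Data.Rational.Properties as ℚ
import Data.Rational.Solver as ℚ-Solver
import Data.Rational.Unnormalised.Properties as ℚᵘ
open import Algebra.Properties.CommutativeMonoid.Sum ℕ.+-0-commutativeMonoid using (sum; sum-permute; ∑-distrib-+; sum-cong-≗)
open import Data.Bool.Base as Bool using (Bool; true; false; if_then_else_; _∧_; _∨_; not)
open import Data.Empty using (⊥; ⊥-elim)
open import Data.Fin.Base as Fin using (Fin; zero; suc)
open import Data.Fin.Permutation using (permutation)
open import Data.Fin.Subset using (Subset; _∈_; ∣_∣)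
open import Data.Integer.Base as ℤ using ()
open import Data.List.Base as List using (List; []; _∷_)
open import Data.List.Membership.Propositional.Properties using (∈-filter⁺; ∈-allFin)
open import Data.List.Relation.Unary.All using (All; []; _∷_)
open import Data.List.Relation.Unary.AllPairs using ([]; _∷_)
open import Data.List.Relation.Unary.Any using (index)
open import Data.List.Relation.Unary.Any.Properties using (lookup-index)
open import Data.List.Relation.Unary.Linked using (Linked; [-]; _∷_)
open import Data.List.Relation.Unary.Unique.Propositional using (Unique)
open import Data.Nat.Base as ℕ using (ℕ; zero; suc)
open import Data.Product.Base using (_×_; _,_; proj₁; proj₂; ∃-syntax; Σ-syntax)
open import Data.Product.Properties using (≡-dec)
open import Data.Rational.Base as ℚ using (ℚ; 0ℚ; 1ℚ)
open import Data.Rational.Unnormalised.Base as ℚᵘ using (mkℚᵘ)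
open import Data.Sum.Base using (_⊎_; inj₁; inj₂)
open import Data.Unit.Base using (⊤; tt)
open import Data.Vec.Base as Vec using (Vec; []; _∷_; lookup; _[_]≔_)
open import Data.Vec.Properties using (lookup∘update; lookup∘update′; lookup∘tabulate; []=⇒lookup)
open import Defs
open import Function.Base using (id)
open import Relation.Binary.PropositionalEquality hiding (J)
open import Relation.Nullary using (¬_; Dec; yes; no; does)
open import Relation.Nullary.Decidable using (_×-dec_)

open ℚ-Solver.+-*-Solver using (solve; _:+_; _:*_; _:=_; con; :-_; _:-_)

-- Finite measures

-- Independence is what shapes the rules. A vertex survives a round exactly when each of its three
-- darts is quiet, which depends only on the root edge of the half tree behind that dart; what the
-- dart leads to afterwards depends only on the same half tree. Conditioning on survival therefore
-- keeps the three half trees independent. Any vertex whose situation would couple them is simply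
-- deleted and left unchosen. All coins of all rounds are attached to the darts beforehand, so a run
-- is a deterministic function of a labelling, and some labelling does at least as well as the
-- average. No limit is taken: after the last round the surviving vertices count for nothing, and
-- what is gained until then already suffices. The gain at a vertex depends on labels up to a
-- distance that doubles with each round, and this distance determines the girth. The vertices are
-- chosen backwards in time: an inner vertex of a path is decided once its two ends are. Chosen
-- vertices are counted twice, so that the vertex contributed by an odd path can be shared between
-- its two darts. At the start every edge is even, so only coins that ring for all parities can act;
-- they seed the process, and the much more frequent rings on odd edges carry it on.

module _ where
  open import Data.Rational.Base using (_+_; _*_)
  open ≡-Reasoning

  -- Formal weighted sums, observed only through `E`: two laws agree when they give the same
  -- integrals. Total mass is not fixed, and `IsProb` is asked for where it matters.
  data Meas (A : Set) : Set where
    ∅     : Meas A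
    ret   : A → Meas A
    _∙_⊕_ : ℚ → Meas A → Meas A → Meas A

  infixr 5 _∙_⊕_

  E : ∀ {A} → Meas A → (A → ℚ) → ℚ
  E ∅ f = 0ℚ
  E (ret a) f = f a
  E (w ∙ μ ⊕ ν) f = w * E μ f + E ν f

  infixl 4 _>>=_
  _>>=_ : ∀ {A B} → Meas A → (A → Meas B) → Meas B
  ∅ >>= k = ∅
  ret a >>= k = k a
  (w ∙ μ ⊕ ν) >>= k = w ∙ (μ >>= k) ⊕ (ν >>= k)

  E-bind : ∀ {A B} (μ : Meas A) (k : A → Meas B) f → E (μ >>= k) f ≡ E μ λ a → E (k a) f
  E-bind ∅ k f = refl
  E-bind (ret a) k f = refl
  E-bind (w ∙ μ ⊕ ν) k f = cong₂ (λ x y → w * x + y) (E-bind μ k f) (E-bind ν k f)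

  E-cong : ∀ {A} (μ : Meas A) {f g : A → ℚ} → (∀ a → f a ≡ g a) → E μ f ≡ E μ g
  E-cong ∅ h = refl
  E-cong (ret a) h = h a
  E-cong (w ∙ μ ⊕ ν) h = cong₂ (λ x y → w * x + y) (E-cong μ h) (E-cong ν h)

  E-0 : ∀ {A} (μ : Meas A) → E μ (λ _ → 0ℚ) ≡ 0ℚ
  E-0 ∅ = refl
  E-0 (ret a) = refl
  E-0 (w ∙ μ ⊕ ν) = trans (cong₂ (λ x y → w * x + y) (E-0 μ) (E-0 ν))
    (solve 1 (λ w → w :* con 0ℚ :+ con 0ℚ := con 0ℚ) refl w)

  E-+ : ∀ {A} (μ : Meas A) f g → E μ (λ a → f a + g a) ≡ E μ f + E μ g
  E-+ ∅ f g = refl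
  E-+ (ret a) f g = refl
  E-+ (w ∙ μ ⊕ ν) f g = trans (cong₂ (λ x y → w * x + y) (E-+ μ f g) (E-+ ν f g))
    (solve 5 (λ w a b c d → w :* (a :+ b) :+ (c :+ d) := (w :* a :+ c) :+ (w :* b :+ d)) refl w _ _ _ _)

  E-* : ∀ {A} (μ : Meas A) c f → E μ (λ a → c * f a) ≡ c * E μ f
  E-* ∅ c f = sym (ℚ.*-zeroʳ c)
  E-* (ret a) c f = refl
  E-* (w ∙ μ ⊕ ν) c f = trans (cong₂ (λ x y → w * x + y) (E-* μ c f) (E-* ν c f))
    (solve 4 (λ w c a b → w :* (c :* a) :+ c :* b := c :* (w :* a :+ b)) refl w c _ _)

  E-swap : ∀ {A B} (μ : Meas A) (ν : Meas B) (f : A → B → ℚ) →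
           E μ (λ a → E ν (f a)) ≡ E ν (λ b → E μ (λ a → f a b))
  E-swap ∅ ν f = sym (E-0 ν)
  E-swap (ret a) ν f = refl
  E-swap (w ∙ μ ⊕ μ′) ν f = begin
    w * E μ (λ a → E ν (f a)) + E μ′ (λ a → E ν (f a))
      ≡⟨ cong₂ (λ x y → w * x + y) (E-swap μ ν f) (E-swap μ′ ν f) ⟩
    w * E ν (λ b → E μ (λ a → f a b)) + E ν (λ b → E μ′ (λ a → f a b))
      ≡⟨ cong (_+ _) (sym (E-* ν w _)) ⟩
    E ν (λ b → w * E μ (λ a → f a b)) + E ν (λ b → E μ′ (λ a → f a b))
      ≡⟨ sym (E-+ ν _ _) ⟩
    E ν (λ b → w * E μ (λ a → f a b) + E μ′ (λ a → f a b)) ∎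

  IsProb : ∀ {A} → Meas A → Set
  IsProb μ = E μ (λ _ → 1ℚ) ≡ 1ℚ

  E-const : ∀ {A} {μ : Meas A} → IsProb μ → ∀ c → E μ (λ _ → c) ≡ c
  E-const {μ = μ} pr c = begin
    E μ (λ _ → c)       ≡⟨ E-cong μ (λ _ → sym (ℚ.*-identityʳ c)) ⟩
    E μ (λ _ → c * 1ℚ)  ≡⟨ E-* μ c _ ⟩
    c * E μ (λ _ → 1ℚ)  ≡⟨ cong (c *_) pr ⟩
    c * 1ℚ              ≡⟨ ℚ.*-identityʳ c ⟩
    c ∎

  E-affine : ∀ {A} {μ : Meas A} → IsProb μ → ∀ a f b → E μ (λ x → a * f x + b) ≡ a * E μ f + b
  E-affine {μ = μ} pr a f b = trans (E-+ μ _ _) (cong₂ _+_ (E-* μ a f) (E-const {μ = μ} pr b))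

  prob-bind : ∀ {A B} {μ : Meas A} {k : A → Meas B} → IsProb μ → (∀ a → IsProb (k a)) → IsProb (μ >>= k)
  prob-bind {μ = μ} {k} pμ pk = trans (E-bind μ k _) (trans (E-cong μ pk) pμ)

  -- The first moment method as a property of a law; it passes from the single coin to whole
  -- labellings through `attained-bind`.
  Attained : ∀ {A} → Meas A → Set
  Attained {A} μ = ∀ f → ∃[ a ] (E μ f ℚ.≤ f a)

  attained-bind : ∀ {A B} {μ : Meas A} {k : A → Meas B} →
                  Attained μ → (∀ a → Attained (k a)) → Attained (μ >>= k)
  attained-bind {μ = μ} {k} aμ ak f with aμ (λ a → E (k a) f)
  ... | a , h with ak a f
  ... | b , h′ = b , ℚ.≤-trans (ℚ.≤-reflexive (E-bind μ k f)) (ℚ.≤-trans h h′)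

  opaque
    iid : ∀ {A} → Meas A → ∀ n → Meas (Vec A n)
    iid μ zero = ret []
    iid μ (suc n) = μ >>= λ a → iid μ n >>= λ v → ret (a ∷ v)

    E-iid-suc : ∀ {A} (μ : Meas A) n f →
                E (iid μ (suc n)) f ≡ E μ (λ a → E (iid μ n) (λ v → f (a ∷ v)))
    E-iid-suc μ n f = trans (E-bind μ _ f) (E-cong μ λ a → E-bind (iid μ n) _ f)

    prob-iid : ∀ {A} {μ : Meas A} → IsProb μ → ∀ n → IsProb (iid μ n)
    prob-iid pμ zero = refl
    prob-iid {μ = μ} pμ (suc n) = prob-bind {μ = μ} pμ λ a → prob-bind {μ = iid μ n} (prob-iid pμ n) λ _ → refl

    attained-iid : ∀ {A} {μ : Meas A} → Attained μ → ∀ n → Attained (iid μ n)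
    attained-iid aμ zero f = [] , ℚ.≤-refl
    attained-iid {μ = μ} aμ (suc n) =
      attained-bind {μ = μ} aμ λ a → attained-bind {μ = iid μ n} (attained-iid aμ n) λ v f → _ , ℚ.≤-refl

  -- The entry that is overwritten integrates to one. This lets a single coordinate be split off as
  -- an independent variable.
  resample : ∀ {A} {μ : Meas A} → IsProb μ → ∀ {n} (p : Fin n) (φ : Vec A n → ℚ) →
             E (iid μ n) φ ≡ E μ (λ a → E (iid μ n) (λ v → φ (v [ p ]≔ a)))
  resample {μ = μ} pμ {suc n} zero φ = trans (E-iid-suc μ n φ) (E-cong μ λ a → sym (trans (E-iid-suc μ n _)
    (E-const {μ = μ} pμ _)))
  resample {μ = μ} pμ {suc n} (suc p) φ = begin
    E (iid μ (suc n)) φ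
      ≡⟨ E-iid-suc μ n φ ⟩
    E μ (λ b → E (iid μ n) (λ v → φ (b ∷ v)))
      ≡⟨ E-cong μ (λ b → resample pμ p (λ v → φ (b ∷ v))) ⟩
    E μ (λ b → E μ (λ a → E (iid μ n) (λ v → φ (b ∷ (v [ p ]≔ a)))))
      ≡⟨ E-swap μ μ _ ⟩
    E μ (λ a → E μ (λ b → E (iid μ n) (λ v → φ (b ∷ (v [ p ]≔ a)))))
      ≡⟨ E-cong μ (λ a → sym (E-iid-suc μ n _)) ⟩
    E μ (λ a → E (iid μ (suc n)) (λ v → φ (v [ suc p ]≔ a))) ∎

  E₃ : ∀ {A} → Meas A → (A → A → A → ℚ) → ℚ
  E₃ μ f = E μ λ a → E μ λ b → E μ λ c → f a b c

  E₃-cong : ∀ {A} (μ : Meas A) {f g : A → A → A → ℚ} → (∀ a b c → f a b c ≡ g a b c) → E₃ μ f ≡ E₃ μ g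
  E₃-cong μ h = E-cong μ λ a → E-cong μ λ b → E-cong μ (h a b)

-- One round on random trees

-- An edge of the current cubic graph stands for a path of the original one, whose inner vertices have
-- lost all other edges; only the parity of their number matters.
data Parity : Set where
  even odd : Parity

-- The parity of the number of inner vertices after two paths are concatenated at a further inner vertex.
_⊛_ : Parity → Parity → Parity
even ⊛ even = odd
even ⊛ odd  = even
odd  ⊛ even = even
odd  ⊛ odd  = odd

⊛-comm : ∀ e y → e ⊛ y ≡ y ⊛ e
⊛-comm even even = refl
⊛-comm even odd  = refl
⊛-comm odd  even = refl
⊛-comm odd  odd  = refl

-- One coin for two nested events: whatever rings on an even edge also rings on an odd one. The coin
-- can be thrown before the parity is known.
data Coin : Set where
  always onOdd never : Coin

rings : Coin → Parity → Bool
rings always e    = true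
rings onOdd  even = false
rings onOdd  odd  = true
rings never  e    = false

-- What is behind a dart of a surviving vertex: lost means that the edge has disappeared, kill that the vertex
-- must be deleted because the last inner vertex of the path was chosen.  A live edge carries the coins of its
-- two darts for the j remaining rounds; leaf is an artefact of the finite depth.
data Half (j : ℕ) : Set where
  leaf lost kill : Half j
  live : Parity → (near far : Vec Coin j) → Half j → Half j → Half j

-- A quiet half tree whose near coin for the current round has already been read, while the far one
-- has not; hence the two different lengths.
data Slot (j : ℕ) : Set where
  slot : Parity → Vec Coin j → Vec Coin (suc j) → Half (suc j) → Half (suc j) → Slot j

data View (A : Set) : Set where
  lost  : View A
  quiet : A → View A
  other : View A

data Fate (A B : Set) : Set where
  stays : A → A → Fate A B
  joins : Parity → B → A → A → Fate A B
  dies  : Fate A B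

view : ∀ {j} → Half (suc j) → View (Slot j)
view leaf = other
view lost = lost
view kill = other
view (live e (c ∷ r) r′ t u) = if rings c e then other else quiet (slot e r r′ t u)

-- A vertex becomes an inner one only if the far ends of both its paths survive, so that the new
-- path again joins two surviving vertices and at most two paths merge in a round. In every other
-- case it is sacrificed.
joinFate : ∀ {A B} → Parity → B → View A → View A → Fate A B
joinFate y b (quiet z) (quiet z′) = joins y b z z′
joinFate y b _         _          = dies

vertexFate : ∀ {A B} → (A → Fate A B) → View A → View A → Fate A B
vertexFate join (quiet s) (quiet s′) = stays s s′
vertexFate join lost      (quiet s)  = join s
vertexFate join (quiet s) lost       = join s
vertexFate join _         _          = dies

joinSlot : ∀ {j} → Slot j → Fate (Slot j) (Vec Coin j)
-- The near coins belong to the vertex that becomes an inner one and are discarded; the far end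
-- carries its remaining coins `r` over to the new edge.
joinSlot (slot y _ (c ∷ r) t u) = if rings c y then dies else joinFate y r (view t) (view u)

fate : ∀ {j} → Slot j → Fate (Slot j) (Vec Coin j)
fate (slot e _ (c ∷ _) t u) = if rings c e then dies else vertexFate joinSlot (view t) (view u)

dead : ∀ {j} → Parity → Half j
dead even = lost
dead odd  = kill

outcome : ∀ {A j} → Parity → (near far : Vec Coin j) → (A → Half j) → Fate A (Vec Coin j) → Half j
outcome e r r′ f (stays s s′)     = live e r r′ (f s) (f s′)
outcome e r r′ f (joins y b s s′) = live (e ⊛ y) r b (f s) (f s′)
outcome e r r′ f dies             = dead e

-- The number is the depth of the resulting tree, which makes the recursion structural although a
-- join descends two levels at once.
advance : ∀ {j} → ℕ → Slot j → Half j
advance zero    _ = leaf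
advance (suc m) s@(slot e r (_ ∷ r′) _ _) = outcome e r r′ (advance m) (fate s)

-- Twice the number of chosen inner vertices that is charged to a dart of a quiet vertex, by the fate of its neighbour.
pay : ∀ {A B} → Parity → Fate A B → ℕ
pay odd (joins even _ _ _) = 2
pay odd (joins odd _ _ _)  = 1
pay odd dies               = 2
pay _   _                  = 0

gain : ∀ {j} → Slot j → ℕ
gain s@(slot e _ _ _ _) = pay e (fate s)

double : ℕ → ℕ
double zero    = zero
double (suc m) = suc (suc (double m))

-- A join merges two levels of a tree into one, so that a round halves the depth.
height : ℕ → ℕ
height zero    = zero
height (suc j) = double (suc (height j))

allQuiet : ∀ {A} → (A → A → A → ℕ) → View A → View A → View A → ℕ
allQuiet f (quiet a) (quiet b) (quiet c) = f a b c
allQuiet f _         _         _         = 0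

mutual
  total : ∀ j → Half j → Half j → Half j → ℕ
  total zero    t u v = 0
  total (suc j) t u v = allQuiet (round j) (view t) (view u) (view v)

  round : ∀ j → Slot j → Slot j → Slot j → ℕ
  round j a b c = gain a ℕ.+ gain b ℕ.+ gain c ℕ.+ total j (next a) (next b) (next c)
    where
    next : Slot j → Half j
    next = advance (suc (height j))

ι : ℕ → ℚ
ι zero    = 0ℚ
ι (suc n) = 1ℚ ℚ.+ ι n

ι-+ : ∀ m n → ι (m ℕ.+ n) ≡ ι m ℚ.+ ι n
ι-+ zero    n = sym (ℚ.+-identityˡ _)
ι-+ (suc m) n = trans (cong (1ℚ ℚ.+_) (ι-+ m n)) (sym (ℚ.+-assoc 1ℚ (ι m) (ι n)))

-- The law of a random half tree

record Params : Set where
  field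
    l κ p d : ℚ
    sum≡1   : l ℚ.+ (κ ℚ.+ (p ℚ.+ d)) ≡ 1ℚ

  mass : Parity → ℚ
  mass even = p
  mass odd  = d

module Law (ra rb rc : ℚ) (coin-sum : ra ℚ.+ (rb ℚ.+ rc) ≡ 1ℚ) where
  open import Data.Rational.Base using (_+_; _*_; _-_)
  open ≡-Reasoning

  coin : Meas Coin
  coin = ra ∙ ret always ⊕ rb ∙ ret onOdd ⊕ rc ∙ ret never ⊕ ∅

  silent : Parity → ℚ
  silent even = rb + rc
  silent odd  = rc

  prob-coin : IsProb coin
  prob-coin = trans (solve 3 (λ a b c → a :* con 1ℚ :+ (b :* con 1ℚ :+ (c :* con 1ℚ :+ con 0ℚ)) := a :+ (b :+ c)) refl ra rb rc) coin-sum

  E-rings : ∀ e (g : Bool → ℚ) → E coin (λ c → g (rings c e)) ≡ silent e * g false + (1ℚ - silent e) * g true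
  E-rings even g = trans
    (solve 5 (λ a b c x y → a :* y :+ (b :* x :+ (c :* x :+ con 0ℚ)) := (b :+ c) :* x :+ ((a :+ (b :+ c)) :- (b :+ c)) :* y) refl ra rb rc (g false) (g true))
    (cong (λ w → (rb + rc) * g false + (w - (rb + rc)) * g true) coin-sum)
  E-rings odd g = trans
    (solve 5 (λ a b c x y → a :* y :+ (b :* y :+ (c :* x :+ con 0ℚ)) := c :* x :+ ((a :+ (b :+ c)) :- c) :* y) refl ra rb rc (g false) (g true))
    (cong (λ w → rc * g false + (w - rc) * g true) coin-sum)

  coins : ∀ j → Meas (Vec Coin j)
  coins = iid coin

  prob-coins : ∀ j → IsProb (coins j)
  prob-coins = prob-iid {μ = coin} prob-coin

  module At (P : Params) where
    open Params P

    opaque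
      mutual
        tree : ∀ j → ℕ → Meas (Half j)
        tree j zero    = ret leaf
        tree j (suc D) = l ∙ ret lost ⊕ κ ∙ ret kill ⊕ p ∙ edge j even D ⊕ d ∙ edge j odd D ⊕ ∅

        edge : ∀ j → Parity → ℕ → Meas (Half j)
        edge j e D = coins j >>= λ r → coins j >>= λ r′ → tree j D >>= λ t → tree j D >>= λ u → ret (live e r r′ t u)

      E-tree-zero : ∀ {j} f → E (tree j zero) f ≡ f leaf
      E-tree-zero f = refl

      E-tree-suc : ∀ {j} D f → E (tree j (suc D)) f ≡
                   l * f lost + (κ * f kill + (p * E (edge j even D) f + (d * E (edge j odd D) f + 0ℚ)))
      E-tree-suc D f = refl

    E₂ : ∀ {j} → ℕ → (Half j → Half j → ℚ) → ℚ
    E₂ {j} D f = E (tree j D) λ t → E (tree j D) (f t)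

    opaque
      unfolding tree

      E-edge : ∀ {j} e D f → E (edge j e D) f ≡
               E (coins j) (λ r → E (coins j) λ r′ → E₂ D λ t u → f (live e r r′ t u))
      E-edge {j} e D f = trans (E-bind (coins j) _ f) (E-cong (coins j) λ r →
        trans (E-bind (coins j) _ f) (E-cong (coins j) λ r′ →
        trans (E-bind (tree j D) _ f) (E-cong (tree j D) λ t → E-bind (tree j D) _ f)))

      prob-tree : ∀ j D → IsProb (tree j D)
      prob-edge : ∀ j e D → IsProb (edge j e D)
      prob-tree j zero    = refl
      prob-tree j (suc D) = trans
        (cong₂ (λ x y → l * 1ℚ + (κ * 1ℚ + (p * x + (d * y + 0ℚ)))) (prob-edge j even D) (prob-edge j odd D))
        (trans (solve 4 (λ l k p d → l :* con 1ℚ :+ (k :* con 1ℚ :+ (p :* con 1ℚ :+ (d :* con 1ℚ :+ con 0ℚ))) := l :+ (k :+ (p :+ d))) refl l κ p d) sum≡1)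
      prob-edge j e D = prob-bind {μ = coins j} (prob-coins j) λ r → prob-bind {μ = coins j} (prob-coins j) λ r′ →
        prob-bind {μ = tree j D} (prob-tree j D) λ t → prob-bind {μ = tree j D} (prob-tree j D) λ u → refl

    -- Mass of an edge of parity `e` with a silent near coin; in `u` below both coins are silent.
    q : Parity → ℚ
    q e = mass e * silent e

    qₛ : ℚ
    qₛ = q even + q odd

    u : Parity → ℚ
    u e = q e * silent e

    uₛ : ℚ
    uₛ = u even + u odd

    Eₑ : ∀ {j} → Parity → ℕ → (Slot j → ℚ) → ℚ
    Eₑ {j} e D φ = E (coins j) λ r → E (coins (suc j)) λ r′ → E₂ D λ t u → φ (slot e r r′ t u)

    opaque
      -- The integral of φ over the quiet half trees of depth suc D.
      S : ∀ {j} → ℕ → (Slot j → ℚ) → ℚ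
      S D φ = q even * Eₑ even D φ + q odd * Eₑ odd D φ

      S-def : ∀ {j} D (φ : Slot j → ℚ) → S D φ ≡ q even * Eₑ even D φ + q odd * Eₑ odd D φ
      S-def D φ = refl

    E₂-cong : ∀ {j} D {f g : Half j → Half j → ℚ} → (∀ t u → f t u ≡ g t u) → E₂ D f ≡ E₂ D g
    E₂-cong {j} D h = E-cong (tree j D) λ t → E-cong (tree j D) (h t)

    Eₑ-cong : ∀ {j} e D {φ ψ : Slot j → ℚ} → (∀ s → φ s ≡ ψ s) → Eₑ e D φ ≡ Eₑ e D ψ
    Eₑ-cong {j} e D h = E-cong (coins j) λ r → E-cong (coins (suc j)) λ r′ → E₂-cong D λ t u → h _

    opaque
      unfolding S

      S-cong : ∀ {j} D {φ ψ : Slot j → ℚ} → (∀ s → φ s ≡ ψ s) → S D φ ≡ S D ψ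
      S-cong D h = cong₂ (λ x y → q even * x + q odd * y) (Eₑ-cong even D h) (Eₑ-cong odd D h)

    E₂-affine : ∀ {j} D a (f : Half j → Half j → ℚ) b → E₂ D (λ t u → a * f t u + b) ≡ a * E₂ D f + b
    E₂-affine {j} D a f b = trans (E-cong (tree j D) λ t → E-affine {μ = tree j D} (prob-tree j D) a (f t) b)
      (E-affine {μ = tree j D} (prob-tree j D) a _ b)

    Eₑ-affine : ∀ {j} e D a (φ : Slot j → ℚ) b → Eₑ e D (λ s → a * φ s + b) ≡ a * Eₑ e D φ + b
    Eₑ-affine {j} e D a φ b =
      trans (E-cong (coins j) λ r → trans (E-cong (coins (suc j)) λ r′ → E₂-affine D a _ b)
        (E-affine {μ = coins (suc j)} (prob-coins (suc j)) a _ b))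
      (E-affine {μ = coins j} (prob-coins j) a _ b)

    Eₑ-const : ∀ {j} e D b → Eₑ {j} e D (λ _ → b) ≡ b
    Eₑ-const {j} e D b = trans (Eₑ-cong {j} e D {φ = λ _ → b} {ψ = λ _ → 0ℚ * 0ℚ + b} λ _ → sym (ℚ.+-identityˡ b))
      (trans (Eₑ-affine {j} e D 0ℚ (λ _ → 0ℚ) b) (solve 2 (λ x y → con 0ℚ :* x :+ y := y) refl (Eₑ {j} e D λ _ → 0ℚ) b))

    opaque
      unfolding S

      S-affine : ∀ {j} D a (φ : Slot j → ℚ) b → S D (λ s → a * φ s + b) ≡ a * S D φ + qₛ * b
      S-affine D a φ b = trans (cong₂ (λ x y → q even * x + q odd * y) (Eₑ-affine even D a φ b) (Eₑ-affine odd D a φ b))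
        (solve 6 (λ qe qo a b x y → qe :* (a :* x :+ b) :+ qo :* (a :* y :+ b) := a :* (qe :* x :+ qo :* y) :+ (qe :+ qo) :* b)
          refl (q even) (q odd) a b _ _)

      S-const : ∀ {j} D b → S {j} D (λ _ → b) ≡ qₛ * b
      S-const {j} D b = trans (cong₂ (λ x y → q even * x + q odd * y) (Eₑ-const {j} even D b) (Eₑ-const {j} odd D b))
        (sym (ℚ.*-distribʳ-+ b (q even) (q odd)))

      S-+ : ∀ {j} D (φ ψ : Slot j → ℚ) → S D (λ s → φ s + ψ s) ≡ S D φ + S D ψ
      S-+ {j} D φ ψ = trans (cong₂ (λ x y → q even * x + q odd * y) (Eₑ-+ even) (Eₑ-+ odd))
        (solve 6 (λ a b x y z w → a :* (x :+ y) :+ b :* (z :+ w) := (a :* x :+ b :* z) :+ (a :* y :+ b :* w)) refl (q even) (q odd) _ _ _ _)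
        where
        Eₑ-+ : ∀ e → Eₑ e D (λ s → φ s + ψ s) ≡ Eₑ e D φ + Eₑ e D ψ
        Eₑ-+ e = trans (E-cong (coins j) λ r → trans (E-cong (coins (suc j)) λ r′ →
          trans (E-cong (tree (suc j) D) λ t → E-+ (tree (suc j) D) _ _) (E-+ (tree (suc j) D) _ _))
          (E-+ (coins (suc j)) _ _)) (E-+ (coins j) _ _)

    -- A ringing near coin turns a live edge into `other`, whose mass is whatever `l` and `qₛ` leave
    -- of the total mass one.
    E-view : ∀ {j} D (Ψ : View (Slot j) → ℚ) →
             E (tree (suc j) (suc D)) (λ t → Ψ (view t)) ≡
             l * Ψ lost + (S D (λ s → Ψ (quiet s)) + (1ℚ - l - qₛ) * Ψ other)
    E-view {j} D Ψ = begin
      E (tree (suc j) (suc D)) (λ t → Ψ (view t))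
        ≡⟨ E-tree-suc D (λ t → Ψ (view t)) ⟩
      l * Ψ lost + (κ * Ψ other + (p * E (edge (suc j) even D) _ + (d * E (edge (suc j) odd D) _ + 0ℚ)))
        ≡⟨ cong₂ (λ x y → l * Ψ lost + (κ * Ψ other + (p * x + (d * y + 0ℚ)))) (step even) (step odd) ⟩
      l * Ψ lost + (κ * Ψ other + (p * (se * X + (1ℚ - se) * Ψ other) + (d * (so * Y + (1ℚ - so) * Ψ other) + 0ℚ)))
        ≡⟨ solve 10 (λ l κ p d se so X Y L O →
             l :* L :+ (κ :* O :+ (p :* (se :* X :+ (con 1ℚ :- se) :* O) :+ (d :* (so :* Y :+ (con 1ℚ :- so) :* O) :+ con 0ℚ)))
             := l :* L :+ ((p :* se :* X :+ d :* so :* Y) :+ ((l :+ (κ :+ (p :+ d))) :- l :- (p :* se :+ d :* so)) :* O))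
           refl l κ p d se so X Y (Ψ lost) (Ψ other) ⟩
      l * Ψ lost + ((q even * X + q odd * Y) + ((l + (κ + (p + d))) - l - qₛ) * Ψ other)
        ≡⟨ cong₂ (λ x w → l * Ψ lost + (x + (w - l - qₛ) * Ψ other)) (sym (S-def D (λ s → Ψ (quiet s)))) sum≡1 ⟩
      l * Ψ lost + (S D (λ s → Ψ (quiet s)) + (1ℚ - l - qₛ) * Ψ other) ∎
      where
      se = silent even
      so = silent odd
      X = Eₑ even D (λ s → Ψ (quiet s))
      Y = Eₑ odd D (λ s → Ψ (quiet s))
      step : ∀ e → E (edge (suc j) e D) (λ t → Ψ (view t)) ≡
                   silent e * Eₑ e D (λ s → Ψ (quiet s)) + (1ℚ - silent e) * Ψ other
      step e = begin
        E (edge (suc j) e D) (λ t → Ψ (view t))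
          ≡⟨ E-edge {suc j} e D (λ t → Ψ (view t)) ⟩
        E (coins (suc j)) (λ r → E (coins (suc j)) λ r′ → E₂ D λ t u → Ψ (view (live e r r′ t u)))
          ≡⟨ E-iid-suc coin j _ ⟩
        E coin (λ c → E (coins j) λ r → E (coins (suc j)) λ r′ → E₂ D λ t u → Ψ (if rings c e then other else quiet (slot e r r′ t u)))
          ≡⟨ E-rings e (λ b → E (coins j) λ r → E (coins (suc j)) λ r′ → E₂ D λ t u → Ψ (if b then other else quiet (slot e r r′ t u))) ⟩
        silent e * Eₑ e D (λ s → Ψ (quiet s)) + (1ℚ - silent e) * Eₑ {j} e D (λ _ → Ψ other)
          ≡⟨ cong (λ w → silent e * Eₑ e D (λ s → Ψ (quiet s)) + (1ℚ - silent e) * w)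
               (Eₑ-const {j} e D (Ψ other)) ⟩
        silent e * Eₑ e D (λ s → Ψ (quiet s)) + (1ℚ - silent e) * Ψ other ∎

module Step (ra rb rc : ℚ) (coin-sum : ra ℚ.+ (rb ℚ.+ rc) ≡ 1ℚ) (P : Params) where
  open import Data.Rational.Base using (_+_; _*_; _-_)
  open ≡-Reasoning
  open Law ra rb rc coin-sum
  open Params P
  open At P

  2ℚ : ℚ
  2ℚ = 1ℚ + 1ℚ

  S-* : ∀ {j} D c (φ : Slot j → ℚ) → S D (λ s → c * φ s) ≡ c * S D φ
  S-* D c φ = trans (S-cong D λ s → sym (ℚ.+-identityʳ (c * φ s))) (trans (S-affine D c φ 0ℚ)
    (solve 3 (λ c x q → c :* x :+ q :* con 0ℚ := c :* x) refl c (S D φ) qₛ))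

  -- Only two quiet darts, or one lost and one quiet in either order, avoid immediate death; all
  -- other pairs of views are collected in the coefficient of `dies`.
  E-vertexFate : ∀ {j} D (Ψ : Fate (Slot j) (Vec Coin j) → ℚ) →
    E₂ (suc D) (λ t u → Ψ (vertexFate joinSlot (view t) (view u))) ≡
    S D (λ a → S D λ b → Ψ (stays a b)) +
    (2ℚ * l * S D (λ a → Ψ (joinSlot a)) + (1ℚ - qₛ * qₛ - 2ℚ * l * qₛ) * Ψ dies)
  E-vertexFate {j} D Ψ = begin
    E₂ (suc D) (λ t u → Ψ (vertexFate joinSlot (view t) (view u)))
      ≡⟨ E-cong (tree (suc j) (suc D)) (λ t → E-view D (λ v → Ψ (vertexFate joinSlot (view t) v))) ⟩
    E (tree (suc j) (suc D)) (λ t → G (view t))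
      ≡⟨ E-view D G ⟩
    l * G lost + (S D (λ a → G (quiet a)) + x * G other)
      ≡⟨ cong₂ (λ y z → l * G lost + (y + x * (l * δ + (z + x * δ)))) inner (S-const {j} D δ) ⟩
    l * G lost + ((l * J + (SS + qₛ * (x * δ))) + x * (l * δ + (qₛ * δ + x * δ)))
      ≡⟨ solve 5 (λ l q δ J SS → let x = con 1ℚ :- l :- q in
           l :* (l :* δ :+ (J :+ x :* δ)) :+ ((l :* J :+ (SS :+ q :* (x :* δ))) :+ x :* (l :* δ :+ (q :* δ :+ x :* δ)))
           := SS :+ ((con 1ℚ :+ con 1ℚ) :* l :* J :+ (con 1ℚ :- q :* q :- (con 1ℚ :+ con 1ℚ) :* l :* q) :* δ)) refl l qₛ δ J SS ⟩
    SS + (2ℚ * l * J + (1ℚ - qₛ * qₛ - 2ℚ * l * qₛ) * δ) ∎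
    where
    δ = Ψ dies
    x = 1ℚ - l - qₛ
    J = S D (λ a → Ψ (joinSlot a))
    SS = S D (λ a → S D λ b → Ψ (stays a b))
    G : View (Slot j) → ℚ
    G v = l * Ψ (vertexFate joinSlot v lost) + (S D (λ b → Ψ (vertexFate joinSlot v (quiet b))) + x * Ψ (vertexFate joinSlot v other))
    inner : S D (λ a → G (quiet a)) ≡ l * J + (SS + qₛ * (x * δ))
    inner = trans (S-+ D (λ a → l * Ψ (joinSlot a)) (λ a → S D (λ b → Ψ (stays a b)) + x * δ))
      (cong₂ _+_ (S-* D l (λ a → Ψ (joinSlot a)))
        (trans (S-+ D (λ a → S D λ b → Ψ (stays a b)) (λ _ → x * δ)) (cong (SS +_) (S-const {j} D (x * δ)))))

  E-joinFate : ∀ {j} D y (ρ : Vec Coin j) (Ψ : Fate (Slot j) (Vec Coin j) → ℚ) →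
    E₂ (suc D) (λ t u → Ψ (joinFate y ρ (view t) (view u))) ≡
    S D (λ a → S D λ b → Ψ (joins y ρ a b)) + (1ℚ - qₛ * qₛ) * Ψ dies
  E-joinFate {j} D y ρ Ψ = begin
    E₂ (suc D) (λ t u → Ψ (joinFate y ρ (view t) (view u)))
      ≡⟨ E-cong (tree (suc j) (suc D)) (λ t → E-view D (λ v → Ψ (joinFate y ρ (view t) v))) ⟩
    E (tree (suc j) (suc D)) (λ t → G (view t))
      ≡⟨ E-view D G ⟩
    l * (l * δ + (S {j} D (λ _ → δ) + x * δ)) + (S D (λ a → G (quiet a)) + x * (l * δ + (S {j} D (λ _ → δ) + x * δ)))
      ≡⟨ cong₂ (λ y z → l * (l * δ + (z + x * δ)) + (y + x * (l * δ + (z + x * δ)))) inner (S-const {j} D δ) ⟩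
    l * (l * δ + (qₛ * δ + x * δ)) + ((qₛ * (l * δ) + (SS + qₛ * (x * δ))) + x * (l * δ + (qₛ * δ + x * δ)))
      ≡⟨ solve 4 (λ l q δ SS → let x = con 1ℚ :- l :- q in
           l :* (l :* δ :+ (q :* δ :+ x :* δ)) :+ ((q :* (l :* δ) :+ (SS :+ q :* (x :* δ))) :+ x :* (l :* δ :+ (q :* δ :+ x :* δ)))
           := SS :+ (con 1ℚ :- q :* q) :* δ) refl l qₛ δ SS ⟩
    SS + (1ℚ - qₛ * qₛ) * δ ∎
    where
    δ = Ψ dies
    x = 1ℚ - l - qₛ
    SS = S D (λ a → S D λ b → Ψ (joins y ρ a b))
    G : View (Slot j) → ℚ
    G v = l * Ψ (joinFate y ρ v lost) + (S D (λ b → Ψ (joinFate y ρ v (quiet b))) + x * Ψ (joinFate y ρ v other))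
    inner : S D (λ a → G (quiet a)) ≡ qₛ * (l * δ) + (SS + qₛ * (x * δ))
    inner = trans (S-+ D (λ _ → l * δ) (λ a → S D (λ b → Ψ (joins y ρ a b)) + x * δ))
      (cong₂ _+_ (S-const {j} D (l * δ))
        (trans (S-+ D (λ a → S D λ b → Ψ (joins y ρ a b)) (λ _ → x * δ)) (cong (SS +_) (S-const {j} D (x * δ)))))

  E-coins-rings : ∀ {j} e (g : Bool → Vec Coin j → ℚ) (δ : Vec Coin j → ℚ) → (∀ ρ → g true ρ ≡ δ ρ) →
    E (coins (suc j)) (λ r → g (rings (Vec.head r) e) (Vec.tail r)) ≡
    E (coins j) (λ ρ → silent e * g false ρ + (1ℚ - silent e) * δ ρ)
  E-coins-rings {j} e g δ h = begin
    E (coins (suc j)) (λ r → g (rings (Vec.head r) e) (Vec.tail r))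
      ≡⟨ E-iid-suc coin j _ ⟩
    E coin (λ c → E (coins j) (g (rings c e)))
      ≡⟨ E-rings e (λ b → E (coins j) (g b)) ⟩
    silent e * E (coins j) (g false) + (1ℚ - silent e) * E (coins j) (g true)
      ≡⟨ cong₂ _+_ (sym (E-* (coins j) (silent e) _)) (sym (E-* (coins j) (1ℚ - silent e) _)) ⟩
    E (coins j) (λ ρ → silent e * g false ρ) + E (coins j) (λ ρ → (1ℚ - silent e) * g true ρ)
      ≡⟨ sym (E-+ (coins j) _ _) ⟩
    E (coins j) (λ ρ → silent e * g false ρ + (1ℚ - silent e) * g true ρ)
      ≡⟨ E-cong (coins j) (λ ρ → cong (λ w → silent e * g false ρ + (1ℚ - silent e) * w) (h ρ)) ⟩
    E (coins j) (λ ρ → silent e * g false ρ + (1ℚ - silent e) * δ ρ) ∎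

  SJ : ∀ {j} → ℕ → Parity → (Fate (Slot j) (Vec Coin j) → ℚ) → ℚ
  SJ {j} D y Ψ = E (coins j) λ ρ → S D λ a → S D λ b → Ψ (joins y ρ a b)

  E-joinSlot : ∀ {j} D y (Ψ : Fate (Slot j) (Vec Coin j) → ℚ) →
    Eₑ y (suc D) (λ a → Ψ (joinSlot a)) ≡ silent y * SJ D y Ψ + (1ℚ - silent y * (qₛ * qₛ)) * Ψ dies
  E-joinSlot {j} D y Ψ = begin
    Eₑ y (suc D) (λ a → Ψ (joinSlot a))
      ≡⟨ E-cong (coins j) (λ r → E-cong (coins (suc j)) (λ { (c ∷ ρ) → refl })) ⟩
    E (coins j) (λ _ → E (coins (suc j)) (λ r → E₂ (suc D) (λ t u → Ψ (if rings (Vec.head r) y then dies else joinFate y (Vec.tail r) (view t) (view u)))))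
      ≡⟨ E-const {μ = coins j} (prob-coins j) _ ⟩
    E (coins (suc j)) (λ r → E₂ (suc D) (λ t u → Ψ (if rings (Vec.head r) y then dies else joinFate y (Vec.tail r) (view t) (view u))))
      ≡⟨ E-coins-rings y (λ b ρ → E₂ (suc D) (λ t u → Ψ (if b then dies else joinFate y ρ (view t) (view u)))) (λ _ → Ψ dies)
           (λ ρ → trans (E-const {μ = tree (suc j) (suc D)} (prob-tree (suc j) (suc D)) _) (E-const {μ = tree (suc j) (suc D)} (prob-tree (suc j) (suc D)) _)) ⟩
    E (coins j) (λ ρ → silent y * E₂ (suc D) (λ t u → Ψ (joinFate y ρ (view t) (view u))) + (1ℚ - silent y) * Ψ dies)
      ≡⟨ E-cong (coins j) (λ ρ → trans (cong (λ w → silent y * w + (1ℚ - silent y) * Ψ dies) (E-joinFate D y ρ Ψ))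
           (solve 4 (λ s A δ q → s :* (A :+ (con 1ℚ :- q :* q) :* δ) :+ (con 1ℚ :- s) :* δ := s :* A :+ (con 1ℚ :- s :* (q :* q)) :* δ) refl
             (silent y) (S D (λ a → S D λ b → Ψ (joins y ρ a b))) (Ψ dies) qₛ)) ⟩
    E (coins j) (λ ρ → silent y * S D (λ a → S D λ b → Ψ (joins y ρ a b)) + (1ℚ - silent y * (qₛ * qₛ)) * Ψ dies)
      ≡⟨ E-affine {μ = coins j} (prob-coins j) (silent y) _ _ ⟩
    silent y * SJ D y Ψ + (1ℚ - silent y * (qₛ * qₛ)) * Ψ dies ∎

  -- The probability, once the far coin is silent, that the fate is not `dies`: two quiet darts, or
  -- one lost dart in two positions and a join, which takes two silent coins on the second edge and
  -- two quiet darts behind it.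
  survive : ℚ
  survive = qₛ * qₛ + 2ℚ * l * (qₛ * qₛ) * uₛ

  -- `Φ` also receives the unread far coins because an edge that stays keeps them.
  E-fate : ∀ {j} D e (r : Vec Coin j) (Φ : Vec Coin j → Fate (Slot j) (Vec Coin j) → ℚ) →
    E (coins (suc j)) (λ r′ → E₂ (suc (suc D)) λ t w → Φ (Vec.tail r′) (fate (slot e r r′ t w))) ≡
    E (coins j) (λ ρ → silent e * (S (suc D) (λ a → S (suc D) λ b → Φ ρ (stays a b)) +
                         2ℚ * l * (u even * SJ D even (Φ ρ) + u odd * SJ D odd (Φ ρ))) +
                       (1ℚ - silent e * survive) * Φ ρ dies)
  E-fate {j} D e r Φ = begin
    E (coins (suc j)) (λ r′ → E₂ (suc (suc D)) λ t w → Φ (Vec.tail r′) (fate (slot e r r′ t w)))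
      ≡⟨ E-cong (coins (suc j)) (λ { (c ∷ ρ) → refl }) ⟩
    E (coins (suc j)) (λ r′ → E₂ (suc (suc D)) λ t w → Φ (Vec.tail r′) (if rings (Vec.head r′) e then dies else vertexFate joinSlot (view t) (view w)))
      ≡⟨ E-coins-rings e (λ b ρ → E₂ (suc (suc D)) λ t w → Φ ρ (if b then dies else vertexFate joinSlot (view t) (view w))) (λ ρ → Φ ρ dies)
           (λ ρ → trans (E-const {μ = tree (suc j) (suc (suc D))} (prob-tree (suc j) (suc (suc D))) _)
                        (E-const {μ = tree (suc j) (suc (suc D))} (prob-tree (suc j) (suc (suc D))) _)) ⟩
    E (coins j) (λ ρ → silent e * E₂ (suc (suc D)) (λ t w → Φ ρ (vertexFate joinSlot (view t) (view w))) + (1ℚ - silent e) * Φ ρ dies)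
      ≡⟨ E-cong (coins j) (λ ρ → trans
           (cong (λ w → silent e * w + (1ℚ - silent e) * Φ ρ dies)
             (trans (E-vertexFate (suc D) (Φ ρ))
               (cong (λ v → S (suc D) (λ a → S (suc D) λ b → Φ ρ (stays a b)) + (2ℚ * l * v + (1ℚ - qₛ * qₛ - 2ℚ * l * qₛ) * Φ ρ dies))
                 (trans (S-def (suc D) (λ a → Φ ρ (joinSlot a)))
                   (cong₂ (λ v w → q even * v + q odd * w) (E-joinSlot D even (Φ ρ)) (E-joinSlot D odd (Φ ρ)))))))
           (solve 10 (λ s SS l qe qo se so JE JO δ → let q = qe :+ qo; two = con 1ℚ :+ con 1ℚ in
             s :* (SS :+ (two :* l :* (qe :* (se :* JE :+ (con 1ℚ :- se :* (q :* q)) :* δ) :+ qo :* (so :* JO :+ (con 1ℚ :- so :* (q :* q)) :* δ))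
                    :+ (con 1ℚ :- q :* q :- two :* l :* q) :* δ)) :+ (con 1ℚ :- s) :* δ
             := s :* (SS :+ two :* l :* (qe :* se :* JE :+ qo :* so :* JO)) :+ (con 1ℚ :- s :* (q :* q :+ two :* l :* (q :* q) :* (qe :* se :+ qo :* so))) :* δ)
             refl (silent e) (S (suc D) (λ a → S (suc D) λ b → Φ ρ (stays a b))) l (q even) (q odd) (silent even) (silent odd) (SJ D even (Φ ρ)) (SJ D odd (Φ ρ)) (Φ ρ dies))) ⟩
    _ ∎

  -- The masses after a round, conditioned on the dart being quiet and cleared of the denominator
  -- `qₛ`. The first two come from a dying neighbour behind an even or odd edge; in the last two the
  -- edge stays or is joined to one of the appropriate parity.
  record Next (P′ : Params) : Set where
    open Params P′ renaming (l to l′; κ to κ′; p to p′; d to d′)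
    field
      l-eq : qₛ * l′ ≡ q even - u even * survive
      κ-eq : qₛ * κ′ ≡ q odd - u odd * survive
      p-eq : qₛ * p′ ≡ qₛ * qₛ * (u even + 2ℚ * l * (u even * u odd + u odd * u even))
      d-eq : qₛ * d′ ≡ qₛ * qₛ * (u odd + 2ℚ * l * (u even * u even + u odd * u odd))

module Round (ra rb rc : ℚ) (coin-sum : ra ℚ.+ (rb ℚ.+ rc) ≡ 1ℚ) (P P′ : Params)
             (nxt : Step.Next ra rb rc coin-sum P P′) where
  open import Data.Rational.Base using (_+_; _*_; _-_)
  open ≡-Reasoning
  open Law ra rb rc coin-sum
  open Params P
  open Params P′ using () renaming (l to l′; κ to κ′; p to p′; d to d′)
  open At P
  open Step ra rb rc coin-sum P
  module N = Step.Next nxt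
  module T = At P′

  E-lin : ∀ {A} {μ : Meas A} → IsProb μ → ∀ a f b g c h k →
          E μ (λ x → a * f x + (b * g x + c * h x) + k) ≡ a * E μ f + (b * E μ g + c * E μ h) + k
  E-lin {μ = μ} pr a f b g c h k = trans (E-+ μ _ _) (cong₂ _+_
    (trans (E-+ μ _ _) (cong₂ _+_ (E-* μ a f) (trans (E-+ μ _ _) (cong₂ _+_ (E-* μ b g) (E-* μ c h)))))
    (E-const {μ = μ} pr k))

  edge-eq : ∀ qe se Q M ue uo X Y Z sv L →
    qe * (se * Q * X + (se * M * ue * Y + se * M * uo * Z) + (1ℚ - se * sv) * L) ≡
    (qe - qe * se * sv) * L + (qe * se * Q * X + (qe * se * M * ue * Y + qe * se * M * uo * Z))
  edge-eq = solve 11 (λ qe se Q M ue uo X Y Z sv L →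
    qe :* (se :* Q :* X :+ (se :* M :* ue :* Y :+ se :* M :* uo :* Z) :+ (con 1ℚ :- se :* sv) :* L) :=
    (qe :- qe :* se :* sv) :* L :+ (qe :* se :* Q :* X :+ (qe :* se :* M :* ue :* Y :+ qe :* se :* M :* uo :* Z))) refl

  collect-eq : ∀ Q l ue uo Ze Zo L K →
    L + (ue * Q * Ze + (ue * (2ℚ * l * Q) * ue * Zo + ue * (2ℚ * l * Q) * uo * Ze)) +
    (K + (uo * Q * Zo + (uo * (2ℚ * l * Q) * ue * Ze + uo * (2ℚ * l * Q) * uo * Zo)))
    ≡ L + (K + (Q * (ue + 2ℚ * l * (ue * uo + uo * ue)) * Ze + Q * (uo + 2ℚ * l * (ue * ue + uo * uo)) * Zo))
  collect-eq = solve 8 (λ Q l ue uo Ze Zo L K → let two = con 1ℚ :+ con 1ℚ in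
    L :+ (ue :* Q :* Ze :+ (ue :* (two :* l :* Q) :* ue :* Zo :+ ue :* (two :* l :* Q) :* uo :* Ze)) :+
    (K :+ (uo :* Q :* Zo :+ (uo :* (two :* l :* Q) :* ue :* Ze :+ uo :* (two :* l :* Q) :* uo :* Zo)))
    := L :+ (K :+ (Q :* (ue :+ two :* l :* (ue :* uo :+ uo :* ue)) :* Ze :+ Q :* (uo :+ two :* l :* (ue :* ue :+ uo :* uo)) :* Zo))) refl

  slot-eq : ∀ s Q X l ue uo Y Z k → s * (Q * X + 2ℚ * l * (ue * (Q * Y) + uo * (Q * Z))) + k ≡
            s * Q * X + (s * (2ℚ * l * Q) * ue * Y + s * (2ℚ * l * Q) * uo * Z) + k
  slot-eq = solve 9 (λ s Q X l ue uo Y Z k → let two = con 1ℚ :+ con 1ℚ in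
    s :* (Q :* X :+ two :* l :* (ue :* (Q :* Y) :+ uo :* (Q :* Z))) :+ k
    := s :* Q :* X :+ (s :* (two :* l :* Q) :* ue :* Y :+ s :* (two :* l :* Q) :* uo :* Z) :+ k) refl

  Pushes : ℕ → ℕ → ℕ → Set
  Pushes j m D = ∀ φ → S {j} D (λ s → φ (advance m s)) ≡ qₛ * E (T.tree j m) φ

  pushes₂ : ∀ {j m D} → Pushes j m D → ∀ (ψ : Half j → Half j → ℚ) →
            S D (λ a → S D λ b → ψ (advance m a) (advance m b)) ≡ qₛ * qₛ * T.E₂ m ψ
  pushes₂ {j} {m} {D} h ψ = begin
    S D (λ a → S D λ b → ψ (advance m a) (advance m b))
      ≡⟨ S-cong D (λ a → h (ψ (advance m a))) ⟩
    S D (λ a → qₛ * E (T.tree j m) (ψ (advance m a)))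
      ≡⟨ S-* D qₛ (λ a → E (T.tree j m) (ψ (advance m a))) ⟩
    qₛ * S D (λ a → E (T.tree j m) (ψ (advance m a)))
      ≡⟨ cong (qₛ *_) (h (λ t → E (T.tree j m) (ψ t))) ⟩
    qₛ * (qₛ * T.E₂ m ψ)
      ≡⟨ sym (ℚ.*-assoc qₛ qₛ _) ⟩
    qₛ * qₛ * T.E₂ m ψ ∎

  -- The family of laws is closed under a round. Behind an edge that stays or is joined lie two
  -- independent quiet slots, to which the induction applies, and the unread coins are still fresh.
  -- One new level uses up to two old ones, whence `double m`.
  pushes : ∀ {j} m D → double m ℕ.≤ D → Pushes j m D
  pushes {j} zero D h φ = trans (S-const {j} D (φ leaf)) (cong (qₛ *_) (sym (T.E-tree-zero φ)))
  pushes {j} (suc m) (suc (suc D)) (ℕ.s≤s (ℕ.s≤s h)) φ = begin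
    S (suc (suc D)) (λ s → φ (advance (suc m) s))
      ≡⟨ S-def (suc (suc D)) (λ s → φ (advance (suc m) s)) ⟩
    q even * Eₑ even (suc (suc D)) (λ s → φ (advance (suc m) s)) + q odd * Eₑ odd (suc (suc D)) (λ s → φ (advance (suc m) s))
      ≡⟨ cong₂ (λ x y → q even * x + q odd * y) (onEdge even) (onEdge odd) ⟩
    q even * form even + q odd * form odd
      ≡⟨ cong₂ _+_
           (edge-eq (q even) (silent even) (qₛ * qₛ) (2ℚ * l * (qₛ * qₛ)) (u even) (u odd) (Z even) (Z odd) (Z even) survive (φ lost))
           (edge-eq (q odd) (silent odd) (qₛ * qₛ) (2ℚ * l * (qₛ * qₛ)) (u even) (u odd) (Z odd) (Z even) (Z odd) survive (φ kill)) ⟩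
    (q even - u even * survive) * φ lost + (u even * (qₛ * qₛ) * Z even +
      (u even * (2ℚ * l * (qₛ * qₛ)) * u even * Z odd + u even * (2ℚ * l * (qₛ * qₛ)) * u odd * Z even)) +
    ((q odd - u odd * survive) * φ kill + (u odd * (qₛ * qₛ) * Z odd +
      (u odd * (2ℚ * l * (qₛ * qₛ)) * u even * Z even + u odd * (2ℚ * l * (qₛ * qₛ)) * u odd * Z odd)))
      ≡⟨ collect-eq (qₛ * qₛ) l (u even) (u odd) (Z even) (Z odd) ((q even - u even * survive) * φ lost) ((q odd - u odd * survive) * φ kill) ⟩
    (q even - u even * survive) * φ lost + ((q odd - u odd * survive) * φ kill +
      (qₛ * qₛ * (u even + 2ℚ * l * (u even * u odd + u odd * u even)) * Z even +
       qₛ * qₛ * (u odd + 2ℚ * l * (u even * u even + u odd * u odd)) * Z odd))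
      ≡⟨ sym (cong₂ _+_ (cong (_* _) N.l-eq) (cong₂ _+_ (cong (_* _) N.κ-eq) (cong₂ _+_ (cong (_* _) N.p-eq) (cong (_* _) N.d-eq)))) ⟩
    qₛ * l′ * φ lost + (qₛ * κ′ * φ kill + (qₛ * p′ * Z even + qₛ * d′ * Z odd))
      ≡⟨ solve 9 (λ q l k p d L K X Y → q :* l :* L :+ (q :* k :* K :+ (q :* p :* X :+ q :* d :* Y)) :=
           q :* (l :* L :+ (k :* K :+ (p :* X :+ (d :* Y :+ con 0ℚ))))) refl qₛ l′ κ′ p′ d′ (φ lost) (φ kill) (Z even) (Z odd) ⟩
    qₛ * (l′ * φ lost + (κ′ * φ kill + (p′ * Z even + (d′ * Z odd + 0ℚ))))
      ≡⟨ cong (qₛ *_) (sym (T.E-tree-suc m φ)) ⟩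
    qₛ * E (T.tree j (suc m)) φ ∎
    where
    Z : Parity → ℚ
    Z e = E (T.edge j e m) φ
    X : Parity → Vec Coin j → Vec Coin j → ℚ
    X e r ρ = T.E₂ m λ t w → φ (live e r ρ t w)
    Y : Parity → Vec Coin j → ℚ
    Y e r = E (coins j) (X e r)
    A B C K : Parity → ℚ
    A e = silent e * (qₛ * qₛ)
    B e = silent e * (2ℚ * l * (qₛ * qₛ)) * u even
    C e = silent e * (2ℚ * l * (qₛ * qₛ)) * u odd
    K e = (1ℚ - silent e * survive) * φ (dead e)
    form : Parity → ℚ
    form e = silent e * (qₛ * qₛ) * Z e +
             (silent e * (2ℚ * l * (qₛ * qₛ)) * u even * Z (e ⊛ even) + silent e * (2ℚ * l * (qₛ * qₛ)) * u odd * Z (e ⊛ odd)) +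
             (1ℚ - silent e * survive) * φ (dead e)
    SJ-eq : ∀ e y r ρ → SJ D y (λ f → φ (outcome e r ρ (advance m) f)) ≡ qₛ * qₛ * Y (e ⊛ y) r
    SJ-eq e y r ρ = trans (E-cong (coins j) λ ρ′ → pushes₂ {m = m} {D} (pushes m D h) (λ t w → φ (live (e ⊛ y) r ρ′ t w)))
      (E-* (coins j) (qₛ * qₛ) _)
    V : Parity → Vec Coin j → Vec Coin j → Fate (Slot j) (Vec Coin j) → ℚ
    V e r ρ f = φ (outcome e r ρ (advance m) f)
    h₁ : double m ℕ.≤ suc D
    h₁ = ℕ.m≤n⇒m≤1+n h
    push₁ : Pushes j m (suc D)
    push₁ = pushes {j} m (suc D) h₁
    stay-eq : ∀ e r ρ → S (suc D) (λ a → S (suc D) λ b → V e r ρ (stays a b)) ≡ qₛ * qₛ * X e r ρ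
    stay-eq e r ρ = trans (S-cong (suc D) λ a → S-cong (suc D) λ b → refl)
      (pushes₂ {j} {m} {suc D} push₁ (λ t w → φ (live e r ρ t w)))
    onCoins : ∀ e r ρ → silent e * (S (suc D) (λ a → S (suc D) λ b → V e r ρ (stays a b)) +
                         2ℚ * l * (u even * SJ D even (V e r ρ) + u odd * SJ D odd (V e r ρ))) + K e ≡
              A e * X e r ρ + (B e * Y (e ⊛ even) r + C e * Y (e ⊛ odd) r) + K e
    onCoins e r ρ = trans
      (cong (λ w → silent e * w + K e) (cong₂ (λ x y → x + 2ℚ * l * y) (stay-eq e r ρ)
        (cong₂ (λ x y → u even * x + u odd * y) (SJ-eq e even r ρ) (SJ-eq e odd r ρ))))
      (slot-eq (silent e) (qₛ * qₛ) (X e r ρ) l (u even) (u odd) (Y (e ⊛ even) r) (Y (e ⊛ odd) r) (K e))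
    onSlot : ∀ e r → E (coins (suc j)) (λ r′ → E₂ (suc (suc D)) λ t w → φ (advance (suc m) (slot e r r′ t w))) ≡
             A e * Y e r + (B e * Y (e ⊛ even) r + C e * Y (e ⊛ odd) r) + K e
    onSlot e r = begin
      E (coins (suc j)) (λ r′ → E₂ (suc (suc D)) λ t w → φ (advance (suc m) (slot e r r′ t w)))
        ≡⟨ E-cong (coins (suc j)) (λ { (c ∷ ρ) → refl }) ⟩
      E (coins (suc j)) (λ r′ → E₂ (suc (suc D)) λ t w → V e r (Vec.tail r′) (fate (slot e r r′ t w)))
        ≡⟨ E-fate D e r (V e r) ⟩
      E (coins j) (λ ρ → silent e * (S (suc D) (λ a → S (suc D) λ b → V e r ρ (stays a b)) +
                         2ℚ * l * (u even * SJ D even (V e r ρ) + u odd * SJ D odd (V e r ρ))) + K e)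
        ≡⟨ E-cong (coins j) (onCoins e r) ⟩
      E (coins j) (λ ρ → A e * X e r ρ + (B e * Y (e ⊛ even) r + C e * Y (e ⊛ odd) r) + K e)
        ≡⟨ E-lin {μ = coins j} (prob-coins j) (A e) (X e r) (B e) (λ _ → Y (e ⊛ even) r) (C e) (λ _ → Y (e ⊛ odd) r) (K e) ⟩
      A e * Y e r + (B e * E (coins j) (λ _ → Y (e ⊛ even) r) + C e * E (coins j) (λ _ → Y (e ⊛ odd) r)) + K e
        ≡⟨ cong₂ (λ x y → A e * Y e r + (B e * x + C e * y) + K e)
             (E-const {μ = coins j} (prob-coins j) (Y (e ⊛ even) r)) (E-const {μ = coins j} (prob-coins j) (Y (e ⊛ odd) r)) ⟩
      A e * Y e r + (B e * Y (e ⊛ even) r + C e * Y (e ⊛ odd) r) + K e ∎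
    Z-eq : ∀ e → E (coins j) (Y e) ≡ Z e
    Z-eq e = sym (T.E-edge e m φ)
    onEdge : ∀ e → Eₑ e (suc (suc D)) (λ s → φ (advance (suc m) s)) ≡ form e
    onEdge e = trans (E-cong (coins j) (onSlot e)) (trans
      (E-lin {μ = coins j} (prob-coins j) (A e) (Y e) (B e) (Y (e ⊛ even)) (C e) (Y (e ⊛ odd)) (K e))
      (cong₂ (λ x y → silent e * (qₛ * qₛ) * x + y + (1ℚ - silent e * survive) * φ (dead e)) (Z-eq e)
        (cong₂ (λ x y → silent e * (2ℚ * l * (qₛ * qₛ)) * u even * x + silent e * (2ℚ * l * (qₛ * qₛ)) * u odd * y) (Z-eq (e ⊛ even)) (Z-eq (e ⊛ odd)))))

  -- The mean gain at one dart, on the event that it is quiet: 2 for a neighbour dying behind an odd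
  -- edge, and 2 or 1 for an odd edge that is joined to an even or an odd one.
  Γ : ℚ
  Γ = 2ℚ * (q odd - u odd * survive) + u odd * (2ℚ * l * (qₛ * qₛ) * (2ℚ * u even + u odd))

  S-gain : ∀ {j} D → S {j} (suc (suc D)) (λ s → ι (gain s)) ≡ Γ
  S-gain {j} D = begin
    S {j} (suc (suc D)) (λ s → ι (gain s))
      ≡⟨ S-def {j} (suc (suc D)) (λ s → ι (gain s)) ⟩
    q even * Eₑ {j} even (suc (suc D)) (λ s → ι (gain s)) + q odd * Eₑ {j} odd (suc (suc D)) (λ s → ι (gain s))
      ≡⟨ cong₂ (λ x y → q even * x + q odd * y) onEven onOdd′ ⟩
    q even * 0ℚ + q odd * form
      ≡⟨ solve 7 (λ qe qo so l Q sv ue → let two = con 1ℚ :+ con 1ℚ in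
           qe :* con 0ℚ :+ qo :* (so :* (two :* l) :* (ue :* (Q :* two) :+ qo :* so :* Q) :+ (con 1ℚ :- so :* sv) :* two)
           := two :* (qo :- qo :* so :* sv) :+ qo :* so :* (two :* l :* Q :* (two :* ue :+ qo :* so))) refl
           (q even) (q odd) (silent odd) l (qₛ * qₛ) survive (u even) ⟩
    Γ ∎
    where
    form : ℚ
    form = silent odd * (2ℚ * l) * (u even * (qₛ * qₛ * 2ℚ) + u odd * (qₛ * qₛ)) + (1ℚ - silent odd * survive) * 2ℚ
    SS-const : ∀ D c → S {j} D (λ _ → S {j} D λ _ → c) ≡ qₛ * qₛ * c
    SS-const D c = trans (S-const {j} D _) (trans (cong (qₛ *_) (S-const {j} D c)) (sym (ℚ.*-assoc qₛ qₛ c)))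
    onEven : Eₑ {j} even (suc (suc D)) (λ s → ι (gain s)) ≡ 0ℚ
    onEven = trans (E-cong (coins j) λ r → E-0′ (suc j) (λ r′ → E₂ (suc (suc D)) λ t w → ι (gain (slot even r r′ t w)))
               λ r′ → trans (E-cong (tree (suc j) (suc (suc D))) λ t → E-0 (tree (suc j) (suc (suc D)))) (E-0 (tree (suc j) (suc (suc D)))))
             (E-0 (coins j))
      where
      E-0′ : ∀ i (f : Vec Coin i → ℚ) → (∀ v → f v ≡ 0ℚ) → E (coins i) f ≡ 0ℚ
      E-0′ i f h = trans (E-cong (coins i) h) (E-0 (coins i))
    V : Fate (Slot j) (Vec Coin j) → ℚ
    V f = ι (pay odd f)
    raw : ℚ
    raw = silent odd * (S {j} (suc D) (λ a → S {j} (suc D) λ b → V (stays a b)) +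
          2ℚ * l * (u even * SJ {j} D even V + u odd * SJ {j} D odd V)) + (1ℚ - silent odd * survive) * V dies
    onOdd′ : Eₑ {j} odd (suc (suc D)) (λ s → ι (gain s)) ≡ form
    onOdd′ = begin
      Eₑ {j} odd (suc (suc D)) (λ s → ι (gain s))
        ≡⟨ E-cong (coins j) (λ r → E-fate D odd r (λ _ → V)) ⟩
      E (coins j) (λ r → E (coins j) λ ρ → raw)
        ≡⟨ trans (E-const {μ = coins j} (prob-coins j) _) (E-const {μ = coins j} (prob-coins j) raw) ⟩
      raw
        ≡⟨ cong₂ (λ x y → silent odd * (x + 2ℚ * l * y) + (1ℚ - silent odd * survive) * 2ℚ)
             (trans (S-cong {j} (suc D) λ a → S-cong {j} (suc D) λ b → refl) (SS-const (suc D) 0ℚ))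
             (cong₂ (λ x y → u even * x + u odd * y)
               (trans (E-cong (coins j) λ ρ → trans (S-cong {j} D λ a → S-cong {j} D λ b → refl) (SS-const D 2ℚ)) (E-const {μ = coins j} (prob-coins j) _))
               (trans (E-cong (coins j) λ ρ → trans (S-cong {j} D λ a → S-cong {j} D λ b → refl) (SS-const D 1ℚ)) (E-const {μ = coins j} (prob-coins j) _))) ⟩
      silent odd * (qₛ * qₛ * 0ℚ + 2ℚ * l * (u even * (qₛ * qₛ * 2ℚ) + u odd * (qₛ * qₛ * 1ℚ))) + (1ℚ - silent odd * survive) * 2ℚ
        ≡⟨ solve 6 (λ so l Q sv ue uo → let two = con 1ℚ :+ con 1ℚ in
             so :* (Q :* con 0ℚ :+ two :* l :* (ue :* (Q :* two) :+ uo :* (Q :* con 1ℚ))) :+ (con 1ℚ :- so :* sv) :* two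
             := so :* (two :* l) :* (ue :* (Q :* two) :+ uo :* Q) :+ (con 1ℚ :- so :* sv) :* two) refl
             (silent odd) l (qₛ * qₛ) survive (u even) (u odd) ⟩
      form ∎

  E-allQuiet : ∀ {j} D (f : Slot j → Slot j → Slot j → ℕ) →
    E₃ (tree (suc j) (suc D)) (λ t v w → ι (allQuiet f (view t) (view v) (view w))) ≡
    S {j} D (λ a → S {j} D λ b → S {j} D λ c → ι (f a b c))
  E-allQuiet {j} D f = begin
    E₃ (tree (suc j) (suc D)) (λ t v w → ι (allQuiet f (view t) (view v) (view w)))
      ≡⟨ E-cong (tree (suc j) (suc D)) (λ t → E-cong (tree (suc j) (suc D)) λ v → only (λ w → ι (allQuiet f (view t) (view v) w)) (third₁ (view t) (view v)) (third₂ (view t) (view v))) ⟩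
    E (tree (suc j) (suc D)) (λ t → E (tree (suc j) (suc D)) λ v → S {j} D λ c → ι (allQuiet f (view t) (view v) (quiet c)))
      ≡⟨ E-cong (tree (suc j) (suc D)) (λ t → only (λ v → S {j} D λ c → ι (allQuiet f (view t) v (quiet c)))
           (S-0 (λ c → second₁ (view t) {c})) (S-0 (λ c → second₂ (view t) {c}))) ⟩
    E (tree (suc j) (suc D)) (λ t → S {j} D λ b → S {j} D λ c → ι (allQuiet f (view t) (quiet b) (quiet c)))
      ≡⟨ only (λ v → S {j} D λ b → S {j} D λ c → ι (allQuiet f v (quiet b) (quiet c))) (S-0 (λ _ → S-0 λ _ → refl)) (S-0 (λ _ → S-0 λ _ → refl)) ⟩
    S {j} D (λ a → S {j} D λ b → S {j} D λ c → ι (f a b c)) ∎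
    where
    only : (Ψ : View (Slot j) → ℚ) → Ψ lost ≡ 0ℚ → Ψ other ≡ 0ℚ → E (tree (suc j) (suc D)) (λ t → Ψ (view t)) ≡ S {j} D (λ a → Ψ (quiet a))
    only Ψ h₁ h₂ = trans (E-view D Ψ) (trans (cong₂ (λ x y → l * x + (S {j} D (λ a → Ψ (quiet a)) + (1ℚ - l - qₛ) * y)) h₁ h₂)
      (solve 3 (λ l s x → l :* con 0ℚ :+ (s :+ x :* con 0ℚ) := s) refl l (S {j} D (λ a → Ψ (quiet a))) (1ℚ - l - qₛ)))
    S-0 : {φ : Slot j → ℚ} → (∀ s → φ s ≡ 0ℚ) → S {j} D φ ≡ 0ℚ
    S-0 h = trans (S-cong {j} D h) (trans (S-const {j} D 0ℚ) (ℚ.*-zeroʳ qₛ))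
    third₁ : ∀ x y → ι (allQuiet f x y lost) ≡ 0ℚ
    third₁ lost y = refl
    third₁ other y = refl
    third₁ (quiet _) lost = refl
    third₁ (quiet _) other = refl
    third₁ (quiet _) (quiet _) = refl
    third₂ : ∀ x y → ι (allQuiet f x y other) ≡ 0ℚ
    third₂ lost y = refl
    third₂ other y = refl
    third₂ (quiet _) lost = refl
    third₂ (quiet _) other = refl
    third₂ (quiet _) (quiet _) = refl
    second₁ : ∀ x {c} → ι (allQuiet f x lost (quiet c)) ≡ 0ℚ
    second₁ lost = refl
    second₁ other = refl
    second₁ (quiet _) = refl
    second₂ : ∀ x {c} → ι (allQuiet f x other (quiet c)) ≡ 0ℚ
    second₂ lost = refl
    second₂ other = refl
    second₂ (quiet _) = refl

  -- Each of the three darts yields `Γ`, times `qₛ` for each of the two others that must be quiet as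
  -- well. The vertex itself survives with mass `qₛ` cubed and then sees three independent half
  -- trees of the next law.
  E-total : ∀ j → E₃ (tree (suc j) (suc (height (suc j)))) (λ t v w → ι (total (suc j) t v w)) ≡
    (1ℚ + 2ℚ) * (qₛ * qₛ) * Γ + qₛ * qₛ * qₛ * E₃ (T.tree j (suc (height j))) (λ t v w → ι (total j t v w))
  E-total j = go (height (suc j)) (suc (height j))
      (subst (λ D → S {j} D (λ s → ι (gain s)) ≡ Γ) height-eq (S-gain {j} (double (height j))))
      split (pushes (suc (height j)) (height (suc j)) ℕ.≤-refl)
    where
    height-eq : suc (suc (double (height j))) ≡ height (suc j)
    height-eq = refl
    parts : ℕ → Slot j → Slot j → Slot j → ℚ
    parts m a b c = (ι (gain a) + ι (gain b)) + (ι (gain c) + ι (total j (advance m a) (advance m b) (advance m c)))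
    split : ∀ a b c → ι (round j a b c) ≡ parts (suc (height j)) a b c
    split a b c = trans (ι-+ (gain a ℕ.+ gain b ℕ.+ gain c) rest)
        (trans (cong (_+ ι rest) (trans (ι-+ (gain a ℕ.+ gain b) (gain c)) (cong (_+ ι (gain c)) (ι-+ (gain a) (gain b)))))
        (ℚ.+-assoc (ι (gain a) + ι (gain b)) (ι (gain c)) (ι rest)))
      where
      rest : ℕ
      rest = total j (advance (suc (height j)) a) (advance (suc (height j)) b) (advance (suc (height j)) c)
    go : ∀ D m → S {j} D (λ s → ι (gain s)) ≡ Γ → (∀ a b c → ι (round j a b c) ≡ parts m a b c) → Pushes j m D →
         E₃ (tree (suc j) (suc D)) (λ t v w → ι (total (suc j) t v w)) ≡
         (1ℚ + 2ℚ) * (qₛ * qₛ) * Γ + qₛ * qₛ * qₛ * E₃ (T.tree j m) (λ t v w → ι (total j t v w))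
    go D m gain-eq split push = begin
      E₃ (tree (suc j) (suc D)) (λ t v w → ι (total (suc j) t v w))
        ≡⟨ E₃-cong (tree (suc j) (suc D)) (λ t v w → refl) ⟩
      E₃ (tree (suc j) (suc D)) (λ t v w → ι (allQuiet (round j) (view t) (view v) (view w)))
        ≡⟨ E-allQuiet D (round j) ⟩
      S {j} D (λ a → S {j} D λ b → S {j} D λ c → ι (round j a b c))
        ≡⟨ S-cong {j} D (λ a → S-cong {j} D λ b → trans (S-cong {j} D λ c → split a b c) (inner a b)) ⟩
      S {j} D (λ a → S {j} D λ b → (qₛ * ι (gain a) + qₛ * ι (gain b)) + (Γ + rest a b))
        ≡⟨ S-cong {j} D middle ⟩
      S {j} D (λ a → qₛ * qₛ * ι (gain a) + (2ℚ * qₛ * Γ + S {j} D (rest a)))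
        ≡⟨ S-+ {j} D (λ a → qₛ * qₛ * ι (gain a)) (λ a → 2ℚ * qₛ * Γ + S {j} D (rest a)) ⟩
      S {j} D (λ a → qₛ * qₛ * ι (gain a)) + S {j} D (λ a → 2ℚ * qₛ * Γ + S {j} D (rest a))
        ≡⟨ cong₂ _+_ (trans (S-* {j} D (qₛ * qₛ) (λ a → ι (gain a))) (cong (qₛ * qₛ *_) gain-eq))
             (trans (S-+ {j} D (λ _ → 2ℚ * qₛ * Γ) (λ a → S {j} D (rest a))) (cong₂ _+_ (S-const {j} D (2ℚ * qₛ * Γ)) outer)) ⟩
      qₛ * qₛ * Γ + (qₛ * (2ℚ * qₛ * Γ) + qₛ * (qₛ * qₛ * W))
        ≡⟨ solve 3 (λ q g w → let two = con 1ℚ :+ con 1ℚ in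
             q :* q :* g :+ (q :* (two :* q :* g) :+ q :* (q :* q :* w)) := (con 1ℚ :+ two) :* (q :* q) :* g :+ q :* q :* q :* w) refl qₛ Γ W ⟩
      (1ℚ + 2ℚ) * (qₛ * qₛ) * Γ + qₛ * qₛ * qₛ * W ∎
      where
      W : ℚ
      W = E₃ (T.tree j m) (λ t v w → ι (total j t v w))
      rest : Slot j → Slot j → ℚ
      rest a b = S {j} D λ c → ι (total j (advance m a) (advance m b) (advance m c))
      inner : ∀ a b → S {j} D (λ c → (ι (gain a) + ι (gain b)) + (ι (gain c) + ι (total j (advance m a) (advance m b) (advance m c)))) ≡
              (qₛ * ι (gain a) + qₛ * ι (gain b)) + (Γ + rest a b)
      inner a b = trans (S-+ {j} D (λ _ → ι (gain a) + ι (gain b)) (λ c → ι (gain c) + ι (total j (advance m a) (advance m b) (advance m c)))) (cong₂ _+_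
        (trans (S-const {j} D (ι (gain a) + ι (gain b))) (ℚ.*-distribˡ-+ qₛ (ι (gain a)) (ι (gain b))))
        (trans (S-+ {j} D (λ c → ι (gain c)) (λ c → ι (total j (advance m a) (advance m b) (advance m c)))) (cong (_+ rest a b) gain-eq)))
      middle : ∀ a → S {j} D (λ b → (qₛ * ι (gain a) + qₛ * ι (gain b)) + (Γ + rest a b)) ≡ qₛ * qₛ * ι (gain a) + (2ℚ * qₛ * Γ + S {j} D (rest a))
      middle a = trans (S-+ {j} D (λ b → qₛ * ι (gain a) + qₛ * ι (gain b)) (λ b → Γ + rest a b)) (trans (cong₂ _+_
        (trans (S-+ {j} D (λ _ → qₛ * ι (gain a)) (λ b → qₛ * ι (gain b)))
          (cong₂ _+_ (S-const {j} D (qₛ * ι (gain a))) (trans (S-* {j} D qₛ (λ b → ι (gain b))) (cong (qₛ *_) gain-eq))))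
        (trans (S-+ {j} D (λ _ → Γ) (rest a)) (cong (_+ S {j} D (rest a)) (S-const {j} D Γ))))
        (solve 4 (λ q x g r → (q :* (q :* x) :+ q :* g) :+ (q :* g :+ r) := q :* q :* x :+ ((con 1ℚ :+ con 1ℚ) :* q :* g :+ r)) refl
          qₛ (ι (gain a)) Γ (S {j} D (rest a))))
      outer : S {j} D (λ a → S {j} D (rest a)) ≡ qₛ * (qₛ * qₛ * W)
      outer = begin
        S {j} D (λ a → S {j} D (rest a))
          ≡⟨ S-cong {j} D (λ a → S-cong {j} D λ b → push (λ w → ι (total j (advance m a) (advance m b) w))) ⟩
        S {j} D (λ a → S {j} D λ b → qₛ * E (T.tree j m) (λ w → ι (total j (advance m a) (advance m b) w)))
          ≡⟨ pushes₂ {j} {m} {D} push (λ t v → qₛ * E (T.tree j m) (λ w → ι (total j t v w))) ⟩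
        qₛ * qₛ * T.E₂ m (λ t v → qₛ * E (T.tree j m) (λ w → ι (total j t v w)))
          ≡⟨ cong (qₛ * qₛ *_) (trans (E-cong (T.tree j m) λ t → E-* (T.tree j m) qₛ (λ v → E (T.tree j m) (λ w → ι (total j t v w))))
               (E-* (T.tree j m) qₛ (λ t → E (T.tree j m) λ v → E (T.tree j m) (λ w → ι (total j t v w))))) ⟩
        qₛ * qₛ * (qₛ * W)
          ≡⟨ solve 2 (λ q w → q :* q :* (q :* w) := q :* (q :* q :* w)) refl qₛ W ⟩
        qₛ * (qₛ * qₛ * W) ∎

-- Rounds on a graph

mapView : ∀ {A B} → (A → B) → View A → View B
mapView f lost      = lost
mapView f (quiet a) = quiet (f a)
mapView f other     = other

isQuiet : ∀ {A} → View A → Bool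
isQuiet (quiet _) = true
isQuiet _         = false

succ₁ succ₂ : Fin 3 → Fin 3
succ₁ zero             = suc zero
succ₁ (suc zero)       = suc (suc zero)
succ₁ (suc (suc zero)) = zero
succ₂ i = succ₁ (succ₁ i)

succ₁³ : ∀ i → succ₁ (succ₁ (succ₁ i)) ≡ i
succ₁³ zero             = refl
succ₁³ (suc zero)       = refl
succ₁³ (suc (suc zero)) = refl

cyclic-cases : ∀ (i k : Fin 3) → k ≡ i ⊎ (k ≡ succ₁ i ⊎ k ≡ succ₂ i)
cyclic-cases zero zero = inj₁ refl
cyclic-cases zero (suc zero) = inj₂ (inj₁ refl)
cyclic-cases zero (suc (suc zero)) = inj₂ (inj₂ refl)
cyclic-cases (suc zero) zero = inj₂ (inj₂ refl)
cyclic-cases (suc zero) (suc zero) = inj₁ refl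
cyclic-cases (suc zero) (suc (suc zero)) = inj₂ (inj₁ refl)
cyclic-cases (suc (suc zero)) zero = inj₂ (inj₁ refl)
cyclic-cases (suc (suc zero)) (suc zero) = inj₂ (inj₂ refl)
cyclic-cases (suc (suc zero)) (suc (suc zero)) = inj₁ refl

module Simulation (V : Set) where

  Dart : Set
  Dart = V × Fin 3

  turn₁ turn₂ : Dart → Dart
  turn₁ (v , i) = v , succ₁ i
  turn₂ (v , i) = v , succ₂ i

  data End : Set where
    lost kill : End
    live      : Parity → Dart → End

  deadEnd : Parity → End
  deadEnd even = lost
  deadEnd odd  = kill

  record State (j : ℕ) : Set where
    field
      end     : Dart → End
      label   : Dart → Vec Coin j
      end-sym : ∀ {d e f} → end d ≡ live e f → end f ≡ live e d

  module Unfold {j} (s : State j) where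
    open State s

    mutual
      -- This is a piece of the universal cover: vertices met again are unfolded again. Only the
      -- absence of short cycles will make its labels independent.
      unfold : ℕ → Dart → Half j
      unfold zero    d = leaf
      unfold (suc D) d = unfoldEnd D d (end d)

      unfoldEnd : ℕ → Dart → End → Half j
      unfoldEnd D d lost       = lost
      unfoldEnd D d kill       = kill
      unfoldEnd D d (live e f) = live e (label d) (label f) (unfold D (turn₁ f)) (unfold D (turn₂ f))

  open Unfold using (unfold)

  Link : Set
  Link = Parity × Dart

  module Local {j} (s : State (suc j)) where
    open State s
    open Unfold s using (unfoldEnd)

    rung : Dart → Parity → Bool
    rung d = rings (Vec.head (label d))

    viewEnd : Dart → End → View Link
    viewEnd d lost       = lost
    viewEnd d kill       = other
    viewEnd d (live e f) = if rung d e then other else quiet (e , f)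

    look : Dart → View Link
    look d = viewEnd d (end d)

    look-quiet : ∀ {d e f} → look d ≡ quiet (e , f) → end d ≡ live e f × rung d e ≡ false
    look-quiet {d} eq with end d
    ... | live e f with rung d e in r
    look-quiet refl | live e f | false = refl , r

    look-intro : ∀ {d e f} → end d ≡ live e f → rung d e ≡ false → look d ≡ quiet (e , f)
    look-intro {d} {e} eq r rewrite eq | r = refl

    joinLink : Link → Fate Link Dart
    joinLink (y , g) = if rung g y then dies else joinFate y g (look (turn₁ g)) (look (turn₂ g))

    linkFate : Link → Fate Link Dart
    linkFate (e , f) = if rung f e then dies else vertexFate joinLink (look (turn₁ f)) (look (turn₂ f))

    toSlot : ℕ → Dart → Link → Slot j
    toSlot D d (e , f) = slot e (Vec.tail (label d)) (label f) (unfold s D (turn₁ f)) (unfold s D (turn₂ f))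

    view-unfold : ∀ D d → view (unfold s (suc D) d) ≡ mapView (toSlot D d) (look d)
    view-unfold D d with end d
    ... | lost = refl
    ... | kill = refl
    ... | live e f with label d in eq
    ...   | c ∷ r with rings c e
    ...     | true  = refl
    ...     | false rewrite eq = refl

    toFate : ℕ → Dart → Fate Link Dart → Fate (Slot j) (Vec Coin j)
    toFate D f (stays a b)     = stays (toSlot (suc D) (turn₁ f) a) (toSlot (suc D) (turn₂ f) b)
    toFate D f (joins y g a b) = joins y (Vec.tail (label g)) (toSlot D (turn₁ g) a) (toSlot D (turn₂ g) b)
    toFate D f dies            = dies

    joinSlot-toSlot : ∀ D h f a → joinSlot (toSlot (suc D) h a) ≡ toFate D f (joinLink a)
    joinSlot-toSlot D h f (y , g) with label g in eq
    ... | c ∷ r with rings c y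
    ...   | true = refl
    ...   | false rewrite view-unfold D (turn₁ g) | view-unfold D (turn₂ g)
            with look (turn₁ g) | look (turn₂ g)
    ...     | lost    | _       = refl
    ...     | other   | _       = refl
    ...     | quiet _ | lost    = refl
    ...     | quiet _ | other   = refl
    ...     | quiet _ | quiet _ rewrite eq = refl

    -- The depth has two extra levels because a join looks past the neighbour at the vertex behind
    -- it.
    fate-toSlot : ∀ D d a → fate (toSlot (suc (suc D)) d a) ≡ toFate D (proj₂ a) (linkFate a)
    fate-toSlot D d (e , f) with label f
    ... | c ∷ r with rings c e
    ...   | true = refl
    ...   | false rewrite view-unfold (suc D) (turn₁ f) | view-unfold (suc D) (turn₂ f)
            with look (turn₁ f) | look (turn₂ f)
    ...     | lost    | lost    = refl
    ...     | lost    | other   = refl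
    ...     | lost    | quiet b = joinSlot-toSlot D (turn₂ f) f b
    ...     | other   | _       = refl
    ...     | quiet a | lost    = joinSlot-toSlot D (turn₁ f) f a
    ...     | quiet a | other   = refl
    ...     | quiet a | quiet b = refl

    -- The reasons for a fate, kept for inversion. The two constructors for a join tell which dart
    -- of the middle vertex is lost, since this changes when the path is read from its other end.
    data Spec (e : Parity) (f : Dart) : Fate Link Dart → Set where
      stays : ∀ {a b} → rung f e ≡ false → look (turn₁ f) ≡ quiet a → look (turn₂ f) ≡ quiet b → Spec e f (stays a b)
      join₁ : ∀ {y g a b} → rung f e ≡ false → look (turn₁ f) ≡ quiet (y , g) → look (turn₂ f) ≡ lost →
              rung g y ≡ false → look (turn₁ g) ≡ quiet a → look (turn₂ g) ≡ quiet b → Spec e f (joins y g a b)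
      join₂ : ∀ {y g a b} → rung f e ≡ false → look (turn₁ f) ≡ lost → look (turn₂ f) ≡ quiet (y , g) →
              rung g y ≡ false → look (turn₁ g) ≡ quiet a → look (turn₂ g) ≡ quiet b → Spec e f (joins y g a b)
      dies  : Spec e f dies

    spec : ∀ e f → Spec e f (linkFate (e , f))
    spec e f with rung f e in r
    ... | true = dies
    ... | false with look (turn₁ f) in p | look (turn₂ f) in q
    ...   | lost    | lost    = dies
    ...   | lost    | other   = dies
    ...   | other   | _       = dies
    ...   | quiet a | other   = dies
    ...   | quiet a | quiet b = stays r p q
    ...   | lost    | quiet (y , g) with rung g y in r′
    ...     | true = dies
    ...     | false with look (turn₁ g) in p′ | look (turn₂ g) in q′
    ...       | lost    | _       = dies
    ...       | other   | _       = dies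
    ...       | quiet _ | lost    = dies
    ...       | quiet _ | other   = dies
    ...       | quiet a | quiet b = join₂ r p q r′ p′ q′
    spec e f | false | quiet (y , g) | lost with rung g y in r′
    ...     | true = dies
    ...     | false with look (turn₁ g) in p′ | look (turn₂ g) in q′
    ...       | lost    | _       = dies
    ...       | other   | _       = dies
    ...       | quiet _ | lost    = dies
    ...       | quiet _ | other   = dies
    ...       | quiet a | quiet b = join₁ r p q r′ p′ q′

    linkFate-stays : ∀ {e f a b} → rung f e ≡ false → look (turn₁ f) ≡ quiet a → look (turn₂ f) ≡ quiet b →
                     linkFate (e , f) ≡ stays a b
    linkFate-stays r p q rewrite r | p | q = refl

    joinLink-joins : ∀ {y g a b} → rung g y ≡ false → look (turn₁ g) ≡ quiet a → look (turn₂ g) ≡ quiet b →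
                     joinLink (y , g) ≡ joins y g a b
    joinLink-joins r p q rewrite r | p | q = refl

    linkFate-join₁ : ∀ {e f c} → rung f e ≡ false → look (turn₁ f) ≡ quiet c → look (turn₂ f) ≡ lost →
                     linkFate (e , f) ≡ joinLink c
    linkFate-join₁ r p q rewrite r | p | q = refl

    linkFate-join₂ : ∀ {e f c} → rung f e ≡ false → look (turn₁ f) ≡ lost → look (turn₂ f) ≡ quiet c →
                     linkFate (e , f) ≡ joinLink c
    linkFate-join₂ r p q rewrite r | p | q = refl

    Quiet : V → Set
    Quiet v = ∀ i → ∃[ a ] look (v , i) ≡ quiet a

    quiet? : V → Bool
    quiet? v = isQuiet (look (v , zero)) ∧ isQuiet (look (v , suc zero)) ∧ isQuiet (look (v , suc (suc zero)))

    quiet?-sound : ∀ {v} → quiet? v ≡ true → Quiet v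
    quiet?-sound {v} eq i with look (v , zero) in p | look (v , suc zero) in q | look (v , suc (suc zero)) in r
    quiet?-sound eq zero             | quiet a | quiet b | quiet c = a , p
    quiet?-sound eq (suc zero)       | quiet a | quiet b | quiet c = b , q
    quiet?-sound eq (suc (suc zero)) | quiet a | quiet b | quiet c = c , r
    quiet?-sound () i | lost | _ | _
    quiet?-sound () i | other | _ | _
    quiet?-sound () i | quiet _ | lost | _
    quiet?-sound () i | quiet _ | other | _
    quiet?-sound () i | quiet _ | quiet _ | lost
    quiet?-sound () i | quiet _ | quiet _ | other

    quiet?-complete : ∀ {v} → Quiet v → quiet? v ≡ true
    quiet?-complete h rewrite proj₂ (h zero) | proj₂ (h (suc zero)) | proj₂ (h (suc (suc zero))) = refl

    quiet-by : ∀ {d a b c} → look d ≡ quiet a → look (turn₁ d) ≡ quiet b → look (turn₂ d) ≡ quiet c → Quiet (proj₁ d)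
    quiet-by {v , i} p q r k with cyclic-cases i k
    ... | inj₁ refl        = _ , p
    ... | inj₂ (inj₁ refl) = _ , q
    ... | inj₂ (inj₂ refl) = _ , r

    settle : Parity → Dart → Fate Link Dart → End
    settle e f (stays a b)     = live e f
    settle e f (joins y g a b) = live (e ⊛ y) g
    settle e f dies            = deadEnd e

    resolve : View Link → End
    resolve (quiet (e , f)) = settle e f (linkFate (e , f))
    resolve _               = kill

    -- A deleted vertex stays in the vertex set with `kill` at all its darts. It is thus never quiet
    -- again, and validity keeps it out of every later choice.
    end′ : Dart → End
    end′ (v , i) = if quiet? v then resolve (look (v , i)) else kill

    end′-quiet : ∀ {d e f} → Quiet (proj₁ d) → look d ≡ quiet (e , f) → end′ d ≡ settle e f (linkFate (e , f))
    end′-quiet {d} h p rewrite quiet?-complete h | p = refl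

    module _ {d e f} (h : Quiet (proj₁ d)) (p : look d ≡ quiet (e , f)) where

      back : rung f e ≡ false → look f ≡ quiet (e , d)
      back r = look-intro (end-sym (proj₁ (look-quiet p))) r

      stays-quiet : ∀ {a b} → rung f e ≡ false → look (turn₁ f) ≡ quiet a → look (turn₂ f) ≡ quiet b → Quiet (proj₁ f)
      stays-quiet r q₁ q₂ = quiet-by (back r) q₁ q₂

      stays-back : ∀ {a b} → rung f e ≡ false → look (turn₁ f) ≡ quiet a → look (turn₂ f) ≡ quiet b → end′ f ≡ live e d
      stays-back r q₁ q₂ rewrite end′-quiet (stays-quiet r q₁ q₂) (back r)
        | linkFate-stays {e} {d} (proj₂ (look-quiet p)) (proj₂ (h (succ₁ (proj₂ d)))) (proj₂ (h (succ₂ (proj₂ d)))) = refl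

      module _ {k y g a b} (hk : look k ≡ quiet (y , g)) (rg : rung g y ≡ false)
               (q₁ : look (turn₁ g) ≡ quiet a) (q₂ : look (turn₂ g) ≡ quiet b) where

        joins-look : look g ≡ quiet (y , k)
        joins-look = look-intro (end-sym (proj₁ (look-quiet hk))) rg

        joins-quiet : Quiet (proj₁ g)
        joins-quiet = quiet-by joins-look q₁ q₂

        joins-back : linkFate (y , k) ≡ joinLink (e , d) → end′ g ≡ live (e ⊛ y) d
        joins-back eq rewrite end′-quiet joins-quiet joins-look | eq
          | joinLink-joins {e} {d} (proj₂ (look-quiet p)) (proj₂ (h (succ₁ (proj₂ d)))) (proj₂ (h (succ₂ (proj₂ d))))
          | ⊛-comm e y = refl

    look-succ₁³ : ∀ {u i a} → look (u , i) ≡ a → look (u , succ₁ (succ₂ i)) ≡ a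
    look-succ₁³ {u} {i} eq = trans (cong (λ k → look (u , k)) (succ₁³ i)) eq

    -- Read from the far end, a join enters the middle vertex by the other live dart, so `join₁` and
    -- `join₂` change places; `⊛` being commutative, the parity agrees.
    end′-sym : ∀ {d e f} → end′ d ≡ live e f → end′ f ≡ live e d
    end′-sym {v , i} eq with quiet? v in qv
    ... | true with quiet?-sound qv i
    ...   | (e , f) , p rewrite p with linkFate (e , f) | spec e f
    end′-sym {v , i} refl | true | (e , f) , p | stays a b | stays r q₁ q₂ = stays-back (quiet?-sound qv) p r q₁ q₂
    end′-sym {v , i} refl | true | (e , f) , p | joins y g a b | join₁ r s₁ s₂ r′ q₁ q₂ =
      joins-back (quiet?-sound qv) p s₁ r′ q₁ q₂
        (linkFate-join₂ {y} {turn₁ f} (proj₂ (look-quiet s₁)) s₂ (look-succ₁³ (back (quiet?-sound qv) p r)))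
    end′-sym {v , i} refl | true | (e , f) , p | joins y g a b | join₂ r s₁ s₂ r′ q₁ q₂ =
      joins-back (quiet?-sound qv) p s₂ r′ q₁ q₂
        (linkFate-join₁ {y} {turn₂ f} (proj₂ (look-quiet s₂)) (look-succ₁³ (back (quiet?-sound qv) p r)) (look-succ₁³ s₁))
    end′-sym {v , i} () | true | (even , f) , p | dies | _
    end′-sym {v , i} () | true | (odd , f) , p | dies | _

    after : State j
    after = record { end = end′ ; label = λ d → Vec.tail (label d) ; end-sym = end′-sym }

    -- The round on the graph and the round on trees commute. The induction goes on because every
    -- edge that is live afterwards ends at a quiet vertex.
    unfold-after : ∀ m D → double m ℕ.≤ D → ∀ {d a} → Quiet (proj₁ d) → look d ≡ quiet a →
                   unfold after m d ≡ advance m (toSlot D d a)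
    unfold-after zero D le h p = refl
    unfold-after (suc m) (suc (suc D)) (ℕ.s≤s (ℕ.s≤s le)) {d} {e , f} h p
      rewrite end′-quiet h p = go
      where
      adv : ∀ ρ → advance (suc m) (toSlot (suc (suc D)) d (e , f)) ≡
            outcome e (Vec.tail (label d)) (Vec.tail (label f)) (advance m) (fate (toSlot (suc (suc D)) d (e , f)))
      adv ρ with label f
      ... | c ∷ r = refl
      go : Unfold.unfoldEnd after m d (settle e f (linkFate (e , f))) ≡ advance (suc m) (toSlot (suc (suc D)) d (e , f))
      go rewrite adv 0 | fate-toSlot D d (e , f) with linkFate (e , f) | spec e f
      ... | stays a b | stays r q₁ q₂ = cong₂ (live e _ _)
              (unfold-after m (suc D) (ℕ.m≤n⇒m≤1+n le) (stays-quiet h p r q₁ q₂) q₁)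
              (unfold-after m (suc D) (ℕ.m≤n⇒m≤1+n le) (stays-quiet h p r q₁ q₂) q₂)
      ... | joins y g a b | join₁ r s₁ s₂ r′ q₁ q₂ = cong₂ (live (e ⊛ y) _ _)
              (unfold-after m D le (joins-quiet h p s₁ r′ q₁ q₂) q₁) (unfold-after m D le (joins-quiet h p s₁ r′ q₁ q₂) q₂)
      ... | joins y g a b | join₂ r s₁ s₂ r′ q₁ q₂ = cong₂ (live (e ⊛ y) _ _)
              (unfold-after m D le (joins-quiet h p s₂ r′ q₁ q₂) q₁) (unfold-after m D le (joins-quiet h p s₂ r′ q₁ q₂) q₂)
      ... | dies | _ = dead-eq e
        where
        dead-eq : ∀ e → Unfold.unfoldEnd after m d (deadEnd e) ≡ dead e
        dead-eq even = refl
        dead-eq odd  = refl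

    payView : View Link → ℕ
    payView (quiet (e , f)) = pay e (linkFate (e , f))
    payView _               = 0

    gainAt : V → ℕ
    gainAt v = if quiet? v then sum (λ i → payView (look (v , i))) else 0

    pay-toFate : ∀ D f e φ → pay e (toFate D f φ) ≡ pay e φ
    pay-toFate D f even φ                  = refl
    pay-toFate D f odd  (stays _ _)        = refl
    pay-toFate D f odd  (joins even _ _ _) = refl
    pay-toFate D f odd  (joins odd _ _ _)  = refl
    pay-toFate D f odd  dies               = refl

    gain-toSlot : ∀ D d a → gain (toSlot (suc (suc D)) d a) ≡ payView (quiet a)
    gain-toSlot D d (e , f) = trans (cong (pay e) (fate-toSlot D d (e , f))) (pay-toFate D f e (linkFate (e , f)))

  remaining : ∀ j → State j → V → ℕ
  remaining zero    s v = 0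
  remaining (suc j) s v = Local.gainAt s v ℕ.+ (if Local.quiet? s v then remaining j (Local.after s) v else 0)

  totalAt : ∀ j → State j → V → ℕ
  totalAt j s v = total j (unfold s D (v , zero)) (unfold s D (v , suc zero)) (unfold s D (v , suc (suc zero)))
    where
    D = suc (height j)

  remaining-total : ∀ j (s : State j) v → remaining j s v ≡ totalAt j s v
  remaining-total zero    s v = refl
  remaining-total (suc j) s v = trans (go (look (v , zero)) (look (v , suc zero)) (look (v , suc (suc zero))) refl refl refl) (sym views)
    where
    open Local s
    D : ℕ
    D = double (height j)
    slotAt : Fin 3 → Link → Slot j
    slotAt i = toSlot (suc (suc D)) (v , i)
    views : totalAt (suc j) s v ≡ allQuiet (round j) (mapView (slotAt zero) (look (v , zero)))
              (mapView (slotAt (suc zero)) (look (v , suc zero))) (mapView (slotAt (suc (suc zero))) (look (v , suc (suc zero))))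
    views rewrite view-unfold (suc (suc D)) (v , zero) | view-unfold (suc (suc D)) (v , suc zero) | view-unfold (suc (suc D)) (v , suc (suc zero)) = refl
    go : ∀ x y z → look (v , zero) ≡ x → look (v , suc zero) ≡ y → look (v , suc (suc zero)) ≡ z →
         remaining (suc j) s v ≡ allQuiet (round j) (mapView (slotAt zero) x) (mapView (slotAt (suc zero)) y) (mapView (slotAt (suc (suc zero))) z)
    go lost      y         z     p q r rewrite p = refl
    go other     y         z     p q r rewrite p = refl
    go (quiet _) lost      z     p q r rewrite p | q = refl
    go (quiet _) other     z     p q r rewrite p | q = refl
    go (quiet _) (quiet _) lost  p q r rewrite p | q | r = refl
    go (quiet _) (quiet _) other p q r rewrite p | q | r = refl
    go (quiet a) (quiet b) (quiet c) p q r = begin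
      gainAt v ℕ.+ (if quiet? v then remaining j after v else 0)
        ≡⟨ cong₂ ℕ._+_ gain-eq (cong (λ w → if w then remaining j after v else 0) (quiet?-complete h)) ⟩
      payView (quiet a) ℕ.+ (payView (quiet b) ℕ.+ (payView (quiet c) ℕ.+ 0)) ℕ.+ remaining j after v
        ≡⟨ cong₂ ℕ._+_ (reassoc (payView (quiet a)) (payView (quiet b)) (payView (quiet c))) (remaining-total j after v) ⟩
      payView (quiet a) ℕ.+ payView (quiet b) ℕ.+ payView (quiet c) ℕ.+ totalAt j after v
        ≡⟨ cong₂ ℕ._+_ (sym (cong₂ ℕ._+_ (cong₂ ℕ._+_ (gain-toSlot D (v , zero) a) (gain-toSlot D (v , suc zero) b)) (gain-toSlot D (v , suc (suc zero)) c)))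
             (total-cong (step zero p) (step (suc zero) q) (step (suc (suc zero)) r)) ⟩
      round j (slotAt zero a) (slotAt (suc zero) b) (slotAt (suc (suc zero)) c) ∎
      where
      open ≡-Reasoning
      h : Quiet v
      h zero             = a , p
      h (suc zero)       = b , q
      h (suc (suc zero)) = c , r
      reassoc : ∀ x y z → x ℕ.+ (y ℕ.+ (z ℕ.+ 0)) ≡ x ℕ.+ y ℕ.+ z
      reassoc x y z = trans (cong (λ w → x ℕ.+ (y ℕ.+ w)) (ℕ.+-identityʳ z)) (sym (ℕ.+-assoc x y z))
      gain-eq : gainAt v ≡ payView (quiet a) ℕ.+ (payView (quiet b) ℕ.+ (payView (quiet c) ℕ.+ 0))
      gain-eq rewrite p | q | r = refl
      step : ∀ i {a} → look (v , i) ≡ quiet a → unfold after (suc (height j)) (v , i) ≡ advance (suc (height j)) (slotAt i a)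
      step i p = unfold-after (suc (height j)) (suc (suc D)) ℕ.≤-refl h p
      total-cong : ∀ {t t′ u u′ w w′} → t ≡ t′ → u ≡ u′ → w ≡ w′ → total j t u w ≡ total j t′ u′ w′
      total-cong refl refl refl = refl

-- Independent sets from rounds

b2n : Bool → ℕ
b2n true  = 1
b2n false = 0

sum-mono : ∀ {n} {f g : Fin n → ℕ} → (∀ i → f i ℕ.≤ g i) → sum f ℕ.≤ sum g
sum-mono {zero}  h = ℕ.z≤n
sum-mono {suc n} h = ℕ.+-mono-≤ (h zero) (sum-mono (λ i → h (suc i)))

sum-darts : ∀ N (f : Fin N × Fin 3 → ℕ) →
            sum {N ℕ.* 3} (λ x → f (Fin.remQuot 3 x)) ≡ sum λ v → sum λ i → f (v , i)
sum-darts zero    f = refl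
sum-darts (suc N) f = trans
  (cong (λ s → f (zero , zero) ℕ.+ (f (zero , suc zero) ℕ.+ (f (zero , suc (suc zero)) ℕ.+ s))) (sum-darts N λ { (v , i) → f (suc v , i) }))
  (reassoc (f (zero , zero)) (f (zero , suc zero)) (f (zero , suc (suc zero))) _)
  where
  reassoc : ∀ a b c s → a ℕ.+ (b ℕ.+ (c ℕ.+ s)) ≡ (a ℕ.+ (b ℕ.+ (c ℕ.+ 0))) ℕ.+ s
  reassoc a b c s = trans (cong (λ w → a ℕ.+ (b ℕ.+ (w ℕ.+ s))) (sym (ℕ.+-identityʳ c)))
    (trans (cong (a ℕ.+_) (sym (ℕ.+-assoc b (c ℕ.+ 0) s))) (sym (ℕ.+-assoc a _ s)))

-- Used for discharging: what is sent along all darts equals what is received at their other ends.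
sum-involution : ∀ N (σ : Fin N × Fin 3 → Fin N × Fin 3) → (∀ d → σ (σ d) ≡ d) → (f : Fin N × Fin 3 → ℕ) →
                 sum (λ v → sum λ i → f (v , i)) ≡ sum λ v → sum λ i → f (σ (v , i))
sum-involution N σ inv f = trans (sym (sum-darts N f)) (trans (sum-permute (λ x → f (Fin.remQuot 3 x)) π)
  (trans (sum-cong-≗ {N ℕ.* 3} (λ x → cong f (Fin.remQuot-combine (proj₁ (σ (Fin.remQuot 3 x))) (proj₂ (σ (Fin.remQuot 3 x))))))
    (sum-darts N (λ d → f (σ d)))))
  where
  to : Fin (N ℕ.* 3) → Fin (N ℕ.* 3)
  to x = Fin.combine (proj₁ (σ (Fin.remQuot 3 x))) (proj₂ (σ (Fin.remQuot 3 x)))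
  to-to : ∀ x → to (to x) ≡ x
  to-to x = trans (cong (λ d → Fin.combine (proj₁ (σ d)) (proj₂ (σ d))) (Fin.remQuot-combine {N} {3} (proj₁ (σ (Fin.remQuot 3 x))) (proj₂ (σ (Fin.remQuot 3 x)))))
    (trans (cong (λ d → Fin.combine (proj₁ d) (proj₂ d)) (inv (Fin.remQuot 3 x))) (Fin.combine-remQuot {N} 3 x))
  π = permutation to to to-to to-to

-- Whether a vertex joining two paths is chosen, given the parities of the paths and the choices at their far ends.
rule : Parity → Parity → Bool → Bool → Bool
rule even even σ τ = not σ ∧ not τ
rule even odd  σ τ = not σ
rule odd  even σ τ = not τ
rule odd  odd  σ τ = σ ∨ τ

rule-comm : ∀ e y σ τ → rule e y σ τ ≡ rule y e τ σ
rule-comm even even true  true  = refl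
rule-comm even even true  false = refl
rule-comm even even false true  = refl
rule-comm even even false false = refl
rule-comm even odd  σ τ = refl
rule-comm odd  even σ τ = refl
rule-comm odd  odd true  true  = refl
rule-comm odd  odd true  false = refl
rule-comm odd  odd false true  = refl
rule-comm odd  odd false false = refl

rule-even : ∀ y τ → rule even y true τ ≡ false
rule-even even τ = refl
rule-even odd  τ = refl

edgeTally : Parity → Bool → Bool → ℕ
edgeTally even σ τ = 0
edgeTally odd  σ τ = b2n (not (σ ∨ τ))

-- How the contribution 2 of a chosen vertex inside a path is divided between its two sides.
share : Parity → Parity → ℕ
share even even = 1
share even odd  = 0
share odd  even = 2
share odd  odd  = 1

share-sum : ∀ e y → share e y ℕ.+ share y e ≡ 2
share-sum even even = refl
share-sum even odd  = refl
share-sum odd  even = refl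
share-sum odd  odd  = refl

payJoin : Parity → Parity → ℕ
payJoin even y    = 0
payJoin odd  even = 2
payJoin odd  odd  = 1

pay-joins : ∀ {A B : Set} e y {b : B} {s s′ : A} → pay e (joins y b s s′) ≡ payJoin e y
pay-joins even y    = refl
pay-joins odd  even = refl
pay-joins odd  odd  = refl

pay-stays : ∀ {A B : Set} e {s s′ : A} → pay {A} {B} e (stays s s′) ≡ 0
pay-stays even = refl
pay-stays odd  = refl

-- The balance on one side of a merged path. The end of parity `e` inherits both tallies of its old
-- edge and its share of the middle vertex; this covers the tally of the new edge and the gain paid
-- at that end.
join-tally : ∀ e y σ τ → (e ⊛ y ≡ even → σ ≡ true → τ ≡ false) →
  edgeTally (e ⊛ y) σ τ ℕ.+ payJoin e y ℕ.≤
  edgeTally e σ (rule e y σ τ) ℕ.+ (edgeTally e (rule e y σ τ) σ ℕ.+ share e y ℕ.* b2n (rule e y σ τ))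
join-tally even even true  true  h = ℕ.≤ᵇ⇒≤ _ _ tt
join-tally even even true  false h = ℕ.≤ᵇ⇒≤ _ _ tt
join-tally even even false true  h = ℕ.≤ᵇ⇒≤ _ _ tt
join-tally even even false false h = ℕ.≤ᵇ⇒≤ _ _ tt
join-tally even odd  true  τ     h = ℕ.≤ᵇ⇒≤ _ _ tt
join-tally even odd  false τ     h = ℕ.≤ᵇ⇒≤ _ _ tt
-- The merged path is even, so its ends cannot both be chosen.
join-tally odd  even true  true  h with () ← h refl refl
join-tally odd  even true  false h = ℕ.≤ᵇ⇒≤ _ _ tt
join-tally odd  even false true  h = ℕ.≤ᵇ⇒≤ _ _ tt
join-tally odd  even false false h = ℕ.≤ᵇ⇒≤ _ _ tt
join-tally odd  odd  true  true  h = ℕ.≤ᵇ⇒≤ _ _ tt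
join-tally odd  odd  true  false h = ℕ.≤ᵇ⇒≤ _ _ tt
join-tally odd  odd  false true  h = ℕ.≤ᵇ⇒≤ _ _ tt
join-tally odd  odd  false false h = ℕ.≤ᵇ⇒≤ _ _ tt

-- The difference `k - i` modulo 3: the place of dart `k` relative to the lost dart `i`.
offset : Fin 3 → Fin 3 → Fin 3
offset zero             k = k
offset (suc zero)       k = succ₂ k
offset (suc (suc zero)) k = succ₁ k

offset-1 : ∀ i → offset i (succ₁ i) ≡ suc zero
offset-1 zero             = refl
offset-1 (suc zero)       = refl
offset-1 (suc (suc zero)) = refl

offset-2 : ∀ i → offset i (succ₂ i) ≡ suc (suc zero)
offset-2 zero             = refl
offset-2 (suc zero)       = refl
offset-2 (suc (suc zero)) = refl

open ℕ-Solver.+-*-Solver using () renaming (solve to ℕ-solve; _:+_ to _⊹_; _:*_ to _⊠_; _:=_ to _≙_; con to con⁰)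

module Certificate (N : ℕ) where
  open Simulation (Fin N)

  tally : ∀ {j} → State j → (Fin N → Bool) → Dart → ℕ
  tally s S d with State.end s d
  ... | live e f = edgeTally e (S (proj₁ d)) (S (proj₁ f))
  ... | _        = 0

  tally-live : ∀ {j} (s : State j) S {d e f} → State.end s d ≡ live e f → tally s S d ≡ edgeTally e (S (proj₁ d)) (S (proj₁ f))
  tally-live s S {d} eq with State.end s d
  tally-live s S refl | live e f = refl

  weight : ∀ {j} → State j → (Fin N → Bool) → Fin N → ℕ
  weight s S v = 2 ℕ.* b2n (S v) ℕ.+ sum λ i → tally s S (v , i)

  -- What the gains already paid presuppose. An odd path that lost its other end has been credited
  -- with its additional vertex, so the remaining end must stay unchosen; an even path can have half
  -- of its inner vertices chosen only if its ends are not both chosen. On an even edge without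
  -- inner vertices, `apart` is ordinary independence.
  record Valid {j} (s : State j) (S : Fin N → Bool) : Set where
    field
      killed : ∀ {d} → State.end s d ≡ kill → S (proj₁ d) ≡ false
      apart  : ∀ {d f} → State.end s d ≡ live even f → S (proj₁ d) ≡ true → S (proj₁ f) ≡ false

  module Extend {j} (s : State (suc j)) (S : Fin N → Bool) (valid : Valid (Local.after s) S) where
    open State s
    open Local s
    open Valid valid

    good : Link → Bool
    good (y , g) = not (rung g y) ∧ isQuiet (look (turn₁ g)) ∧ isQuiet (look (turn₂ g))

    good-sound : ∀ {y g} → good (y , g) ≡ true →
      rung g y ≡ false × ∃[ a ] ∃[ b ] (look (turn₁ g) ≡ quiet a × look (turn₂ g) ≡ quiet b)
    good-sound {y} {g} eq with rung g y | look (turn₁ g) | look (turn₂ g)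
    ... | false | quiet a | quiet b = refl , a , b , refl , refl

    good-complete : ∀ {y g a b} → rung g y ≡ false → look (turn₁ g) ≡ quiet a → look (turn₂ g) ≡ quiet b → good (y , g) ≡ true
    good-complete r p q rewrite r | p | q = refl

    data Role : Set where
      remain : Role
      middle : Fin 3 → Link → Link → Role
      idle   : Role

    tryMiddle : Fin 3 → Link → Link → Role
    tryMiddle i a b = if good a ∧ good b then middle i a b else idle

    roleOf : View Link → View Link → View Link → Role
    roleOf lost      (quiet a) (quiet b) = tryMiddle zero a b
    roleOf (quiet b) lost      (quiet a) = tryMiddle (suc zero) a b
    roleOf (quiet a) (quiet b) lost      = tryMiddle (suc (suc zero)) a b
    roleOf _         _         _         = idle

    role : Fin N → Role
    role v = if quiet? v then remain else roleOf (look (v , zero)) (look (v , suc zero)) (look (v , suc (suc zero)))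

    data RoleSpec (v : Fin N) : Role → Set where
      remain : Quiet v → RoleSpec v remain
      middle : ∀ {i a b} → look (v , i) ≡ lost → look (v , succ₁ i) ≡ quiet a → look (v , succ₂ i) ≡ quiet b →
               good a ≡ true → good b ≡ true → RoleSpec v (middle i a b)
      idle   : ¬ Quiet v → RoleSpec v idle

    role-spec : ∀ v → RoleSpec v (role v)
    role-spec v with quiet? v in qv
    ... | true  = remain (quiet?-sound qv)
    ... | false = roleOf-spec refl refl refl
      where
      ¬quiet : ¬ Quiet v
      ¬quiet h with () ← trans (sym qv) (quiet?-complete h)
      tryMiddle-spec : ∀ {i a b} → look (v , i) ≡ lost → look (v , succ₁ i) ≡ quiet a → look (v , succ₂ i) ≡ quiet b →
                       RoleSpec v (tryMiddle i a b)
      tryMiddle-spec {i} {a} {b} p q r with good a in ga | good b in gb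
      ... | true  | true  = middle p q r ga gb
      ... | true  | false = idle ¬quiet
      ... | false | _     = idle ¬quiet
      roleOf-spec : ∀ {x y z} → look (v , zero) ≡ x → look (v , suc zero) ≡ y → look (v , suc (suc zero)) ≡ z →
                    RoleSpec v (roleOf x y z)
      roleOf-spec {lost}    {lost}    {_}       p q r = idle ¬quiet
      roleOf-spec {lost}    {other}   {_}       p q r = idle ¬quiet
      roleOf-spec {lost}    {quiet _} {lost}    p q r = idle ¬quiet
      roleOf-spec {lost}    {quiet _} {other}   p q r = idle ¬quiet
      roleOf-spec {lost}    {quiet a} {quiet b} p q r = tryMiddle-spec p q r
      roleOf-spec {other}   {_}       {_}       p q r = idle ¬quiet
      roleOf-spec {quiet _} {lost}    {lost}    p q r = idle ¬quiet
      roleOf-spec {quiet _} {lost}    {other}   p q r = idle ¬quiet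
      roleOf-spec {quiet b} {lost}    {quiet a} p q r = tryMiddle-spec q r p
      roleOf-spec {quiet _} {other}   {_}       p q r = idle ¬quiet
      roleOf-spec {quiet a} {quiet b} {lost}    p q r = tryMiddle-spec r p q
      roleOf-spec {quiet _} {quiet _} {other}   p q r = idle ¬quiet
      roleOf-spec {quiet _} {quiet _} {quiet _} p q r = idle ¬quiet

    role-remain : ∀ {v} → Quiet v → role v ≡ remain
    role-remain h rewrite quiet?-complete h = refl

    role-middle : ∀ {v} i {a b} → look (v , i) ≡ lost → look (v , succ₁ i) ≡ quiet a → look (v , succ₂ i) ≡ quiet b →
                  good a ≡ true → good b ≡ true → role v ≡ middle i a b
    role-middle zero             p q r ga gb rewrite p | q | r | ga | gb = refl
    role-middle (suc zero)       p q r ga gb rewrite p | q | r | ga | gb = refl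
    role-middle (suc (suc zero)) p q r ga gb rewrite p | q | r | ga | gb = refl

    ruleAt : Link → Link → Bool
    ruleAt (e , d) (y , g) = rule e y (S (proj₁ d)) (S (proj₁ g))

    choose : Role → Bool → Bool
    choose remain         b = b
    choose (middle _ a c) b = ruleAt a c
    choose idle           b = false

    S⁺ : Fin N → Bool
    S⁺ v = choose (role v) (S v)

    -- The discharging rule at a middle vertex: each of its two live darts sends its own tally
    -- together with a share of the weight 2 of that vertex. An idle vertex sends its tallies alone,
    -- a surviving one nothing.
    portion : Link → Link → Fin 3 → ℕ → ℕ
    portion a b zero             t = 0
    portion a b (suc zero)       t = t ℕ.+ share (proj₁ a) (proj₁ b) ℕ.* b2n (ruleAt a b)
    portion a b (suc (suc zero)) t = t ℕ.+ share (proj₁ b) (proj₁ a) ℕ.* b2n (ruleAt a b)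

    outflow : Role → Fin 3 → ℕ → ℕ
    outflow remain         k t = 0
    outflow (middle i a b) k t = portion a b (offset i k) t
    outflow idle           k t = t

    out : Dart → ℕ
    out (u , k) = outflow (role u) k (tally s S⁺ (u , k))

    S⁺-quiet : ∀ {v} → Quiet v → S⁺ v ≡ S v
    S⁺-quiet h rewrite role-remain h = refl

    data Partner (d : Dart) (e : Parity) (f : Dart) : Fate Link Dart → Set where
      stays : ∀ {a b} → Quiet (proj₁ f) → end′ d ≡ live e f → Partner d e f (stays a b)
      join₁ : ∀ {y g a b} i → end′ d ≡ live (e ⊛ y) g → role (proj₁ f) ≡ middle i (e , d) (y , g) →
              offset i (proj₂ f) ≡ suc zero → Partner d e f (joins y g a b)
      join₂ : ∀ {y g a b} i → end′ d ≡ live (e ⊛ y) g → role (proj₁ f) ≡ middle i (y , g) (e , d) →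
              offset i (proj₂ f) ≡ suc (suc zero) → Partner d e f (joins y g a b)
      dies  : end′ d ≡ deadEnd e → role (proj₁ f) ≡ idle → Partner d e f dies

    -- The fate seen along a dart is consistent with the role that the neighbour finds for itself;
    -- in particular `dies` seen from one surviving end means idle, hence unchosen.
    partner : ∀ {d e f} → Quiet (proj₁ d) → look d ≡ quiet (e , f) → Partner d e f (linkFate (e , f))
    partner {d} {e} {u , k} h p with linkFate (e , u , k) in eq | spec e (u , k) | end′-quiet h p
    ... | stays a b | stays r q₁ q₂ | st = stays (stays-quiet h p r q₁ q₂) st
    ... | joins y g a b | join₁ r s₁ s₂ r′ q₁ q₂ | st = join₁ (succ₂ k) st
          (role-middle (succ₂ k) s₂ (look-succ₁³ (back h p r)) (trans (cong (λ i → look (u , succ₁ i)) (succ₁³ k)) s₁)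
            (good-complete {e} {d} (proj₂ (look-quiet p)) (proj₂ (h (succ₁ (proj₂ d)))) (proj₂ (h (succ₂ (proj₂ d)))))
            (good-complete {y} {g} r′ q₁ q₂))
          (trans (cong (offset (succ₂ k)) (sym (succ₁³ k))) (offset-1 (succ₂ k)))
    ... | joins y g a b | join₂ r s₁ s₂ r′ q₁ q₂ | st = join₂ (succ₁ k) st
          (role-middle (succ₁ k) s₁ s₂ (look-succ₁³ (back h p r))
            (good-complete {y} {g} r′ q₁ q₂)
            (good-complete {e} {d} (proj₂ (look-quiet p)) (proj₂ (h (succ₁ (proj₂ d)))) (proj₂ (h (succ₂ (proj₂ d))))))
          (trans (cong (offset (succ₁ k)) (sym (succ₁³ k))) (offset-2 (succ₁ k)))
    ... | dies | _ | st = dies st (role-idle (role-spec u))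
      where
      end-f : end (u , k) ≡ live e d
      end-f = end-sym (proj₁ (look-quiet p))
      live-look : ∀ {a} → look (u , k) ≡ quiet a → a ≡ (e , d) × rung (u , k) e ≡ false
      live-look {a , g} q with look-quiet q
      ... | en , r with refl ← trans (sym en) end-f = refl , r
      live-lost : look (u , k) ≡ lost → ⊥
      live-lost q rewrite end-f with rung (u , k) e
      live-lost () | true
      live-lost () | false
      bad : ∀ {c} → good c ≡ true → linkFate (e , u , k) ≡ joinLink c → ⊥
      bad {y , g} gc h₁ with good-sound gc
      ... | r , a , b , q₁ , q₂ with () ← trans (sym eq) (trans h₁ (joinLink-joins r q₁ q₂))
      role-idle : ∀ {ρ} → RoleSpec u ρ → ρ ≡ idle
      role-idle (idle _) = refl
      role-idle (remain hu) with () ← trans (sym eq)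
        (linkFate-stays (proj₂ (live-look (proj₂ (hu k)))) (proj₂ (hu (succ₁ k))) (proj₂ (hu (succ₂ k))))
      role-idle (middle {i} p₀ p₁ p₂ ga gb) with cyclic-cases i k
      ... | inj₁ refl = ⊥-elim (live-lost p₀)
      ... | inj₂ (inj₁ refl) = ⊥-elim (bad gb (linkFate-join₁ (proj₂ (live-look p₁)) p₂ (look-succ₁³ p₀)))
      ... | inj₂ (inj₂ refl) = ⊥-elim (bad ga (linkFate-join₂ (proj₂ (live-look p₂)) (look-succ₁³ p₀)
              (trans (cong (λ i → look (u , succ₁ i)) (succ₁³ i)) p₁)))

    good-quiet : ∀ {d e f} → end d ≡ live e f → good (e , f) ≡ true → Quiet (proj₁ f)
    good-quiet {d} {e} {f} en g with good-sound g
    ... | r , a , b , q₁ , q₂ = quiet-by (look-intro (end-sym en) r) q₁ q₂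

    valid⁺ : Valid s S⁺
    valid⁺ = record { killed = killed⁺ ; apart = apart⁺ }
      where
      look-kill : ∀ {d} → end d ≡ kill → look d ≡ other
      look-kill eq rewrite eq = refl
      killed⁺ : ∀ {d} → end d ≡ kill → S⁺ (proj₁ d) ≡ false
      killed⁺ {v , k} en with role v | role-spec v
      ... | idle   | _        = refl
      ... | remain | remain h with () ← trans (sym (look-kill en)) (proj₂ (h k))
      ... | middle i a b | middle p₀ p₁ p₂ _ _ with cyclic-cases i k
      ...   | inj₁ refl with () ← trans (sym (look-kill en)) p₀
      ...   | inj₂ (inj₁ refl) with () ← trans (sym (look-kill en)) p₁
      ...   | inj₂ (inj₂ refl) with () ← trans (sym (look-kill en)) p₂
      look-live : ∀ {d e f a} → end d ≡ live e f → look d ≡ quiet a → a ≡ (e , f)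
      look-live {a = _ , _} en q with look-quiet q
      ... | en′ , _ with refl ← trans (sym en) en′ = refl
      look-live-lost : ∀ {d e f} → end d ≡ live e f → look d ≡ lost → ⊥
      look-live-lost {d} {e} en q rewrite en with rung d e
      look-live-lost en () | true
      look-live-lost en () | false
      apart⁺ : ∀ {d f} → end d ≡ live even f → S⁺ (proj₁ d) ≡ true → S⁺ (proj₁ f) ≡ false
      apart⁺ {v , k} {f} en m with role v | role-spec v
      ... | middle i a b | middle p₀ p₁ p₂ ga gb with cyclic-cases i k
      ...   | inj₁ refl = ⊥-elim (look-live-lost en p₀)
      ...   | inj₂ (inj₁ refl) with refl ← look-live en p₁ = trans (S⁺-quiet (good-quiet en ga)) (rule-false (proj₁ b) m)
        where
        rule-false : ∀ y {σ τ} → rule even y σ τ ≡ true → σ ≡ false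
        rule-false even {false} h = refl
        rule-false odd  {false} h = refl
      ...   | inj₂ (inj₂ refl) with refl ← look-live en p₂ = trans (S⁺-quiet (good-quiet en gb)) (rule-false (proj₁ a) m)
        where
        rule-false : ∀ y {σ τ} → rule y even σ τ ≡ true → τ ≡ false
        rule-false even {false} {false} h = refl
        rule-false odd  {τ = false} h = refl
      apart⁺ {v , k} {f} en m | remain | remain h with h k
      ... | c , p with refl ← look-live en p with linkFate (even , f) | partner h p
      ...   | stays a b | stays hu en′ = trans (S⁺-quiet hu) (apart en′ m)
      ...   | dies | dies _ ri rewrite ri = refl
      ...   | joins y g a b | join₁ i _ ri _ rewrite ri | m = rule-even y _
      ...   | joins y g a b | join₂ i _ ri _ rewrite ri | m = trans (rule-comm y even (S (proj₁ g)) true) (rule-even y _)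

    tally′-live : ∀ {d e f} → end′ d ≡ live e f → tally after S d ≡ edgeTally e (S (proj₁ d)) (S (proj₁ f))
    tally′-live = tally-live after S

    S⁺-middle : ∀ {u i a b} → role u ≡ middle i a b → S⁺ u ≡ ruleAt a b
    S⁺-middle eq rewrite eq = refl

    -- The discharging inequality at a dart of a surviving vertex: its old tally and what arrives
    -- from the other end pay for the new tally and the gain.
    dart-bound : ∀ {d e f} → Quiet (proj₁ d) → look d ≡ quiet (e , f) →
                 tally after S d ℕ.+ pay e (linkFate (e , f)) ℕ.≤ tally s S⁺ d ℕ.+ out f
    dart-bound {d} {e} {f} h p with look-quiet p
    ... | en , _ with linkFate (e , f) | partner h p
    ...   | stays a b | stays hu en′
            rewrite tally′-live en′ | tally-live s S⁺ en | S⁺-quiet h | S⁺-quiet hu | pay-stays {Link} {Dart} e {a} {b}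
            = ℕ.+-monoʳ-≤ (edgeTally e (S (proj₁ d)) (S (proj₁ f))) ℕ.z≤n
    ...   | joins y g a b | join₁ i en′ ri oi
            rewrite tally′-live en′ | tally-live s S⁺ en | ri | oi | tally-live s S⁺ (end-sym en) | S⁺-quiet h | S⁺-middle ri
                  | pay-joins {Link} {Dart} e y {g} {a} {b}
            = join-tally e y (S (proj₁ d)) (S (proj₁ g)) (λ { eq σ → apart (trans en′ (cong (λ w → live w g) eq)) σ })
    ...   | joins y g a b | join₂ i en′ ri oi
            rewrite tally′-live en′ | tally-live s S⁺ en | ri | oi | tally-live s S⁺ (end-sym en) | S⁺-quiet h | S⁺-middle ri
                  | pay-joins {Link} {Dart} e y {g} {a} {b} | rule-comm y e (S (proj₁ g)) (S (proj₁ d))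
            = join-tally e y (S (proj₁ d)) (S (proj₁ g)) (λ { eq σ → apart (trans en′ (cong (λ w → live w g) eq)) σ })
    ...   | dies | dies en′ ri = dead-bound e en en′
            where
            tally-dead : ∀ e → end′ d ≡ deadEnd e → tally after S d ≡ 0
            tally-dead e en′ with end′ d
            tally-dead even refl | lost = refl
            tally-dead odd  refl | kill = refl
            S⁺-idle : S⁺ (proj₁ f) ≡ false
            S⁺-idle rewrite ri = refl
            dead-bound : ∀ e → end d ≡ live e f → end′ d ≡ deadEnd e →
                         tally after S d ℕ.+ pay {Link} {Dart} e dies ℕ.≤ tally s S⁺ d ℕ.+ out f
            dead-bound even en en′ rewrite tally-dead even en′ = ℕ.z≤n
            -- One end is idle and the other is killed in the next state, so neither is chosen, and
            -- the tallies of the two darts make up the gain 2.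
            dead-bound odd  en en′ rewrite tally-dead odd en′ | tally-live s S⁺ en | ri | tally-live s S⁺ (end-sym en)
              | S⁺-idle | S⁺-quiet h | killed en′ = ℕ.≤-refl

    -- Dead darts are fixed, which makes this an involution on all darts.
    other-end : Dart → Dart
    other-end d with end d
    ... | live e f = f
    ... | _        = d

    other-end-live : ∀ {d e f} → end d ≡ live e f → other-end d ≡ f
    other-end-live {d} eq with end d
    other-end-live refl | live e f = refl

    other-end-involutive : ∀ d → other-end (other-end d) ≡ d
    other-end-involutive d with end d in eq
    ... | live e f = other-end-live (end-sym eq)
    ... | lost rewrite eq = refl
    ... | kill rewrite eq = refl

    settled : Fin N → ℕ
    settled v = if quiet? v then weight s S⁺ v else 0

    outflow-total : ∀ ρ b (t : Fin 3 → ℕ) → sum (λ i → outflow ρ i (t i)) ℕ.≤ 2 ℕ.* b2n (choose ρ b) ℕ.+ sum t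
    outflow-total remain b t = ℕ.z≤n
    outflow-total idle   b t = ℕ.≤-refl
    outflow-total (middle i a c) b t = ℕ.≤-trans (cyclic i) (ℕ.≤-reflexive (cong (λ w → w ℕ.* m ℕ.+ sum t) (share-sum (proj₁ a) (proj₁ c))))
      where
      m x y : ℕ
      m = b2n (ruleAt a c)
      x = share (proj₁ a) (proj₁ c)
      y = share (proj₁ c) (proj₁ a)
      cyclic : ∀ i → sum (λ k → outflow (middle i a c) k (t k)) ℕ.≤ (x ℕ.+ y) ℕ.* m ℕ.+ sum t
      cyclic zero = ℕ.≤-trans (ℕ.m≤n+m _ (t zero)) (ℕ.≤-reflexive
        (ℕ-solve 6 (λ m x y p q r → p ⊹ (con⁰ 0 ⊹ ((q ⊹ x ⊠ m) ⊹ ((r ⊹ y ⊠ m) ⊹ con⁰ 0))) ≙ (x ⊹ y) ⊠ m ⊹ (p ⊹ (q ⊹ (r ⊹ con⁰ 0)))) refl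
          m x y (t zero) (t (suc zero)) (t (suc (suc zero)))))
      cyclic (suc zero) = ℕ.≤-trans (ℕ.m≤n+m _ (t (suc zero))) (ℕ.≤-reflexive
        (ℕ-solve 6 (λ m x y p q r → q ⊹ ((p ⊹ y ⊠ m) ⊹ (con⁰ 0 ⊹ ((r ⊹ x ⊠ m) ⊹ con⁰ 0))) ≙ (x ⊹ y) ⊠ m ⊹ (p ⊹ (q ⊹ (r ⊹ con⁰ 0)))) refl
          m x y (t zero) (t (suc zero)) (t (suc (suc zero)))))
      cyclic (suc (suc zero)) = ℕ.≤-trans (ℕ.m≤n+m _ (t (suc (suc zero)))) (ℕ.≤-reflexive
        (ℕ-solve 6 (λ m x y p q r → r ⊹ ((p ⊹ x ⊠ m) ⊹ ((q ⊹ y ⊠ m) ⊹ (con⁰ 0 ⊹ con⁰ 0))) ≙ (x ⊹ y) ⊠ m ⊹ (p ⊹ (q ⊹ (r ⊹ con⁰ 0)))) refl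
          m x y (t zero) (t (suc zero)) (t (suc (suc zero)))))

    outflow-bound : ∀ v → settled v ℕ.+ sum (λ i → out (v , i)) ℕ.≤ weight s S⁺ v
    outflow-bound v = go (quiet? v) refl
      where
      go : ∀ b → quiet? v ≡ b → (if b then weight s S⁺ v else 0) ℕ.+ sum (λ i → out (v , i)) ℕ.≤ weight s S⁺ v
      go true qv = ℕ.≤-reflexive (trans (cong (λ ρ → weight s S⁺ v ℕ.+ sum (λ i → outflow ρ i (tally s S⁺ (v , i)))) (role-remain (quiet?-sound qv)))
        (ℕ.+-identityʳ (weight s S⁺ v)))
      go false qv = outflow-total (role v) (S v) (λ i → tally s S⁺ (v , i))

    vertex-bound : ∀ v → weight after S v ℕ.+ gainAt v ℕ.≤ settled v ℕ.+ sum (λ i → out (other-end (v , i)))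
    vertex-bound v = go (quiet? v) refl
      where
      open ℕ.≤-Reasoning
      pays : Fin 3 → ℕ
      pays i = payView (look (v , i))
      go : ∀ b → quiet? v ≡ b → weight after S v ℕ.+ (if b then sum pays else 0) ℕ.≤
           (if b then weight s S⁺ v else 0) ℕ.+ sum (λ i → out (other-end (v , i)))
      go true qv = begin
        2 ℕ.* b2n (S v) ℕ.+ sum (λ i → tally after S (v , i)) ℕ.+ sum pays
          ≡⟨ ℕ.+-assoc (2 ℕ.* b2n (S v)) (sum (λ i → tally after S (v , i))) (sum pays) ⟩
        2 ℕ.* b2n (S v) ℕ.+ (sum (λ i → tally after S (v , i)) ℕ.+ sum pays)
          ≡⟨ cong₂ (λ x y → 2 ℕ.* b2n x ℕ.+ y) (sym (S⁺-quiet h)) (sym (∑-distrib-+ (λ i → tally after S (v , i)) pays)) ⟩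
        2 ℕ.* b2n (S⁺ v) ℕ.+ sum (λ i → tally after S (v , i) ℕ.+ pays i)
          ≤⟨ ℕ.+-monoʳ-≤ (2 ℕ.* b2n (S⁺ v)) (sum-mono bound) ⟩
        2 ℕ.* b2n (S⁺ v) ℕ.+ sum (λ i → tally s S⁺ (v , i) ℕ.+ out (other-end (v , i)))
          ≡⟨ cong (2 ℕ.* b2n (S⁺ v) ℕ.+_) (∑-distrib-+ (λ i → tally s S⁺ (v , i)) (λ i → out (other-end (v , i)))) ⟩
        2 ℕ.* b2n (S⁺ v) ℕ.+ (sum (λ i → tally s S⁺ (v , i)) ℕ.+ sum (λ i → out (other-end (v , i))))
          ≡⟨ sym (ℕ.+-assoc (2 ℕ.* b2n (S⁺ v)) (sum (λ i → tally s S⁺ (v , i))) (sum (λ i → out (other-end (v , i))))) ⟩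
        weight s S⁺ v ℕ.+ sum (λ i → out (other-end (v , i))) ∎
        where
        h : Quiet v
        h = quiet?-sound qv
        bound : ∀ i → tally after S (v , i) ℕ.+ pays i ℕ.≤ tally s S⁺ (v , i) ℕ.+ out (other-end (v , i))
        bound i with h i
        ... | (e , f) , p = subst₂ (λ x y → tally after S (v , i) ℕ.+ x ℕ.≤ tally s S⁺ (v , i) ℕ.+ out y)
          (sym (cong payView p)) (sym (other-end-live (proj₁ (look-quiet p)))) (dart-bound h p)
      go false qv = ℕ.≤-trans (ℕ.≤-reflexive (trans (ℕ.+-identityʳ (weight after S v))
          (cong₂ (λ x y → 2 ℕ.* b2n x ℕ.+ y) (killed (gone zero)) (sum-cong-≗ (λ i → tally-gone i))))) ℕ.z≤n
        where
        gone : ∀ i → end′ (v , i) ≡ kill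
        gone i rewrite qv = refl
        tally-gone : ∀ i → tally after S (v , i) ≡ 0
        tally-gone i with end′ (v , i) | gone i
        ... | kill | _ = refl

    -- A surviving vertex keeps its old weight and receives, a deleted one sends at most its weight;
    -- summed over the graph, sent and received amounts cancel.
    extension-bound : sum (λ v → weight after S v ℕ.+ gainAt v) ℕ.≤ sum (weight s S⁺)
    extension-bound = begin
      sum (λ v → weight after S v ℕ.+ gainAt v)
        ≤⟨ sum-mono vertex-bound ⟩
      sum (λ v → settled v ℕ.+ sum (λ i → out (other-end (v , i))))
        ≡⟨ ∑-distrib-+ settled _ ⟩
      sum settled ℕ.+ sum (λ v → sum (λ i → out (other-end (v , i))))
        ≡⟨ cong (sum settled ℕ.+_) (sym (sum-involution N other-end other-end-involutive out)) ⟩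
      sum settled ℕ.+ sum (λ v → sum (λ i → out (v , i)))
        ≡⟨ sym (∑-distrib-+ settled _) ⟩
      sum (λ v → settled v ℕ.+ sum (λ i → out (v , i)))
        ≤⟨ sum-mono outflow-bound ⟩
      sum (weight s S⁺) ∎
      where open ℕ.≤-Reasoning

  -- Induction on the rounds from the last one backwards: a choice for the state after a round is
  -- extended to the vertices deleted in it. When no round is left the empty choice serves.
  certificate : ∀ j (s : State j) → ∃[ S ] (Valid s S × sum (remaining j s) ℕ.≤ sum (weight s S))
  certificate zero s = (λ _ → false) , record { killed = λ _ → refl ; apart = λ _ _ → refl } , sum-mono {N} {λ _ → 0} {weight s (λ _ → false)} (λ v → ℕ.z≤n)
  certificate (suc j) s with certificate j (Local.after s)
  ... | S , valid , bound = S⁺ , valid⁺ , (begin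
    sum (remaining (suc j) s)
      ≤⟨ sum-mono (λ v → ℕ.+-monoʳ-≤ (gainAt v) (drop (quiet? v) (remaining j after v))) ⟩
    sum (λ v → gainAt v ℕ.+ remaining j after v)
      ≡⟨ ∑-distrib-+ gainAt (remaining j after) ⟩
    sum gainAt ℕ.+ sum (remaining j after)
      ≤⟨ ℕ.+-monoʳ-≤ (sum gainAt) bound ⟩
    sum gainAt ℕ.+ sum (weight after S)
      ≡⟨ ℕ.+-comm (sum gainAt) (sum (weight after S)) ⟩
    sum (weight after S) ℕ.+ sum gainAt
      ≡⟨ sym (∑-distrib-+ (weight after S) gainAt) ⟩
    sum (λ v → weight after S v ℕ.+ gainAt v)
      ≤⟨ extension-bound ⟩
    sum (weight s S⁺) ∎)
    where
    open ℕ.≤-Reasoning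
    open Local s
    open Extend s S valid
    drop : ∀ b n → (if b then n else 0) ℕ.≤ n
    drop true  n = ℕ.≤-refl
    drop false n = ℕ.z≤n

-- Independence of labels in the absence of short cycles

succ₁≢ : ∀ i → succ₁ i ≢ i
succ₁≢ zero             ()
succ₁≢ (suc zero)       ()
succ₁≢ (suc (suc zero)) ()

succ₂≢ : ∀ i → succ₂ i ≢ i
succ₂≢ zero             ()
succ₂≢ (suc zero)       ()
succ₂≢ (suc (suc zero)) ()

succ₁≢succ₂ : ∀ i → succ₁ i ≢ succ₂ i
succ₁≢succ₂ zero             ()
succ₁≢succ₂ (suc zero)       ()
succ₁≢succ₂ (suc (suc zero)) ()

module Walks {V : Set} (σ : V × Fin 3 → V × Fin 3) (σσ : ∀ d → σ (σ d) ≡ d) where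
  open Simulation V using (Dart; turn₁; turn₂)

  infix 4 _↝_
  _↝_ : Dart → Dart → Set
  d ↝ e = proj₁ e ≡ proj₁ (σ d) × e ≢ σ d

  data Chain : Dart → Dart → ℕ → Set where
    [_] : ∀ d → Chain d d 1
    _∷_ : ∀ {d d′ e n} → d ↝ d′ → Chain d′ e n → Chain d e (suc n)

  -- Only the return to the first vertex is demanded, so the last dart may be the reverse of the
  -- first. Length 1 covers loops and darts fixed by `σ`.
  NoShortCycle : ℕ → Set
  NoShortCycle m = ∀ {d e n} → Chain d e n → proj₁ (σ e) ≡ proj₁ d → n ℕ.≤ m → ⊥

  join : ∀ {d e e′ f n m} → Chain d e n → e ↝ e′ → Chain e′ f m → Chain d f (n ℕ.+ m)
  join [ d ]   s c′ = s ∷ c′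
  join (r ∷ c) s c′ = r ∷ join c s c′

  ↝-reverse : ∀ {d e} → d ↝ e → σ e ↝ σ d
  ↝-reverse {d} {e} (p , q) = trans (sym p) (cong proj₁ (sym (σσ e))) , λ eq → q (sym (trans eq (σσ e)))

  reverse : ∀ {d e n} → Chain d e n → Chain (σ e) (σ d) n
  reverse [ d ] = [ σ d ]
  reverse {n = suc n} (r ∷ c) = subst (Chain _ _) (ℕ.+-comm n 1) (join (reverse c) (↝-reverse r) [ _ ])

  shift : ∀ {d d′ e n} → d ↝ d′ → Chain d′ e n → ∃[ f ] (Chain d f n × f ↝ e)
  shift r [ _ ] = _ , [ _ ] , r
  shift r (r′ ∷ c) with shift r′ c
  ... | f , c′ , s = f , r ∷ c′ , s

  unsnoc : ∀ {d e n} → Chain d e (suc (suc n)) → ∃[ f ] (Chain d f (suc n) × f ↝ e)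
  unsnoc (r ∷ c) = shift r c

  nonempty : ∀ {d e n} → Chain d e n → ∃[ k ] n ≡ suc k
  nonempty [ d ]   = 0 , refl
  nonempty (_ ∷ _) = _ , refl

  Reads : ℕ → Dart → Dart → Set
  Reads zero    d p = ⊥
  Reads (suc D) d p = (p ≡ d ⊎ p ≡ σ d) ⊎ (Reads D (turn₁ (σ d)) p ⊎ Reads D (turn₂ (σ d)) p)

  ↝-fst : ∀ d → d ↝ turn₁ (σ d)
  ↝-fst d = refl , λ eq → succ₁≢ _ (cong proj₂ eq)

  ↝-snd : ∀ d → d ↝ turn₂ (σ d)
  ↝-snd d = refl , λ eq → succ₂≢ _ (cong proj₂ eq)

  reads-chain : ∀ D {d p} → Reads D d p → ∃[ e ] ∃[ n ] (Chain d e n × n ℕ.≤ D × (p ≡ e ⊎ p ≡ σ e))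
  reads-chain (suc D) {d} (inj₁ h) = d , 1 , [ d ] , ℕ.s≤s ℕ.z≤n , h
  reads-chain (suc D) {d} (inj₂ (inj₁ h)) with reads-chain D h
  ... | e , n , c , le , eq = e , suc n , ↝-fst d ∷ c , ℕ.s≤s le , eq
  reads-chain (suc D) {d} (inj₂ (inj₂ h)) with reads-chain D h
  ... | e , n , c , le , eq = e , suc n , ↝-snd d ∷ c , ℕ.s≤s le , eq

  module _ {m} (acyclic : NoShortCycle m) where

    returns : ∀ {d n} → Chain d d (suc (suc n)) → suc n ℕ.≤ m → ⊥
    returns c le with unsnoc c
    ... | f , c′ , (p , _) = acyclic c′ (sym p) le

    σ-injective : ∀ {d e} → σ d ≡ σ e → d ≡ e
    σ-injective {d} {e} eq = trans (sym (σσ d)) (trans (cong σ eq) (σσ e))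

    -- A common label gives a chain from each dart to the same edge; the reverse of one followed by
    -- the other is a short walk without backtracking.
    reads-disjoint : ∀ {D D′ d d′ p} → d ≢ d′ → proj₁ d ≡ proj₁ d′ → D ℕ.+ D′ ℕ.≤ m → Reads D d p → Reads D′ d′ p → ⊥
    reads-disjoint {D} {D′} {d} {d′} {p} d≢d′ vv le h h′ with reads-chain D h | reads-chain D′ h′
    ... | e , n , c , n≤ , pe | e′ , n′ , c′ , n≤′ , pe′ = go pe pe′
      where
      c⁺ : Chain (σ e) e′ (n ℕ.+ n′)
      c⁺ = join (reverse c) (trans (sym vv) (cong proj₁ (sym (σσ d))) , λ eq → d≢d′ (sym (trans eq (σσ d)))) c′
      le⁺ : n ℕ.+ n′ ℕ.≤ m
      le⁺ = ℕ.≤-trans (ℕ.+-mono-≤ n≤ n≤′) le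
      same : e ≡ e′ → ⊥
      same eq = acyclic c⁺ (cong (λ x → proj₁ (σ x)) (sym eq)) le⁺
      -- The walk begins and ends with the same dart here, so it closes up only after its last dart
      -- has been dropped.
      opposite : σ e ≡ e′ → ⊥
      opposite eq with nonempty c | nonempty c′
      ... | k , refl | k′ , refl = returns (subst₂ (λ x y → Chain x e′ (suc y)) eq (ℕ.+-suc k k′) c⁺)
                                     (ℕ.≤-trans (ℕ.≤-trans (ℕ.m≤n+m _ 1) (ℕ.≤-reflexive (cong suc (sym (ℕ.+-suc k k′))))) le⁺)
      go : p ≡ e ⊎ p ≡ σ e → p ≡ e′ ⊎ p ≡ σ e′ → ⊥
      go (inj₁ a) (inj₁ b) = same (trans (sym a) b)
      go (inj₁ a) (inj₂ b) = opposite (trans (cong σ (trans (sym a) b)) (σσ e′))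
      go (inj₂ a) (inj₁ b) = opposite (trans (sym a) b)
      go (inj₂ a) (inj₂ b) = same (σ-injective (trans (sym a) b))

    near-∉ : ∀ {D d d′} → d ↝ d′ → suc D ℕ.≤ m → Reads D d′ d → ⊥
    near-∉ {D} {d} s le h with reads-chain D h
    ... | e , n , c , n≤ , inj₁ refl with nonempty c
    ...   | k , refl = returns (s ∷ c) (ℕ.≤-trans n≤ (ℕ.≤-trans (ℕ.n≤1+n D) le))
    near-∉ {D} {d} s le h | e , n , c , n≤ , inj₂ eq = acyclic (s ∷ c) (cong proj₁ (sym eq)) (ℕ.≤-trans (ℕ.s≤s n≤) le)

    far-∉ : ∀ {D d d′} → d ↝ d′ → suc D ℕ.≤ m → Reads D d′ (σ d) → ⊥
    far-∉ {D} {d} (p , q) le h = reads-disjoint {1} {D} {σ d} (λ eq → q (sym eq)) (sym p) le (inj₁ (inj₁ refl)) h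

    no-loop : 1 ℕ.≤ m → ∀ d → d ≢ σ d
    no-loop le d eq = acyclic [ d ] (cong proj₁ (sym eq)) le

fresh : Params
fresh = record { l = 0ℚ ; κ = 0ℚ ; p = 1ℚ ; d = 0ℚ ; sum≡1 = refl }

module Labels (ra rb rc : ℚ) (coin-sum : ra ℚ.+ (rb ℚ.+ rc) ≡ 1ℚ)
              (N : ℕ) (σ : Fin N × Fin 3 → Fin N × Fin 3) (σσ : ∀ d → σ (σ d) ≡ d) (K : ℕ) where
  open import Data.Rational.Base using (_+_; _*_)
  open ≡-Reasoning
  open Law ra rb rc coin-sum
  open At fresh using (tree; edge; E-edge; E-tree-zero; E-tree-suc)
  open Simulation (Fin N)
  open Walks σ σσ
  open Unfold using (unfold)

  Labelling : Set
  Labelling = Vec (Vec Coin K) (N ℕ.* 3)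

  labels : Meas Labelling
  labels = iid (coins K) (N ℕ.* 3)

  idx : Dart → Fin (N ℕ.* 3)
  idx (v , i) = Fin.combine v i

  idx-injective : ∀ {d e} → idx d ≡ idx e → d ≡ e
  idx-injective {v , i} {w , k} eq with Fin.combine-injective v i w k eq
  ... | refl , refl = refl

  init : Labelling → State K
  init ℓ = record
    { end     = λ d → live even (σ d)
    ; label   = λ d → lookup ℓ (idx d)
    ; end-sym = λ { {d} refl → cong (live even) (σσ d) } }

  U : ℕ → Dart → Labelling → Half K
  U D d ℓ = unfold (init ℓ) D d

  Blind : {A : Set} → (Dart → Set) → (Labelling → A) → Set
  Blind X f = ∀ {p} → X p → ∀ ω ℓ → f (ℓ [ idx p ]≔ ω) ≡ f ℓ

  lookup-blind : ∀ {d} → Blind (_≢ d) (λ ℓ → lookup ℓ (idx d))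
  lookup-blind {d} {p} p≢d ω ℓ = lookup∘update′ (λ eq → p≢d (sym (idx-injective eq))) ℓ ω

  U-blind : ∀ D d → Blind (λ p → ¬ Reads D d p) (U D d)
  U-blind zero    d h ω ℓ = refl
  U-blind (suc D) d h ω ℓ
    rewrite lookup-blind {d} (λ eq → h (inj₁ (inj₁ eq))) ω ℓ | lookup-blind {σ d} (λ eq → h (inj₁ (inj₂ eq))) ω ℓ
          | U-blind D (turn₁ (σ d)) (λ r → h (inj₂ (inj₁ r))) ω ℓ | U-blind D (turn₂ (σ d)) (λ r → h (inj₂ (inj₂ r))) ω ℓ = refl

  expose : ∀ d (φ : Vec Coin K → Labelling → ℚ) → (∀ ω → Blind (_≡ d) (φ ω)) →
           E labels (λ ℓ → φ (lookup ℓ (idx d)) ℓ) ≡ E (coins K) (λ ω → E labels (φ ω))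
  expose d φ h = trans (resample {μ = coins K} (prob-coins K) (idx d) (λ ℓ → φ (lookup ℓ (idx d)) ℓ))
    (E-cong (coins K) λ ω → E-cong labels λ ℓ →
      trans (cong (λ w → φ w (ℓ [ idx d ]≔ ω)) (lookup∘update (idx d) ℓ ω)) (h ω refl ω ℓ))

  E-fresh : ∀ D f → E (tree K (suc D)) f ≡ E (edge K even D) f
  E-fresh D f = trans (E-tree-suc D f)
    (solve 4 (λ a b c e → con 0ℚ :* a :+ (con 0ℚ :* b :+ (con 1ℚ :* c :+ (con 0ℚ :* e :+ con 0ℚ))) := c) refl (f lost) (f kill) (E (edge K even D) f) (E (edge K odd D) f))

  module _ {m} (acyclic : NoShortCycle m) where

    -- The labels of the tree are exposed one at a time; each is independent of the rest because
    -- nothing that remains reads it again. The second argument of `ψ` stands for whatever else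
    -- depends on labels outside the tree.
    E-unfold : ∀ D d → D ℕ.+ D ℕ.≤ m → (ψ : Half K → Labelling → ℚ) → (∀ t → Blind (Reads D d) (ψ t)) →
               E labels (λ ℓ → ψ (U D d ℓ) ℓ) ≡ E (tree K D) (λ t → E labels (ψ t))
    E-unfold zero d le ψ h = sym (E-tree-zero (λ t → E labels (ψ t)))
    E-unfold (suc D) d le ψ h = begin
      E labels (λ ℓ → ψ (live even (lookup ℓ (idx d)) (lookup ℓ (idx f)) (U D d₁ ℓ) (U D d₂ ℓ)) ℓ)
        ≡⟨ expose d (λ ω ℓ → ψ (live even ω (lookup ℓ (idx f)) (U D d₁ ℓ) (U D d₂ ℓ)) ℓ) blind₀ ⟩
      E (coins K) (λ ω → E labels λ ℓ → ψ (live even ω (lookup ℓ (idx f)) (U D d₁ ℓ) (U D d₂ ℓ)) ℓ)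
        ≡⟨ E-cong (coins K) (λ ω → expose f (λ ω′ ℓ → ψ (live even ω ω′ (U D d₁ ℓ) (U D d₂ ℓ)) ℓ) (blind₁ ω)) ⟩
      E (coins K) (λ ω → E (coins K) λ ω′ → E labels λ ℓ → ψ (live even ω ω′ (U D d₁ ℓ) (U D d₂ ℓ)) ℓ)
        ≡⟨ E-cong (coins K) (λ ω → E-cong (coins K) λ ω′ → E-unfold D d₁ le′ (λ t ℓ → ψ (live even ω ω′ t (U D d₂ ℓ)) ℓ) (blind₂ ω ω′)) ⟩
      E (coins K) (λ ω → E (coins K) λ ω′ → E (tree K D) λ t → E labels λ ℓ → ψ (live even ω ω′ t (U D d₂ ℓ)) ℓ)
        ≡⟨ E-cong (coins K) (λ ω → E-cong (coins K) λ ω′ → E-cong (tree K D) λ t → E-unfold D d₂ le′ (λ u → ψ (live even ω ω′ t u)) (λ u r → h _ (inj₂ (inj₂ r)))) ⟩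
      E (coins K) (λ ω → E (coins K) λ ω′ → E (tree K D) λ t → E (tree K D) λ u → E labels (ψ (live even ω ω′ t u)))
        ≡⟨ sym (trans (E-fresh D (λ t → E labels (ψ t))) (E-edge even D (λ t → E labels (ψ t)))) ⟩
      E (tree K (suc D)) (λ t → E labels (ψ t)) ∎
      where
      f = σ d
      d₁ = turn₁ f
      d₂ = turn₂ f
      1+D≤m : suc D ℕ.≤ m
      1+D≤m = ℕ.≤-trans (ℕ.m≤m+n (suc D) (suc D)) le
      le′ : D ℕ.+ D ℕ.≤ m
      le′ = ℕ.≤-trans (ℕ.+-mono-≤ (ℕ.n≤1+n D) (ℕ.n≤1+n D)) le
      blind₀ : ∀ ω → Blind (_≡ d) (λ ℓ → ψ (live even ω (lookup ℓ (idx f)) (U D d₁ ℓ) (U D d₂ ℓ)) ℓ)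
      blind₀ ω refl ω₀ ℓ
        rewrite lookup-blind {f} (no-loop acyclic (ℕ.≤-trans (ℕ.s≤s ℕ.z≤n) 1+D≤m) d) ω₀ ℓ
              | U-blind D d₁ (near-∉ acyclic (↝-fst d) 1+D≤m) ω₀ ℓ | U-blind D d₂ (near-∉ acyclic (↝-snd d) 1+D≤m) ω₀ ℓ
              = h _ (inj₁ (inj₁ refl)) ω₀ ℓ
      blind₁ : ∀ ω ω′ → Blind (_≡ f) (λ ℓ → ψ (live even ω ω′ (U D d₁ ℓ) (U D d₂ ℓ)) ℓ)
      blind₁ ω ω′ refl ω₀ ℓ
        rewrite U-blind D d₁ (far-∉ acyclic (↝-fst d) 1+D≤m) ω₀ ℓ | U-blind D d₂ (far-∉ acyclic (↝-snd d) 1+D≤m) ω₀ ℓ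
              = h _ (inj₁ (inj₂ refl)) ω₀ ℓ
      blind₂ : ∀ ω ω′ t → Blind (Reads D d₁) (λ ℓ → ψ (live even ω ω′ t (U D d₂ ℓ)) ℓ)
      blind₂ ω ω′ t r ω₀ ℓ
        rewrite U-blind D d₂ (reads-disjoint acyclic {D} {D} (λ eq → succ₁≢succ₂ _ (cong proj₂ eq)) refl le′ r) ω₀ ℓ
              = h _ (inj₂ (inj₁ r)) ω₀ ℓ

    E-vertex : ∀ D v → D ℕ.+ D ℕ.≤ m → (φ : Half K → Half K → Half K → ℚ) →
      E labels (λ ℓ → φ (U D (v , zero) ℓ) (U D (v , suc zero) ℓ) (U D (v , suc (suc zero)) ℓ)) ≡ E₃ (tree K D) φ
    E-vertex D v le φ = begin
      E labels (λ ℓ → φ (U D (v , zero) ℓ) (U D (v , suc zero) ℓ) (U D (v , suc (suc zero)) ℓ))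
        ≡⟨ E-unfold D (v , zero) le (λ t ℓ → φ t (U D (v , suc zero) ℓ) (U D (v , suc (suc zero)) ℓ))
             (λ t r ω ℓ → cong₂ (φ t) (apart (λ ()) r ω ℓ) (apart (λ ()) r ω ℓ)) ⟩
      E (tree K D) (λ t → E labels λ ℓ → φ t (U D (v , suc zero) ℓ) (U D (v , suc (suc zero)) ℓ))
        ≡⟨ E-cong (tree K D) (λ t → E-unfold D (v , suc zero) le (λ u ℓ → φ t u (U D (v , suc (suc zero)) ℓ))
             (λ u r ω ℓ → cong (φ t u) (apart (λ ()) r ω ℓ))) ⟩
      E (tree K D) (λ t → E (tree K D) λ u → E labels λ ℓ → φ t u (U D (v , suc (suc zero)) ℓ))
        ≡⟨ E-cong (tree K D) (λ t → E-cong (tree K D) λ u → E-unfold D (v , suc (suc zero)) le (λ w ℓ → φ t u w) (λ _ _ _ _ → refl)) ⟩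
      E (tree K D) (λ t → E (tree K D) λ u → E (tree K D) λ w → E labels λ _ → φ t u w)
        ≡⟨ E-cong (tree K D) (λ t → E-cong (tree K D) λ u → E-cong (tree K D) λ w → E-const {μ = labels} (prob-iid {μ = coins K} (prob-coins K) (N ℕ.* 3)) (φ t u w)) ⟩
      E₃ (tree K D) φ ∎
      where
      apart : ∀ {i k} → (v , i) ≢ (v , k) → Blind (Reads D (v , i)) (U D (v , k))
      apart ne r = U-blind D _ (reads-disjoint acyclic {D} {D} ne refl le r)

-- Interval arithmetic for the masses

data Interval : Set where
  _,_ : (lo hi : ℕ) → Interval

data Outcome : Set where
  fail : Outcome
  step : (q Γ l κ p d : Interval) → Outcome

-- Rounded arithmetic on intervals of fractions with denominator Q, for the recursion of the masses l, κ, p, d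
-- (given by Next).  An auxiliary function is introduced wherever a value is used twice, so that it is computed once.
module Arithmetic (Q silentE silentO : ℕ) where
  open import Data.Nat.Base using (_+_; _*_; _∸_; _≤ᵇ_)
  open import Data.Nat.DivMod using (_/_)

  -- Division by zero yields 0.
  _÷_ : ℕ → ℕ → ℕ
  n ÷ zero  = 0
  n ÷ suc m = n / suc m

  -- Rounding up by adding one, except at zero. The exception matters in the first round: the odd
  -- masses are exactly zero, and the test before the subtraction compares 0 with 0.
  _÷⁺_ : ℕ → ℕ → ℕ
  zero  ÷⁺ m = 0
  suc n ÷⁺ m = suc (suc n ÷ m)

  infixl 6 _⊞_ _⊟_
  infixl 7 _⊡_

  lower : Interval → ℕ
  lower (a , b) = a

  _⊞_ _⊟_ _⊡_ : Interval → Interval → Interval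
  (a , b) ⊞ (c , e) = a + c , b + e
  (a , b) ⊟ (c , e) = a ∸ e , b ∸ c
  (a , b) ⊡ (c , e) = (a * c) ÷ Q , (b * e) ÷⁺ Q

  inverse : Interval → Interval
  inverse (a , b) = (Q * Q) ÷ b , (Q * Q) ÷⁺ a

  positive : Interval → Bool
  positive (zero  , _) = false
  positive (suc _ , _) = true

  -- The test to be made before `⊟`: it ensures that the truncated subtraction of the lower end is a
  -- true one.
  _≼_ : Interval → Interval → Bool
  (a , b) ≼ (c , e) = b ≤ᵇ c

  unit : Interval
  unit = Q , Q

  exact : ℕ → Interval
  exact n = n , n

  twice : Interval → Interval
  twice x = x ⊞ x

  step₅ : Bool → (q Γ l κ p d : Interval) → Outcome
  step₅ true  q Γ l κ p d = step q Γ l κ p d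
  step₅ false q Γ l κ p d = fail

  step₄ : (q ue uo L a b c e κ : Interval) → Outcome
  step₄ q ue uo L a b c e κ = step₅ (positive q ∧ b ≼ a ∧ e ≼ c) q
    (twice (q ⊡ κ) ⊞ uo ⊡ (L ⊡ (q ⊡ q) ⊡ (twice ue ⊞ uo)))
    (a ⊟ b) κ (q ⊡ (ue ⊞ L ⊡ twice (ue ⊡ uo))) (q ⊡ (uo ⊞ L ⊡ (ue ⊡ ue ⊞ uo ⊡ uo)))

  step₃ : (q ue uo L a b c e : Interval) → Outcome
  step₃ q ue uo L a b c e = step₄ q ue uo L a b c e (c ⊟ e)

  -- Here `y` encloses the inverse of `qₛ` and `w` encloses `survive` divided by `qₛ`, in which the
  -- division cancels. So only one inverse is taken in a round.
  step₂ : (qe qo q ue uo L y w : Interval) → Outcome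
  step₂ qe qo q ue uo L y w = step₃ q ue uo L (qe ⊡ y) (ue ⊡ w) (qo ⊡ y) (uo ⊡ w)

  step₁ : (qe qo q ue uo L : Interval) → Outcome
  step₁ qe qo q ue uo L = step₂ qe qo q ue uo L (inverse q) (q ⊡ (unit ⊞ L ⊡ (ue ⊞ uo)))

  step₀ : (qe qo L : Interval) → Outcome
  step₀ qe qo L = step₁ qe qo (qe ⊞ qo) (qe ⊡ exact silentE) (qo ⊡ exact silentO) L

  data Masses : Set where
    masses : (l κ p d : Interval) → Masses

  advanceMasses : Masses → Outcome
  advanceMasses (masses l κ p d) = step₀ (p ⊡ exact silentE) (d ⊡ exact silentO) (twice l)

  data Result : Set where
    none : Result
    some : ℕ → Result

  -- The recursion `E-total`, evaluated at lower ends and rounded down.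
  accumulate : (q q² Γ : ℕ) → Result → Result
  accumulate q q² Γ none     = none
  accumulate q q² Γ (some v) = some ((3 * q² * Γ) ÷ Q + (q² * q * v) ÷ (Q * Q))

  mutual
    bound : ℕ → Masses → Result
    bound zero    s = some 0
    bound (suc j) s = continue j (advanceMasses s)

    continue : ℕ → Outcome → Result
    continue j fail = none
    continue j (step q Γ l κ p d) = accumulate (lower q) (lower (q ⊡ q)) (lower Γ) (bound j (masses l κ p d))

  exceeds : ℕ → ℕ → Result → Bool
  exceeds a b none     = false
  exceeds a b (some v) = a * Q ≤ᵇ b * v

  initial : Masses
  initial = masses (exact 0) (exact 0) unit (exact 0)

-- Soundness of the interval computation

module RationalFacts where
  open import Data.Rational.Base using (_+_; _*_; _-_; _≤_; _<_; Positive; nonNegative; positive)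

  ι-* : ∀ m n → ι (m ℕ.* n) ≡ ι m * ι n
  ι-* zero    n = sym (ℚ.*-zeroˡ (ι n))
  ι-* (suc m) n = trans (ι-+ n (m ℕ.* n)) (trans (cong (ι n +_) (ι-* m n))
    (solve 2 (λ x y → y :+ x :* y := (con 1ℚ :+ x) :* y) refl (ι m) (ι n)))

  0≤ι : ∀ n → 0ℚ ≤ ι n
  0≤ι zero    = ℚ.≤-refl
  0≤ι (suc n) = ℚ.+-mono-≤ {0ℚ} {1ℚ} (ℚ.nonNegative⁻¹ 1ℚ) (0≤ι n)

  ι-mono : ∀ {m n} → m ℕ.≤ n → ι m ≤ ι n
  ι-mono {n = n} ℕ.z≤n = 0≤ι n
  ι-mono (ℕ.s≤s h) = ℚ.+-monoʳ-≤ 1ℚ (ι-mono h)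

  *-monoʳ : ∀ {x y z} → 0ℚ ≤ z → x ≤ y → x * z ≤ y * z
  *-monoʳ {z = z} h = ℚ.*-monoʳ-≤-nonNeg z {{nonNegative h}}

  *-monoˡ : ∀ {x y z} → 0ℚ ≤ z → x ≤ y → z * x ≤ z * y
  *-monoˡ {z = z} h = ℚ.*-monoˡ-≤-nonNeg z {{nonNegative h}}

  *-mono : ∀ {a b x y} → 0ℚ ≤ a → 0ℚ ≤ b → a ≤ x → b ≤ y → a * b ≤ x * y
  *-mono 0≤a 0≤b a≤x b≤y = ℚ.≤-trans (*-monoˡ 0≤a b≤y) (*-monoʳ (ℚ.≤-trans 0≤b b≤y) a≤x)

  0≤* : ∀ {a b} → 0ℚ ≤ a → 0ℚ ≤ b → 0ℚ ≤ a * b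
  0≤* {a} {b} 0≤a 0≤b = ℚ.≤-trans (ℚ.≤-reflexive (sym (ℚ.*-zeroˡ b))) (*-monoʳ 0≤b 0≤a)

  reciprocal : ∀ n → ℕ.NonZero n → ∃[ ε ] (0ℚ < ε × ι n * ε ≡ 1ℚ)
  reciprocal (suc n) _ = r , ℚ.positive⁻¹ r {{ℚ.1/pos⇒pos x}} , ℚ.*-inverseʳ x
    where
    x = 1ℚ + ι n
    instance
      pos : Positive x
      pos = positive (ℚ.<-≤-trans (ℚ.positive⁻¹ 1ℚ) (ℚ.≤-trans (ℚ.≤-reflexive (sym (ℚ.+-identityʳ 1ℚ))) (ℚ.+-monoʳ-≤ 1ℚ (0≤ι n))))
      nz : ℚ.NonZero x
      nz = ℚ.pos⇒nonZero x
    r = ℚ.1/ x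

open RationalFacts public

-- The denominator is a variable and its inverse an unspecified `ε`, so that no digit of the actual
-- numbers enters the reasoning.
module Soundness (Q A B C : ℕ) (A+B+C≡Q : A ℕ.+ (B ℕ.+ C) ≡ Q) (Q≢0 : ℕ.NonZero Q)
                 (ε : ℚ) (0<ε : 0ℚ ℚ.< ε) (Qε≡1 : ι Q ℚ.* ε ≡ 1ℚ) where
  open import Data.Rational.Base using (_+_; _*_; _-_; _≤_)
  open Arithmetic Q (B ℕ.+ C) C

  0≤ε : 0ℚ ≤ ε
  0≤ε = ℚ.<⇒≤ 0<ε

  val : ℕ → ℚ
  val n = ι n * ε

  val-+ : ∀ m n → val (m ℕ.+ n) ≡ val m + val n
  val-+ m n = trans (cong (_* ε) (ι-+ m n)) (ℚ.*-distribʳ-+ ε (ι m) (ι n))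

  val-mono : ∀ {m n} → m ℕ.≤ n → val m ≤ val n
  val-mono h = *-monoʳ 0≤ε (ι-mono h)

  0≤val : ∀ n → 0ℚ ≤ val n
  0≤val n = 0≤* (0≤ι n) 0≤ε

  weights-sum : val A + (val B + val C) ≡ 1ℚ
  weights-sum = trans (cong (val A +_) (sym (val-+ B C))) (trans (sym (val-+ A (B ℕ.+ C))) (trans (cong val A+B+C≡Q) Qε≡1))

  ÷-lower : ∀ n m → (n ÷ m) ℕ.* m ℕ.≤ n
  ÷-lower n zero    = ℕ.z≤n
  ÷-lower n (suc m) = ℕ.m/n*n≤m n (suc m)

  ÷⁺-upper : ∀ n m → ℕ.NonZero m → n ℕ.≤ (n ÷⁺ m) ℕ.* m
  ÷⁺-upper zero    m       _ = ℕ.z≤n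
  ÷⁺-upper (suc n) (suc m) _ = begin
    suc n                                            ≡⟨ ℕ.m≡m%n+[m/n]*n (suc n) (suc m) ⟩
    suc n ℕ.% suc m ℕ.+ (suc n ℕ./ suc m) ℕ.* suc m  ≤⟨ ℕ.+-monoˡ-≤ _ (ℕ.<⇒≤ (ℕ.m%n<n (suc n) (suc m))) ⟩
    suc m ℕ.+ (suc n ℕ./ suc m) ℕ.* suc m            ∎
    where open ℕ.≤-Reasoning

  unscale : ∀ n → ι (n ℕ.* Q) * (ε * ε) ≡ val n
  unscale n = trans (cong (_* (ε * ε)) (ι-* n Q)) (trans
    (solve 3 (λ n q e → n :* q :* (e :* e) := n :* e :* (q :* e)) refl (ι n) (ι Q) ε)
    (trans (cong (val n *_) Qε≡1) (ℚ.*-identityʳ (val n))))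

  val-*² : ∀ m n → ι (m ℕ.* n) * (ε * ε) ≡ val m * val n
  val-*² m n = trans (cong (_* (ε * ε)) (ι-* m n)) (solve 3 (λ m n e → m :* n :* (e :* e) := m :* e :* (n :* e)) refl (ι m) (ι n) ε)

  0≤ε² : 0ℚ ≤ ε * ε
  0≤ε² = 0≤* 0≤ε 0≤ε

  val-÷ : ∀ n → val (n ÷ Q) ≤ ι n * (ε * ε)
  val-÷ n = ℚ.≤-trans (ℚ.≤-reflexive (sym (unscale (n ÷ Q)))) (*-monoʳ 0≤ε² (ι-mono (÷-lower n Q)))

  val-÷⁺ : ∀ n → ι n * (ε * ε) ≤ val (n ÷⁺ Q)
  val-÷⁺ n = ℚ.≤-trans (*-monoʳ 0≤ε² (ι-mono (÷⁺-upper n Q Q≢0))) (ℚ.≤-reflexive (unscale (n ÷⁺ Q)))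

  infix 4 _∋_
  _∋_ : Interval → ℚ → Set
  (a , b) ∋ x = val a ≤ x × x ≤ val b

  0≤∋ : ∀ I {x} → I ∋ x → 0ℚ ≤ x
  0≤∋ (a , b) (h , _) = ℚ.≤-trans (0≤val a) h

  ⊞-sound : ∀ I J {x y} → I ∋ x → J ∋ y → I ⊞ J ∋ x + y
  ⊞-sound (a , b) (c , e) (h₁ , h₂) (k₁ , k₂) =
    ℚ.≤-trans (ℚ.≤-reflexive (val-+ a c)) (ℚ.+-mono-≤ h₁ k₁) , ℚ.≤-trans (ℚ.+-mono-≤ h₂ k₂) (ℚ.≤-reflexive (sym (val-+ b e)))

  ⊡-sound : ∀ I J {x y} → I ∋ x → J ∋ y → I ⊡ J ∋ x * y
  ⊡-sound (a , b) (c , e) hx@(h₁ , h₂) hy@(k₁ , k₂) =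
    ℚ.≤-trans (val-÷ (a ℕ.* c)) (ℚ.≤-trans (ℚ.≤-reflexive (val-*² a c)) (*-mono (0≤val a) (0≤val c) h₁ k₁)) ,
    ℚ.≤-trans (*-mono (0≤∋ (a , b) hx) (0≤∋ (c , e) hy) h₂ k₂) (ℚ.≤-trans (ℚ.≤-reflexive (sym (val-*² b e))) (val-÷⁺ (b ℕ.* e)))

  ⊟-sound : ∀ I J {x y} → J ≼ I ≡ true → I ∋ x → J ∋ y → I ⊟ J ∋ x - y
  ⊟-sound (a , b) (c , e) {x} {y} ok (h₁ , h₂) (k₁ , k₂) =
    ℚ.≤-trans (ℚ.≤-reflexive lower-eq) (ℚ.+-mono-≤ h₁ (ℚ.neg-antimono-≤ k₂)) ,
    ℚ.≤-trans (ℚ.+-mono-≤ h₂ (ℚ.neg-antimono-≤ k₁)) upper-le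
    where
    e≤a : e ℕ.≤ a
    e≤a = ℕ.≤ᵇ⇒≤ e a (subst Bool.T (sym ok) tt)
    lower-eq : val (a ℕ.∸ e) ≡ val a - val e
    lower-eq = trans (solve 2 (λ x y → x := x :+ y :- y) refl (val (a ℕ.∸ e)) (val e))
      (cong (_- val e) (trans (sym (val-+ (a ℕ.∸ e) e)) (cong val (ℕ.m∸n+n≡m e≤a))))
    upper-le : val b - val c ≤ val (b ℕ.∸ c)
    upper-le = ℚ.≤-trans (ℚ.+-monoˡ-≤ (ℚ.- val c) (ℚ.≤-trans (val-mono (ℕ.≤-trans (ℕ.m≤n+m∸n b c) (ℕ.≤-reflexive (ℕ.+-comm c (b ℕ.∸ c)))))
      (ℚ.≤-reflexive (val-+ (b ℕ.∸ c) c)))) (ℚ.≤-reflexive (solve 2 (λ x y → x :+ y :- y := x) refl (val (b ℕ.∸ c)) (val c)))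

  exact-sound : ∀ n → exact n ∋ val n
  exact-sound n = ℚ.≤-refl , ℚ.≤-refl

  unit-sound : unit ∋ 1ℚ
  unit-sound = ℚ.≤-reflexive Qε≡1 , ℚ.≤-reflexive (sym Qε≡1)

  val-QQ : ι (Q ℕ.* Q) * (ε * ε) ≡ 1ℚ
  val-QQ = trans (val-*² Q Q) (cong₂ _*_ Qε≡1 Qε≡1)

  inverse-sound : ∀ I {x y} → positive I ≡ true → I ∋ x → 0ℚ ≤ y → x * y ≡ 1ℚ → inverse I ∋ y
  inverse-sound (suc a′ , b) {x} {y} ok (h₁ , h₂) 0≤y xy = lower-le , upper-le
    where
    a = suc a′
    k = (Q ℕ.* Q) ÷ b
    m = (Q ℕ.* Q) ÷⁺ a
    regroup : ∀ z → z * x * y ≡ z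
    regroup z = trans (ℚ.*-assoc z x y) (trans (cong (z *_) xy) (ℚ.*-identityʳ z))
    lower-le : val k ≤ y
    lower-le = ℚ.≤-trans (ℚ.≤-reflexive (sym (regroup (val k)))) (ℚ.≤-trans (*-monoʳ 0≤y
      (ℚ.≤-trans (*-monoˡ (0≤val k) h₂) (ℚ.≤-trans (ℚ.≤-reflexive (sym (val-*² k b)))
        (ℚ.≤-trans (*-monoʳ 0≤ε² (ι-mono (÷-lower (Q ℕ.* Q) b))) (ℚ.≤-reflexive val-QQ))))) (ℚ.≤-reflexive (ℚ.*-identityˡ y)))
    upper-le : y ≤ val m
    upper-le = ℚ.≤-trans (ℚ.≤-reflexive (sym (ℚ.*-identityˡ y))) (ℚ.≤-trans (*-monoʳ 0≤y
      (ℚ.≤-trans (ℚ.≤-reflexive (sym val-QQ)) (ℚ.≤-trans (*-monoʳ 0≤ε² (ι-mono (÷⁺-upper (Q ℕ.* Q) a _)))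
        (ℚ.≤-trans (ℚ.≤-reflexive (val-*² m a)) (*-monoˡ (0≤val m) h₁))))) (ℚ.≤-reflexive (regroup (val m))))

  ∋-positive : ∀ I {x} → positive I ≡ true → I ∋ x → ∃[ y ] (0ℚ ≤ y × x * y ≡ 1ℚ)
  ∋-positive (suc a , b) {x} ok (h , _) = ℚ.1/ x , ℚ.<⇒≤ (ℚ.positive⁻¹ (ℚ.1/ x) {{ℚ.1/pos⇒pos x}}) , ℚ.*-inverseʳ x
    where
    ε≤ : ε ≤ val (suc a)
    ε≤ = ℚ.≤-trans (ℚ.≤-reflexive (sym (trans (cong (_* ε) (ℚ.+-identityʳ 1ℚ)) (ℚ.*-identityˡ ε)))) (val-mono {1} {suc a} (ℕ.s≤s ℕ.z≤n))
    instance
      pos : ℚ.Positive x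
      pos = ℚ.positive (ℚ.<-≤-trans 0<ε (ℚ.≤-trans ε≤ h))
      nz : ℚ.NonZero x
      nz = ℚ.pos⇒nonZero x

  module L = Law (val A) (val B) (val C) weights-sum
  module R = Round (val A) (val B) (val C) weights-sum
  module St = Step (val A) (val B) (val C) weights-sum

  ∋-resp : ∀ I {x y} → x ≡ y → I ∋ x → I ∋ y
  ∋-resp I refl h = h

  Fits : Masses → Params → Set
  Fits (masses l κ p d) P = l ∋ P.l × κ ∋ P.κ × p ∋ P.p × d ∋ P.d
    where module P = Params P

  -- Nothing is claimed of a failure, since `bound` then returns `none`, which never passes the
  -- final comparison.
  Good : Params → Outcome → Set
  Good P fail = ⊤
  Good P (step q Γ l κ p d) =
    Σ[ P′ ∈ Params ] Σ[ nxt ∈ St.Next P P′ ] (Fits (masses l κ p d) P′ × q ∋ L.At.qₛ P × Γ ∋ R.Γ P P′ nxt)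

  step₅-good : ∀ P b {q Γ l κ p d} → (b ≡ true → Good P (step q Γ l κ p d)) → Good P (step₅ b q Γ l κ p d)
  step₅-good P true  h = h refl
  step₅-good P false h = tt

  advance-good : ∀ s P → Fits s P → Good P (advanceMasses s)
  advance-good (masses li κi pi di) P (hl , hκ , hp , hd) = step₅-good P (positive q ∧ b ≼ a ∧ e ≼ c) main
    where
    module P = Params P
    module A = L.At P
    open St P using (survive; 2ℚ)
    L qe qo q ue uo y w a b c e κ′ : Interval
    L = twice li
    qe = pi ⊡ exact (B ℕ.+ C)
    qo = di ⊡ exact C
    q = qe ⊞ qo
    ue = qe ⊡ exact (B ℕ.+ C)
    uo = qo ⊡ exact C
    y = inverse q
    w = q ⊡ (unit ⊞ L ⊡ (ue ⊞ uo))
    a = qe ⊡ y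
    b = ue ⊡ w
    c = qo ⊡ y
    e = uo ⊡ w
    κ′ = c ⊟ e
    silentE : exact (B ℕ.+ C) ∋ L.silent even
    silentE = ∋-resp (exact (B ℕ.+ C)) (val-+ B C) (exact-sound (B ℕ.+ C))
    hqe : qe ∋ A.q even
    hqe = ⊡-sound pi (exact (B ℕ.+ C)) hp silentE
    hqo : qo ∋ A.q odd
    hqo = ⊡-sound di (exact C) hd (exact-sound C)
    hq : q ∋ A.qₛ
    hq = ⊞-sound qe qo hqe hqo
    hue : ue ∋ A.u even
    hue = ⊡-sound qe (exact (B ℕ.+ C)) hqe silentE
    huo : uo ∋ A.u odd
    huo = ⊡-sound qo (exact C) hqo (exact-sound C)
    hL : L ∋ P.l + P.l
    hL = ⊞-sound li li hl hl
    W : ℚ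
    W = A.qₛ * (1ℚ + (P.l + P.l) * (A.u even + A.u odd))
    hw : w ∋ W
    hw = ⊡-sound q (unit ⊞ L ⊡ (ue ⊞ uo)) hq (⊞-sound unit (L ⊡ (ue ⊞ uo)) unit-sound (⊡-sound L (ue ⊞ uo) hL (⊞-sound ue uo hue huo)))
    main : positive q ∧ b ≼ a ∧ e ≼ c ≡ true → Good P (step q
      (twice (q ⊡ κ′) ⊞ uo ⊡ (L ⊡ (q ⊡ q) ⊡ (twice ue ⊞ uo)))
      (a ⊟ b) κ′ (q ⊡ (ue ⊞ L ⊡ twice (ue ⊡ uo))) (q ⊡ (uo ⊞ L ⊡ (ue ⊡ ue ⊞ uo ⊡ uo))))
    main ok with positive q in ok₁ | b ≼ a in ok₂ | e ≼ c in ok₃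
    main ok | true | true | true = P′ , nxt , (hl′ , hκ′ , hp′ , hd′) , hq , hΓ
      where
      inv = ∋-positive q ok₁ hq
      Y = proj₁ inv
      0≤Y = proj₁ (proj₂ inv)
      qY = proj₂ (proj₂ inv)
      hY : y ∋ Y
      hY = inverse-sound q ok₁ hq 0≤Y qY
      l₁ κ₁ p₁ d₁ : ℚ
      l₁ = A.q even * Y - A.u even * W
      κ₁ = A.q odd * Y - A.u odd * W
      p₁ = A.qₛ * (A.u even + (P.l + P.l) * (A.u even * A.u odd + A.u even * A.u odd))
      d₁ = A.qₛ * (A.u odd + (P.l + P.l) * (A.u even * A.u even + A.u odd * A.u odd))
      sum-eq : ∀ qe qo Y l ue uo → (qe + qo) * Y ≡ 1ℚ →
        let q = qe + qo ; W = q * (1ℚ + (l + l) * (ue + uo)) in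
        (qe * Y - ue * W) + ((qo * Y - uo * W) + (q * (ue + (l + l) * (ue * uo + ue * uo)) + q * (uo + (l + l) * (ue * ue + uo * uo)))) ≡ 1ℚ
      sum-eq qe qo Y l ue uo eq = trans (solve 6 (λ qe qo Y l ue uo →
        let q = qe :+ qo ; W = q :* (con 1ℚ :+ (l :+ l) :* (ue :+ uo)) in
        (qe :* Y :- ue :* W) :+ ((qo :* Y :- uo :* W) :+ (q :* (ue :+ (l :+ l) :* (ue :* uo :+ ue :* uo)) :+ q :* (uo :+ (l :+ l) :* (ue :* ue :+ uo :* uo))))
        := q :* Y) refl qe qo Y l ue uo) eq
      P′ : Params
      P′ = record { l = l₁ ; κ = κ₁ ; p = p₁ ; d = d₁ ; sum≡1 = sum-eq (A.q even) (A.q odd) Y P.l (A.u even) (A.u odd) qY }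
      loss-eq : ∀ q x z Y l U → q * Y ≡ 1ℚ → q * (x * Y - z * (q * (1ℚ + (l + l) * U))) ≡ x - z * (q * q + 2ℚ * l * (q * q) * U)
      loss-eq q x z Y l U eq = trans (solve 6 (λ q x z Y l U → q :* (x :* Y :- z :* (q :* (con 1ℚ :+ (l :+ l) :* U)))
          := x :* (q :* Y) :- z :* (q :* q :+ (con 1ℚ :+ con 1ℚ) :* l :* (q :* q) :* U)) refl q x z Y l U)
        (trans (cong (λ r → x * r - z * (q * q + 2ℚ * l * (q * q) * U)) eq)
          (cong (_- z * (q * q + 2ℚ * l * (q * q) * U)) (ℚ.*-identityʳ x)))
      nxt : St.Next P P′
      nxt = record
        { l-eq = loss-eq A.qₛ (A.q even) (A.u even) Y P.l A.uₛ qY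
        ; κ-eq = loss-eq A.qₛ (A.q odd) (A.u odd) Y P.l A.uₛ qY
        ; p-eq = solve 4 (λ q l ue uo → q :* (q :* (ue :+ (l :+ l) :* (ue :* uo :+ ue :* uo)))
            := q :* q :* (ue :+ (con 1ℚ :+ con 1ℚ) :* l :* (ue :* uo :+ uo :* ue))) refl A.qₛ P.l (A.u even) (A.u odd)
        ; d-eq = solve 4 (λ q l ue uo → q :* (q :* (uo :+ (l :+ l) :* (ue :* ue :+ uo :* uo)))
            := q :* q :* (uo :+ (con 1ℚ :+ con 1ℚ) :* l :* (ue :* ue :+ uo :* uo))) refl A.qₛ P.l (A.u even) (A.u odd) }
      hl′ : a ⊟ b ∋ l₁
      hl′ = ⊟-sound a b ok₂ (⊡-sound qe y hqe hY) (⊡-sound ue w hue hw)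
      hκ′ : κ′ ∋ κ₁
      hκ′ = ⊟-sound c e ok₃ (⊡-sound qo y hqo hY) (⊡-sound uo w huo hw)
      hp′ : q ⊡ (ue ⊞ L ⊡ twice (ue ⊡ uo)) ∋ p₁
      hp′ = ⊡-sound q (ue ⊞ L ⊡ twice (ue ⊡ uo)) hq (⊞-sound ue (L ⊡ twice (ue ⊡ uo)) hue (⊡-sound L (twice (ue ⊡ uo)) hL
        (⊞-sound (ue ⊡ uo) (ue ⊡ uo) (⊡-sound ue uo hue huo) (⊡-sound ue uo hue huo))))
      hd′ : q ⊡ (uo ⊞ L ⊡ (ue ⊡ ue ⊞ uo ⊡ uo)) ∋ d₁
      hd′ = ⊡-sound q (uo ⊞ L ⊡ (ue ⊡ ue ⊞ uo ⊡ uo)) hq (⊞-sound uo (L ⊡ (ue ⊡ ue ⊞ uo ⊡ uo)) huo (⊡-sound L (ue ⊡ ue ⊞ uo ⊡ uo) hL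
        (⊞-sound (ue ⊡ ue) (uo ⊡ uo) (⊡-sound ue ue hue hue) (⊡-sound uo uo huo huo))))
      hΓ : twice (q ⊡ κ′) ⊞ uo ⊡ (L ⊡ (q ⊡ q) ⊡ (twice ue ⊞ uo)) ∋ R.Γ P P′ nxt
      hΓ = ∋-resp (twice (q ⊡ κ′) ⊞ uo ⊡ (L ⊡ (q ⊡ q) ⊡ (twice ue ⊞ uo))) Γ-eq
        (⊞-sound (twice (q ⊡ κ′)) (uo ⊡ (L ⊡ (q ⊡ q) ⊡ (twice ue ⊞ uo)))
          (⊞-sound (q ⊡ κ′) (q ⊡ κ′) (⊡-sound q κ′ hq hκ′) (⊡-sound q κ′ hq hκ′))
          (⊡-sound uo (L ⊡ (q ⊡ q) ⊡ (twice ue ⊞ uo)) huo (⊡-sound (L ⊡ (q ⊡ q)) (twice ue ⊞ uo) (⊡-sound L (q ⊡ q) hL (⊡-sound q q hq hq))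
            (⊞-sound (twice ue) uo (⊞-sound ue ue hue hue) huo))))
        where
        Γ-eq : (A.qₛ * κ₁ + A.qₛ * κ₁) + A.u odd * ((P.l + P.l) * (A.qₛ * A.qₛ) * ((A.u even + A.u even) + A.u odd)) ≡ R.Γ P P′ nxt
        Γ-eq = trans (cong (λ x → (x + x) + A.u odd * ((P.l + P.l) * (A.qₛ * A.qₛ) * ((A.u even + A.u even) + A.u odd)))
            (loss-eq A.qₛ (A.q odd) (A.u odd) Y P.l A.uₛ qY))
          (solve 5 (λ x uo l Q ue → let two = con 1ℚ :+ con 1ℚ in
            (x :+ x) :+ uo :* ((l :+ l) :* Q :* ((ue :+ ue) :+ uo)) := two :* x :+ uo :* (two :* l :* Q :* (two :* ue :+ uo))) refl
            (A.q odd - A.u odd * survive) (A.u odd) P.l (A.qₛ * A.qₛ) (A.u even))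

  expectation : Params → ℕ → ℚ
  expectation P j = E₃ (L.At.tree P j (suc (height j))) (λ t u w → ι (total j t u w))

  some-injective : ∀ {m n} → some m ≡ some n → m ≡ n
  some-injective refl = refl

  bound-sound : ∀ j s P → Fits s P → ∀ v → bound j s ≡ some v → val v ≤ expectation P j
  continue-sound : ∀ j P o → Good P o → ∀ v → continue j o ≡ some v → val v ≤ expectation P (suc j)
  bound-sound zero s P h v refl = ℚ.≤-reflexive (trans (ℚ.*-zeroˡ ε) (sym (trans
    (E-cong T λ t → trans (E-cong T λ u → E-0 T) (E-0 T)) (E-0 T))))
    where T = L.At.tree P 0 1
  bound-sound (suc j) s P h v eq = continue-sound j P (advanceMasses s) (advance-good s P h) v eq
  continue-sound j P (step q Γ l κ p d) (P′ , nxt , fits , hq , hΓ) v eq with bound j (masses l κ p d) in eq′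
  ... | some v′ = begin
    val v
      ≡⟨ cong val (sym (some-injective eq)) ⟩
    val ((3 ℕ.* q₂ ℕ.* g) ÷ Q ℕ.+ (q₂ ℕ.* q₁ ℕ.* v′) ÷ (Q ℕ.* Q))
      ≡⟨ val-+ ((3 ℕ.* q₂ ℕ.* g) ÷ Q) ((q₂ ℕ.* q₁ ℕ.* v′) ÷ (Q ℕ.* Q)) ⟩
    val ((3 ℕ.* q₂ ℕ.* g) ÷ Q) + val ((q₂ ℕ.* q₁ ℕ.* v′) ÷ (Q ℕ.* Q))
      ≤⟨ ℚ.+-mono-≤ first second ⟩
    (1ℚ + (1ℚ + 1ℚ)) * (x * x) * G + x * x * x * expectation P′ j
      ≡⟨ sym (R.E-total P P′ nxt j) ⟩
    expectation P (suc j) ∎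
    where
    open ℚ.≤-Reasoning
    q₁ = lower q
    q₂ = lower (q ⊡ q)
    g = lower Γ
    x = L.At.qₛ P
    G = R.Γ P P′ nxt
    lower-sound : ∀ I {x} → I ∋ x → val (lower I) ≤ x
    lower-sound (a , b) (h , _) = h
    hq₁ : val q₁ ≤ x
    hq₁ = lower-sound q hq
    hq₂ : val q₂ ≤ x * x
    hq₂ = lower-sound (q ⊡ q) (⊡-sound q q hq hq)
    hg : val g ≤ G
    hg = lower-sound Γ hΓ
    IH : val v′ ≤ expectation P′ j
    IH = bound-sound j (masses l κ p d) P′ fits v′ eq′
    first : val ((3 ℕ.* q₂ ℕ.* g) ÷ Q) ≤ (1ℚ + (1ℚ + 1ℚ)) * (x * x) * G
    first = ℚ.≤-trans (val-÷ (3 ℕ.* q₂ ℕ.* g)) (ℚ.≤-trans (ℚ.≤-reflexive (trans (val-*² (3 ℕ.* q₂) g)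
        (cong (_* val g) (trans (cong (_* ε) (ι-* 3 q₂)) (trans (cong (λ w → (1ℚ + (1ℚ + w)) * ι q₂ * ε) (ℚ.+-identityʳ 1ℚ)) (ℚ.*-assoc (1ℚ + (1ℚ + 1ℚ)) (ι q₂) ε))))))
      (*-mono (0≤* 0≤3 (0≤val q₂)) (0≤val g) (*-monoˡ 0≤3 hq₂) hg))
      where
      0≤3 : 0ℚ ≤ 1ℚ + (1ℚ + 1ℚ)
      0≤3 = 0≤ι 3
    second : val ((q₂ ℕ.* q₁ ℕ.* v′) ÷ (Q ℕ.* Q)) ≤ x * x * x * expectation P′ j
    second = ℚ.≤-trans (ℚ.≤-reflexive expand) (ℚ.≤-trans (*-monoʳ (0≤* 0≤ε² 0≤ε)
        (ι-mono (÷-lower (q₂ ℕ.* q₁ ℕ.* v′) (Q ℕ.* Q)))) (ℚ.≤-trans (ℚ.≤-reflexive contract)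
        (*-mono (0≤* (0≤val q₂) (0≤val q₁)) (0≤val v′) (*-mono (0≤val q₂) (0≤val q₁) hq₂ hq₁) IH)))
      where
      z = (q₂ ℕ.* q₁ ℕ.* v′) ÷ (Q ℕ.* Q)
      expand : val z ≡ ι (z ℕ.* (Q ℕ.* Q)) * (ε * ε * ε)
      expand = sym (trans (cong (_* (ε * ε * ε)) (trans (ι-* z (Q ℕ.* Q)) (cong (ι z *_) (ι-* Q Q))))
        (trans (solve 3 (λ z q e → z :* (q :* q) :* (e :* e :* e) := z :* e :* ((q :* e) :* (q :* e))) refl (ι z) (ι Q) ε)
        (trans (cong (val z *_) (cong₂ _*_ Qε≡1 Qε≡1)) (ℚ.*-identityʳ (val z)))))
      contract : ι (q₂ ℕ.* q₁ ℕ.* v′) * (ε * ε * ε) ≡ val q₂ * val q₁ * val v′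
      contract = trans (cong (_* (ε * ε * ε)) (trans (ι-* (q₂ ℕ.* q₁) v′) (cong (_* ι v′) (ι-* q₂ q₁))))
        (solve 4 (λ a b c e → a :* b :* c :* (e :* e :* e) := a :* e :* (b :* e) :* (c :* e)) refl (ι q₂) (ι q₁) (ι v′) ε)

  initial-fits : Fits initial fresh
  initial-fits = zero-fits , zero-fits , unit-sound , zero-fits
    where
    zero-fits : exact 0 ∋ 0ℚ
    zero-fits = ∋-resp (exact 0) (ℚ.*-zeroˡ ε) (exact-sound 0)

  exceeds-sound : ∀ a b K → exceeds a b (bound K initial) ≡ true → ι a ≤ ι b * expectation fresh K
  exceeds-sound a b K ok with bound K initial in eq
  ... | some v = begin
    ι a
      ≡⟨ sym (trans (ℚ.*-assoc (ι a) (ι Q) ε) (trans (cong (ι a *_) Qε≡1) (ℚ.*-identityʳ (ι a)))) ⟩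
    ι a * ι Q * ε
      ≡⟨ cong (_* ε) (sym (ι-* a Q)) ⟩
    ι (a ℕ.* Q) * ε
      ≤⟨ *-monoʳ 0≤ε (ι-mono (ℕ.≤ᵇ⇒≤ (a ℕ.* Q) (b ℕ.* v) (subst Bool.T (sym ok) tt))) ⟩
    ι (b ℕ.* v) * ε
      ≡⟨ trans (cong (_* ε) (ι-* b v)) (ℚ.*-assoc (ι b) (ι v) ε) ⟩
    ι b * val v
      ≤⟨ *-monoˡ (0≤ι b) (bound-sound K initial fresh initial-fits v eq) ⟩
    ι b * expectation fresh K ∎
    where open ℚ.≤-Reasoning

-- Cubic covers without short cycles

module ChainMap {V V′ : Set} {σ : V × Fin 3 → V × Fin 3} {σ′ : V′ × Fin 3 → V′ × Fin 3}
                (σσ : ∀ d → σ (σ d) ≡ d) (σσ′ : ∀ d → σ′ (σ′ d) ≡ d) (h : V → V′)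
                (commutes : ∀ v i → σ′ (h v , i) ≡ (h (proj₁ (σ (v , i))) , proj₂ (σ (v , i)))) where
  private
    module W = Walks σ σσ
    module W′ = Walks σ′ σσ′

  image : V × Fin 3 → V′ × Fin 3
  image (v , i) = h v , i

  -- The map keeps the index of a dart, so it is injective on the darts at a vertex and cannot
  -- create backtracking.
  ↝-image : ∀ {d e} → d W.↝ e → image d W′.↝ image e
  ↝-image {d} {e} (p , q) = trans (cong h p) (sym (cong proj₁ (commutes (proj₁ d) (proj₂ d)))) , λ eq →
    q (cong₂ _,_ p (cong proj₂ (trans eq (commutes (proj₁ d) (proj₂ d)))))

  chain-image : ∀ {d e n} → W.Chain d e n → W′.Chain (image d) (image e) n
  chain-image W.[ d ]     = W′.[ image d ]
  chain-image (r W.∷ c) = ↝-image r W′.∷ chain-image c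

  closed-image : ∀ {d e} → proj₁ (σ e) ≡ proj₁ d → proj₁ (σ′ (image e)) ≡ proj₁ (image d)
  closed-image {e = e} eq = trans (cong proj₁ (commutes (proj₁ e) (proj₂ e))) (cong h eq)

  acyclic-preimage : ∀ {m} → W′.NoShortCycle m → W.NoShortCycle m
  acyclic-preimage a {d} {e} c eq le = a (chain-image c) (closed-image {d} {e} eq) le

xor : Bool → Fin 2 → Fin 2
xor false b          = b
xor true  zero       = suc zero
xor true  (suc zero) = zero

xor-involutive : ∀ a b → xor a (xor a b) ≡ b
xor-involutive false b          = refl
xor-involutive true  zero       = refl
xor-involutive true  (suc zero) = refl

xor-true≢ : ∀ b → xor true b ≢ b
xor-true≢ zero       ()
xor-true≢ (suc zero) ()

xor-∘ : ∀ a b c → xor a (xor b c) ≡ xor (a Bool.xor b) c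
xor-∘ false b     c          = refl
xor-∘ true  false c          = refl
xor-∘ true  true  zero       = refl
xor-∘ true  true  (suc zero) = refl

funToFin-cong : ∀ {m n} {f g : Fin m → Fin n} → (∀ i → f i ≡ g i) → Fin.funToFin f ≡ Fin.funToFin g
funToFin-cong {zero}  h = refl
funToFin-cong {suc m} h = cong₂ Fin.combine (h zero) (funToFin-cong (λ i → h (suc i)))

-- τ pairs up the darts of a subcubic graph; it fixes the darts that are missing.
module Cover {n : ℕ} (τ : Fin n × Fin 3 → Fin n × Fin 3) (ττ : ∀ d → τ (τ d) ≡ d) where

  _≟_ : (d e : Fin n × Fin 3) → Dec (d ≡ e)
  _≟_ = ≡-dec Fin._≟_ Fin._≟_

  missing : Fin n × Fin 3 → Bool
  missing d = does (τ d ≟ d)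

  missing-fixed : ∀ {d} → missing d ≡ true → τ d ≡ d
  missing-fixed {d} eq with τ d ≟ d
  ... | yes p = p

  missing-τ : ∀ d → missing (τ d) ≡ missing d
  missing-τ d with τ d ≟ d | τ (τ d) ≟ τ d
  ... | yes _ | yes _ = refl
  ... | no  _ | no  _ = refl
  ... | yes p | no ¬q = ⊥-elim (¬q (cong τ p))
  ... | no ¬p | yes q = ⊥-elim (¬p (trans (sym q) (ττ d)))

  -- An action of a free product of groups of order two, one for each dart; the copies use it as a
  -- voltage assignment on the missing darts. The point guarantees that there is at least one copy.
  record Action : Set where
    field
      size  : ℕ
      point : Fin size
      act   : Fin n × Fin 3 → Fin size → Fin size
      act²  : ∀ d x → act d (act d x) ≡ x

  -- Copies of the graph, indexed by the points of an action; a missing dart leads to the same dart of another copy.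
  module Copies (A : Action) where
    open Action A

    Vertex : Set
    Vertex = Fin size × Fin n

    base : Vertex × Fin 3 → Fin n × Fin 3
    base ((x , v) , i) = v , i

    moved : Bool → Fin n × Fin 3 → Fin size → Fin size
    moved true  d x = act d x
    moved false d x = x

    σ : Vertex × Fin 3 → Vertex × Fin 3
    σ ((x , v) , i) = (moved (missing (v , i)) (v , i) x , proj₁ (τ (v , i))) , proj₂ (τ (v , i))

    σ-missing : ∀ {v i} x → missing (v , i) ≡ true → σ ((x , v) , i) ≡ ((act (v , i) x , v) , i)
    σ-missing {v} {i} x eq = cong₂ (λ b e → (moved b (v , i) x , proj₁ e) , proj₂ e) eq (missing-fixed eq)

    moved² : ∀ d x → moved (missing (τ d)) (τ d) (moved (missing d) d x) ≡ x
    moved² d x rewrite missing-τ d with missing d in eq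
    ... | false = refl
    ... | true rewrite missing-fixed {d} eq = act² d x

    σσ : ∀ d → σ (σ d) ≡ d
    σσ ((x , v) , i) = cong₂ (λ y e → (y , proj₁ e) , proj₂ e) (moved² (v , i) x) (ττ (v , i))

    open Walks σ σσ public

    _≟ᶜ_ : (d e : Vertex × Fin 3) → Dec (d ≡ e)
    _≟ᶜ_ = ≡-dec (≡-dec Fin._≟_ Fin._≟_) Fin._≟_

    hit : Vertex × Fin 3 → Vertex × Fin 3 → Bool
    hit D d = does (D ≟ᶜ d) ∨ does (D ≟ᶜ σ d)

    hit-self : ∀ D → hit D D ≡ true
    hit-self D with D ≟ᶜ D
    ... | yes _ = refl
    ... | no ¬p = ⊥-elim (¬p refl)

    hit-no : ∀ {D d} → D ≢ d → D ≢ σ d → hit D d ≡ false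
    hit-no {D} {d} p q with D ≟ᶜ d | D ≟ᶜ σ d
    ... | yes r | _     = ⊥-elim (p r)
    ... | no  _ | yes r = ⊥-elim (q r)
    ... | no  _ | no  _ = refl

    hit-real : ∀ {D d} → missing (base D) ≡ true → missing (base d) ≡ false → hit D d ≡ false
    hit-real {D} {d} m r = hit-no {D} {d} (λ eq → false≢true (trans (sym r) (trans (cong (λ e → missing (base e)) (sym eq)) m)))
      (λ eq → false≢true (trans (sym (trans (missing-τ (base d)) r)) (trans (cong (λ e → missing (base e)) (sym eq)) m)))
      where
      false≢true : false ≢ true
      false≢true ()

    parity : ∀ {d e k} → Vertex × Fin 3 → Chain d e k → Bool
    parity D [ d ]         = hit D d
    parity D (_∷_ {d} r c) = hit D d Bool.xor parity D c

    Real : ∀ {d e k} → Chain d e k → Set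
    Real [ d ]         = missing (base d) ≡ false
    Real (_∷_ {d} r c) = missing (base d) ≡ false × Real c

    module _ {m} (acyclic : NoShortCycle m) where

      ends-differ : ∀ {d f e i} → Chain d f i → f ↝ e → i ℕ.≤ m → d ≢ e × d ≢ σ e
      ends-differ {d} {f} {e} c s le = (λ eq → acyclic c (trans (sym (proj₁ s)) (cong proj₁ (sym eq))) le) , opposite c s le
        where
        opposite : ∀ {i} → Chain d f i → f ↝ e → i ℕ.≤ m → d ≢ σ e
        opposite [ _ ]   s le eq = proj₂ s (trans (sym (σσ e)) (cong σ (sym eq)))
        opposite (r ∷ c) s le eq = acyclic c
          (trans (sym (proj₁ s)) (trans (cong proj₁ (trans (sym (σσ e)) (cong σ (sym eq)))) (sym (proj₁ r)))) (ℕ.≤-trans (ℕ.n≤1+n _) le)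

      later-unhit : ∀ {D f d e i k} → Chain D f i → f ↝ d → (c : Chain d e k) → i ℕ.+ k ℕ.≤ suc m → parity D c ≡ false
      later-unhit {i = i} p s [ d ] le with ends-differ p s (ℕ.≤-pred (ℕ.≤-trans (ℕ.≤-reflexive (ℕ.+-comm 1 i)) le))
      ... | q , q′ = hit-no q q′
      later-unhit {D} {i = i} p s (_∷_ {d} {n = k} r c) le
        with ends-differ p s (ℕ.≤-pred (ℕ.≤-trans (ℕ.≤-trans (ℕ.m≤m+n (suc i) k) (ℕ.≤-reflexive (sym (ℕ.+-suc i k)))) le))
      ... | q , q′ rewrite hit-no q q′ =
        later-unhit (join p s [ d ]) r c (ℕ.≤-trans (ℕ.≤-reflexive (trans (ℕ.+-assoc i 1 k) refl)) le)

      -- The witness is the first missing dart on the walk. Meeting it or its reverse again would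
      -- close a walk of length at most `m`, so its parity is odd.
      find-missing : ∀ {d e k} (c : Chain d e k) → k ℕ.≤ suc m →
                     Real c ⊎ ∃[ D ] ∃[ i ] (missing (base D) ≡ true × Chain d D i × i ℕ.≤ k × parity D c ≡ true)
      find-missing {d} c le = go (missing (base d)) refl c le
        where
        go : ∀ {d e k} b → missing (base d) ≡ b → (c : Chain d e k) → k ℕ.≤ suc m →
             Real c ⊎ ∃[ D ] ∃[ i ] (missing (base D) ≡ true × Chain d D i × i ℕ.≤ k × parity D c ≡ true)
        go false eq [ d ]         le = inj₁ eq
        go true  eq [ d ]         le = inj₂ (d , 1 , eq , [ d ] , ℕ.≤-refl , hit-self d)
        go true  eq (_∷_ {d} r c) le = inj₂ (d , 1 , eq , [ d ] , ℕ.s≤s ℕ.z≤n , cong₂ Bool._xor_ (hit-self d) (later-unhit [ d ] r c le))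
        go false eq (_∷_ {d} {d′} r c) le with go (missing (base d′)) refl c (ℕ.≤-trans (ℕ.n≤1+n _) le)
        ... | inj₁ real = inj₁ (eq , real)
        ... | inj₂ (D , i , mD , p , i≤ , par) =
              inj₂ (D , suc i , mD , r ∷ p , ℕ.s≤s i≤ , trans (cong (Bool._xor parity D c) (hit-real {D} {d} mD eq)) par)

  -- Each point is provided with one bit per dart of the copies, and acting along a missing dart flips its bit and
  -- that of its reverse.  A shortest closed walk traverses a missing dart at most once, so its lift does not close up.
  module Doubling (A : Action) where
    open Action A
    private module C = Copies A

    bits : ℕ
    bits = (size ℕ.* n) ℕ.* 3

    decode : Fin bits → C.Vertex × Fin 3
    decode b = Fin.remQuot n (proj₁ (Fin.remQuot 3 b)) , proj₂ (Fin.remQuot {size ℕ.* n} 3 b)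

    encode : C.Vertex × Fin 3 → Fin bits
    encode ((x , v) , i) = Fin.combine (Fin.combine x v) i

    decode-encode : ∀ d → decode (encode d) ≡ d
    decode-encode ((x , v) , i) = trans
      (cong (λ e → Fin.remQuot n (proj₁ e) , proj₂ e) (Fin.remQuot-combine (Fin.combine x v) i))
      (cong (_, i) (Fin.remQuot-combine x v))

    size′ : ℕ
    size′ = size ℕ.* 2 ℕ.^ bits

    pos : Fin size′ → Fin size
    pos y = proj₁ (Fin.remQuot (2 ℕ.^ bits) y)

    bit : Fin size′ → Fin bits → Fin 2
    bit y = Fin.finToFun (proj₂ (Fin.remQuot {size} (2 ℕ.^ bits) y))

    pack : Fin size → (Fin bits → Fin 2) → Fin size′
    pack x f = Fin.combine x (Fin.funToFin f)

    pos-pack : ∀ x f → pos (pack x f) ≡ x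
    pos-pack x f = cong proj₁ (Fin.remQuot-combine x (Fin.funToFin f))

    bit-pack : ∀ x f b → bit (pack x f) b ≡ f b
    bit-pack x f b = trans (cong (λ e → Fin.finToFun (proj₂ e) b) (Fin.remQuot-combine x (Fin.funToFin f))) (Fin.finToFun-funToFin f b)

    pack-cong : ∀ {x y f g} → x ≡ y → (∀ b → f b ≡ g b) → pack x f ≡ pack y g
    pack-cong {x} refl h = cong (Fin.combine x) (funToFin-cong h)

    pack-pos-bit : ∀ y → pack (pos y) (bit y) ≡ y
    pack-pos-bit y = trans (cong (Fin.combine (pos y)) (Fin.funToFin-finToFin {bits} {2} (proj₂ (Fin.remQuot {size} (2 ℕ.^ bits) y))))
      (Fin.combine-remQuot {size} (2 ℕ.^ bits) y)

    cell : Fin n × Fin 3 → Fin size → C.Vertex × Fin 3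
    cell (v , i) x = (x , v) , i

    flips : Fin n × Fin 3 → Fin size → Fin bits → Bool
    flips d x b = does (decode b C.≟ᶜ cell d x) ∨ does (decode b C.≟ᶜ cell d (act d x))

    flips-act : ∀ d x b → flips d (act d x) b ≡ flips d x b
    flips-act d x b rewrite act² d x = Bool.∨-comm (does (decode b C.≟ᶜ cell d (act d x))) (does (decode b C.≟ᶜ cell d x))

    act′ : Fin n × Fin 3 → Fin size′ → Fin size′
    act′ d y = pack (act d (pos y)) (λ b → xor (flips d (pos y) b) (bit y b))

    doubled : Action
    doubled = record
      { size  = size′
      ; point = pack point (λ _ → zero)
      ; act   = act′
      ; act²  = λ d y → trans (pack-cong
          (trans (cong (act d) (pos-pack (act d (pos y)) _)) (act² d (pos y)))
          (λ b → trans (cong₂ xor (trans (cong (λ x → flips d x b) (pos-pack (act d (pos y)) _)) (flips-act d (pos y) b))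
                                  (bit-pack (act d (pos y)) _ b))
                       (xor-involutive (flips d (pos y) b) (bit y b))))
          (pack-pos-bit y) }

    private module C′ = Copies doubled

    down : C′.Vertex → C.Vertex
    down (y , v) = pos y , v

    down-σ : ∀ w i → C.σ (down w , i) ≡ (down (proj₁ (C′.σ (w , i))) , proj₂ (C′.σ (w , i)))
    down-σ (y , v) i with missing (v , i)
    ... | false = refl
    ... | true  = cong (λ x → (x , proj₁ (τ (v , i))) , proj₂ (τ (v , i))) (sym (pos-pack (act (v , i) (pos y)) _))

    open ChainMap {σ = C′.σ} {σ′ = C.σ} C′.σσ C.σσ down down-σ

    sheet : C′.Vertex × Fin 3 → Fin size′
    sheet ((y , _) , _) = y

    step-bit : ∀ D d → missing (C.base D) ≡ true → bit (sheet (C′.σ d)) (encode D) ≡ xor (C.hit D (image d)) (bit (sheet d) (encode D))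
    step-bit D ((y , v) , i) mD = go (missing (v , i)) refl
      where
      go : ∀ b → missing (v , i) ≡ b →
           bit (C′.moved b (v , i) y) (encode D) ≡ xor (C.hit D ((pos y , v) , i)) (bit y (encode D))
      go false eq = cong (λ h → xor h (bit y (encode D))) (sym (C.hit-real {D} {(pos y , v) , i} mD eq))
      go true  eq = trans (bit-pack (act (v , i) (pos y)) _ (encode D)) (cong (λ h → xor h (bit y (encode D)))
        (trans (cong (λ e → does (e C.≟ᶜ cell (v , i) (pos y)) ∨ does (e C.≟ᶜ cell (v , i) (act (v , i) (pos y)))) (decode-encode D))
          (cong (λ e → does (D C.≟ᶜ cell (v , i) (pos y)) ∨ does (D C.≟ᶜ e)) (sym (C.σ-missing (pos y) eq)))))

    chain-bit : ∀ D {d e k} → missing (C.base D) ≡ true → (c : C′.Chain d e k) →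
                bit (sheet (C′.σ e)) (encode D) ≡ xor (C.parity D (chain-image c)) (bit (sheet d) (encode D))
    chain-bit D mD C′.[ d ] = step-bit D d mD
    chain-bit D mD (C′._∷_ {d} {d′} r c) = trans (chain-bit D mD c) (trans
      (cong (xor (C.parity D (chain-image c))) (trans (cong (λ w → bit (proj₁ w) (encode D)) (proj₁ r)) (step-bit D d mD)))
      (trans (xor-∘ (C.parity D (chain-image c)) (C.hit D (image d)) (bit (sheet d) (encode D)))
        (cong (λ h → xor h (bit (sheet d) (encode D))) (Bool.xor-comm (C.parity D (chain-image c)) (C.hit D (image d))))))

    doubled-acyclic : ∀ {m} → C.NoShortCycle m →
      (∀ {d e k} (c : C.Chain d e k) → C.Real c → proj₁ (C.σ e) ≡ proj₁ d → k ℕ.≤ suc m → ⊥) →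
      C′.NoShortCycle (suc m)
    doubled-acyclic acyclic real-acyclic {d} {e} c closed le with C.find-missing acyclic (chain-image c) le
    ... | inj₁ real = real-acyclic (chain-image c) real (closed-image {d} {e} closed) le
    ... | inj₂ (D , _ , mD , _ , _ , par) = xor-true≢ (bit (sheet d) (encode D)) (trans (cong (λ h → xor h (bit (sheet d) (encode D))) (sym par))
            (trans (sym (chain-bit D mD c)) (cong (λ w → bit (proj₁ w) (encode D)) closed)))

  trivial : Action
  trivial = record { size = 1 ; point = zero ; act = λ _ x → x ; act² = λ _ _ → refl }

  tower : ℕ → Action
  tower zero    = trivial
  tower (suc m) = Doubling.doubled (tower m)

  module Base = Walks τ ττ

  RealBase : ∀ {d e k} → Base.Chain d e k → Set
  RealBase Base.[ d ]             = missing d ≡ false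
  RealBase (Base._∷_ {d} r c) = missing d ≡ false × RealBase c

  module _ (g : ℕ) (real-acyclic : ∀ {d e k} (c : Base.Chain d e k) → RealBase c → proj₁ (τ e) ≡ proj₁ d → k ℕ.≤ g → ⊥) where

    tower-acyclic : ∀ m → m ℕ.≤ g → Copies.NoShortCycle (tower m) m
    tower-acyclic zero    le Walks.[ _ ]     _ ()
    tower-acyclic zero    le (_ Walks.∷ _) _ ()
    tower-acyclic (suc m) le = Doubling.doubled-acyclic (tower m) (tower-acyclic m (ℕ.≤-trans (ℕ.n≤1+n m) le))
      λ {d} {e} c real closed k≤ → real-acyclic (chain-image c) (real-image c real) (closed-image {d} {e} closed) (ℕ.≤-trans k≤ le)
      where
      open Copies (tower m)
      open ChainMap {σ = σ} {σ′ = τ} σσ ττ proj₂ (λ _ _ → refl)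
      real-image : ∀ {d e k} (c : Chain d e k) → Real c → RealBase (chain-image c)
      real-image [ d ]   r       = r
      real-image (_ ∷ c) (r , s) = r , real-image c s

-- The darts of a subcubic graph

sum-split : ∀ m n (f : Fin (m ℕ.+ n) → ℕ) → sum f ≡ sum (λ i → f (i Fin.↑ˡ n)) ℕ.+ sum (λ i → f (m Fin.↑ʳ i))
sum-split zero    n f = refl
sum-split (suc m) n f = trans (cong (f zero ℕ.+_) (sum-split m n (λ i → f (suc i)))) (sym (ℕ.+-assoc (f zero) _ _))

sum-combine : ∀ m n (f : Fin (m ℕ.* n) → ℕ) → sum f ≡ sum λ x → sum λ v → f (Fin.combine {m} {n} x v)
sum-combine zero    n f = refl
sum-combine (suc m) n f = trans (sum-split n (m ℕ.* n) f)
  (cong (sum (λ v → f (v Fin.↑ˡ (m ℕ.* n))) ℕ.+_) (sum-combine m n (λ x → f (n Fin.↑ʳ x))))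

pigeonhole : ∀ m (a : Fin (suc m) → ℕ) c → suc m ℕ.* c ℕ.≤ sum a → ∃[ x ] c ℕ.≤ a x
pigeonhole zero    a c h = zero , subst₂ ℕ._≤_ (ℕ.+-identityʳ c) (ℕ.+-identityʳ (a zero)) h
pigeonhole (suc m) a c h with c ℕ.≤? a zero
... | yes p = zero , p
... | no ¬p with pigeonhole m (λ x → a (suc x)) c (ℕ.+-cancelˡ-≤ c _ _ (ℕ.≤-trans h (ℕ.+-monoˡ-≤ _ (ℕ.<⇒≤ (ℕ.≰⇒> ¬p)))))
...   | x , q = suc x , q

∣tabulate∣ : ∀ {n} (p : Fin n → Bool) → ∣ Vec.tabulate p ∣ ≡ sum λ v → b2n (p v)
∣tabulate∣ {zero}  p = refl
∣tabulate∣ {suc n} p with p zero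
... | true  = cong suc (∣tabulate∣ (λ v → p (suc v)))
... | false = ∣tabulate∣ (λ v → p (suc v))

length-filter : ∀ {A : Set} {P : A → Set} (P? : ∀ a → Dec (P a)) {n} (f : Fin n → A) →
                List.length (List.filter P? (List.tabulate f)) ≡ ∣ Vec.tabulate (λ i → does (P? (f i))) ∣
length-filter P? {zero}  f = refl
length-filter P? {suc n} f with does (P? (f zero))
... | true  = cong suc (length-filter P? (λ i → f (suc i)))
... | false = length-filter P? (λ i → f (suc i))

module Slots {n} (G : Graph n) (subcubic : Subcubic G) where
  open Graph G using (adj?) renaming (sym to adj-sym; irrefl to adj-irrefl)

  neighbours : Fin n → List (Fin n)
  neighbours v = List.filter (adj? v) (List.allFin n)

  at-most-3 : ∀ v → List.length (neighbours v) ℕ.≤ 3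
  at-most-3 v = ℕ.≤-trans (ℕ.≤-reflexive (length-filter (adj? v) id)) (subcubic v)

  -- The position of `w` in the list of neighbours of `v`. The default for other vertices is
  -- harmless, because `search` also requires adjacency.
  rank : Fin n → Fin n → Fin 3
  rank v w with adj? v w
  ... | yes a = Fin.inject≤ (index (∈-filter⁺ (adj? v) (∈-allFin w) a)) (at-most-3 v)
  ... | no  _ = zero

  rank-injective : ∀ {v w w′} → Adj G v w → Adj G v w′ → rank v w ≡ rank v w′ → w ≡ w′
  rank-injective {v} {w} {w′} a a′ eq with adj? v w | adj? v w′
  ... | yes b | yes b′ = trans (lookup-index (∈-filter⁺ (adj? v) (∈-allFin w) b)) (trans
          (cong (List.lookup (neighbours v)) (Fin.inject≤-injective _ _ _ _ eq)) (sym (lookup-index (∈-filter⁺ (adj? v) (∈-allFin w′) b′))))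
  ... | no ¬b | _      = ⊥-elim (¬b a)
  ... | yes _ | no ¬b′ = ⊥-elim (¬b′ a′)

  search : ∀ v i → Dec (∃[ w ] (Adj G v w × rank v w ≡ i))
  search v i = Fin.any? (λ w → adj? v w ×-dec (rank v w Fin.≟ i))

  τ : Fin n × Fin 3 → Fin n × Fin 3
  τ (v , i) with search v i
  ... | yes (w , _) = w , rank w v
  ... | no  _       = v , i

  τ-edge : ∀ {v w} → Adj G v w → τ (v , rank v w) ≡ (w , rank w v)
  τ-edge {v} {w} a with search v (rank v w)
  ... | yes (w′ , a′ , eq) = cong (λ x → x , rank x v) (rank-injective a′ a eq)
  ... | no ¬p = ⊥-elim (¬p (w , a , refl))

  τ-cases : ∀ v i → (∃[ w ] (Adj G v w × rank v w ≡ i × τ (v , i) ≡ (w , rank w v))) ⊎ τ (v , i) ≡ (v , i)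
  τ-cases v i with search v i
  ... | yes (w , a , eq) = inj₁ (w , a , eq , refl)
  ... | no  _            = inj₂ refl

  ττ : ∀ d → τ (τ d) ≡ d
  ττ (v , i) with τ-cases v i
  ... | inj₁ (w , a , refl , eq) = trans (cong τ eq) (τ-edge (adj-sym a))
  ... | inj₂ eq = trans (cong τ eq) eq

  open Cover τ ττ

  missing-false : ∀ {d} → missing d ≡ false → τ d ≢ d
  missing-false {d} eq p with τ d ≟ d
  missing-false () p | yes _
  ... | no ¬q = ¬q p

  edge-real : ∀ {v w} → Adj G v w → missing (v , rank v w) ≡ false
  edge-real {v} {w} a with τ (v , rank v w) ≟ (v , rank v w)
  ... | no  _ = refl
  ... | yes p = ⊥-elim (adj-irrefl (cong proj₁ (trans (sym p) (τ-edge a))) a)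

  real-edge : ∀ d → missing d ≡ false → Adj G (proj₁ d) (proj₁ (τ d)) × proj₂ d ≡ rank (proj₁ d) (proj₁ (τ d))
  real-edge (v , i) r with τ-cases v i
  ... | inj₁ (w , a , eq , eq′) rewrite eq′ = a , sym eq
  ... | inj₂ eq = ⊥-elim (missing-false r eq)

  open Base

  trail : ∀ {d e k} → Chain d e k → List (Fin n)
  trail [ d ]         = proj₁ d ∷ []
  trail (_∷_ {d} r c) = proj₁ d ∷ trail c

  trail-rest : ∀ {d e k} (c : Chain d e k) → ∃[ vs ] (trail c ≡ proj₁ d ∷ vs)
  trail-rest [ d ]   = [] , refl
  trail-rest (r ∷ c) = trail c , refl

  trail-length : ∀ {d e k} (c : Chain d e k) → List.length (trail c) ≡ k
  trail-length [ d ]   = refl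
  trail-length (r ∷ c) = cong suc (trail-length c)

  trail-linked : ∀ {d e k} (c : Chain d e k) → RealBase c → Linked (Adj G) (trail c List.∷ʳ proj₁ (τ e))
  trail-linked [ d ] r = proj₁ (real-edge d r) ∷ [-]
  trail-linked (_∷_ {d} s c) (r , rs) with trail c | trail-rest c | trail-linked c rs
  ... | _ | vs , refl | l = subst (Adj G (proj₁ d)) (sym (proj₁ s)) (proj₁ (real-edge d r)) ∷ l

  ShortAcyclic : ℕ → Set
  ShortAcyclic m = ∀ {d e k} (c : Chain d e k) → RealBase c → proj₁ (τ e) ≡ proj₁ d → k ℕ.≤ m → ⊥

  real-join : ∀ {d e e′ f k m} (c : Chain d e k) (s : e ↝ e′) (c′ : Chain e′ f m) → RealBase c → RealBase c′ → RealBase (join c s c′)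
  real-join [ d ]   s c′ r        r′ = r , r′
  real-join (_ ∷ c) s c′ (r , rs) r′ = r , real-join c s c′ rs r′

  module _ {m} (acyclic : ShortAcyclic m) where

    trail-apart : ∀ {d f e f′ i k} (p : Chain d f i) → RealBase p → f ↝ f′ → (c : Chain f′ e k) → RealBase c →
                  i ℕ.+ k ℕ.≤ suc m → All (proj₁ d ≢_) (trail c)
    trail-apart {i = i} p rp s [ _ ] rc le =
      (λ eq → acyclic p rp (trans (sym (proj₁ s)) (sym eq)) (ℕ.≤-pred (ℕ.≤-trans (ℕ.≤-reflexive (ℕ.+-comm 1 i)) le))) ∷ []
    trail-apart {i = i} p rp s (_∷_ {d} {n = k} r c) (rd , rc) le =
      (λ eq → acyclic p rp (trans (sym (proj₁ s)) (sym eq))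
        (ℕ.≤-pred (ℕ.≤-trans (ℕ.≤-trans (ℕ.m≤m+n (suc i) k) (ℕ.≤-reflexive (sym (ℕ.+-suc i k)))) le))) ∷
      trail-apart (join p s [ d ]) (real-join p s [ d ] rp rd) r c rc (ℕ.≤-trans (ℕ.≤-reflexive (ℕ.+-assoc i 1 k)) le)

    trail-unique : ∀ {d e k} (c : Chain d e k) → RealBase c → k ℕ.≤ suc m → Unique (trail c)
    trail-unique [ d ] r le = [] ∷ []
    trail-unique (_∷_ {d} s c) (r , rs) le = trail-apart [ d ] r s c rs le ∷ trail-unique c rs (ℕ.≤-trans (ℕ.n≤1+n _) le)

    cycle : ∀ {d e} (c : Chain d e (suc m)) → RealBase c → proj₁ (τ e) ≡ proj₁ d → Cycle G (suc m)
    cycle {d} {e} c rc closed with trail c | trail-rest c | trail-linked c rc | trail-unique c rc ℕ.≤-refl | trail-length c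
    ... | _ | vs , refl | linked | unique | len = record
      { start    = proj₁ d
      ; rest     = vs
      ; closed   = subst (λ w → Linked (Adj G) (proj₁ d ∷ (vs List.∷ʳ w))) closed linked
      ; distinct = unique
      ; length≡k = len
      ; 3≤k      = long c rc closed }
      where
      long : ∀ {d e k} (c : Chain d e k) → RealBase c → proj₁ (τ e) ≡ proj₁ d → 3 ℕ.≤ k
      long [ d ] r closed = ⊥-elim (adj-irrefl (sym closed) (proj₁ (real-edge d r)))
      -- Two vertices have only one dart from one to the other, so a closed walk of two darts would
      -- backtrack.
      long {d} {e} (s ∷ [ _ ]) (r , r′) closed = ⊥-elim (proj₂ s (cong₂ _,_ (proj₁ s) (begin
        proj₂ e                                   ≡⟨ proj₂ (real-edge e r′) ⟩
        rank (proj₁ e) (proj₁ (τ e))              ≡⟨ cong₂ rank (proj₁ s) closed ⟩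
        rank (proj₁ (τ d)) (proj₁ d)              ≡⟨ cong (λ x → rank (proj₁ (τ d)) (proj₁ x)) (sym (ττ d)) ⟩
        rank (proj₁ (τ d)) (proj₁ (τ (τ d)))      ≡⟨ sym (proj₂ (real-edge (τ d) (trans (missing-τ d) r))) ⟩
        proj₂ (τ d)                               ∎)))
        where open ≡-Reasoning
      long (_ ∷ (_ ∷ [ _ ])) _ _ = ℕ.s≤s (ℕ.s≤s (ℕ.s≤s ℕ.z≤n))
      long (_ ∷ (_ ∷ (_ ∷ _))) _ _ = ℕ.s≤s (ℕ.s≤s (ℕ.s≤s ℕ.z≤n))

  -- Induction on the length: once shorter closed walks are excluded, a closed walk repeats no
  -- vertex and is a cycle of the graph.
  short-acyclic : ∀ {g} → (∀ {k} → Cycle G k → g ℕ.≤ k) → ∀ m → m ℕ.< g → ShortAcyclic m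
  short-acyclic h zero    lt [ _ ]   _  _ ()
  short-acyclic h zero    lt (_ ∷ _) _  _ ()
  short-acyclic h (suc m) lt {k = k} c rc closed le with ℕ.m≤n⇒m<n∨m≡n le
  ... | inj₁ (ℕ.s≤s le′) = short-acyclic h m (ℕ.<-trans (ℕ.n<1+n m) lt) c rc closed le′
  ... | inj₂ refl = ℕ.<-irrefl refl (ℕ.<-≤-trans lt (h (cycle (short-acyclic h m (ℕ.<-trans (ℕ.n<1+n m) lt)) c rc closed)))

-- Averaging over labellings and over copies

ι-reflect : ∀ {m n} → ι m ℚ.≤ ι n → m ℕ.≤ n
ι-reflect {m} {n} h with m ℕ.≤? n
... | yes p = p
... | no ¬p = ⊥-elim (ℚ.<-irrefl refl (ℚ.<-≤-trans (ℚ.<-≤-trans ιn<ιsn (ι-mono (ℕ.≰⇒> ¬p))) h))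
  where
  ιn<ιsn : ι n ℚ.< ι (suc n)
  ιn<ιsn = ℚ.≤-<-trans (ℚ.≤-reflexive (sym (ℚ.+-identityˡ (ι n)))) (ℚ.+-monoˡ-< (ι n) (ℚ.positive⁻¹ 1ℚ))

sum-* : ∀ {m} c (f : Fin m → ℕ) → c ℕ.* sum f ≡ sum λ x → c ℕ.* f x
sum-* {zero}  c f = ℕ.*-zeroʳ c
sum-* {suc m} c f = trans (ℕ.*-distribˡ-+ c (f zero) _) (cong (c ℕ.* f zero ℕ.+_) (sum-* c (λ x → f (suc x))))

E-sum : ∀ {A} {μ : Meas A} → IsProb μ → ∀ {N} (f : A → Fin N → ℕ) e → (∀ v → E μ (λ a → ι (f a v)) ≡ e) →
        E μ (λ a → ι (sum (f a))) ≡ ι N ℚ.* e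
E-sum {μ = μ} pr {zero}  f e h = trans (E-const {μ = μ} pr 0ℚ) (sym (ℚ.*-zeroˡ e))
E-sum {μ = μ} pr {suc N} f e h = trans (E-cong μ (λ a → ι-+ (f a zero) _)) (trans (E-+ μ _ _)
  (trans (cong₂ ℚ._+_ (h zero) (E-sum {μ = μ} pr (λ a v → f a (suc v)) e (λ v → h (suc v))))
    (solve 2 (λ e n → e :+ n :* e := (con 1ℚ :+ n) :* e) refl e (ι N))))

module CoinMaximum (ra rb rc : ℚ) (coin-sum : ra ℚ.+ (rb ℚ.+ rc) ≡ 1ℚ)
                   (0≤ra : 0ℚ ℚ.≤ ra) (0≤rb : 0ℚ ℚ.≤ rb) (0≤rc : 0ℚ ℚ.≤ rc) where
  open import Data.Rational.Base using (_+_; _*_; _≤_)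
  open Law ra rb rc coin-sum using (coin)

  largest : ∀ (f : Coin → ℚ) → ∃[ a ] (f always ≤ f a × f onOdd ≤ f a × f never ≤ f a)
  largest f with ℚ.≤-total (f always) (f onOdd) | ℚ.≤-total (f always) (f never) | ℚ.≤-total (f onOdd) (f never)
  ... | inj₁ p | _      | inj₁ q = never , ℚ.≤-trans p q , q , ℚ.≤-refl
  ... | inj₁ p | _      | inj₂ q = onOdd , p , ℚ.≤-refl , q
  ... | inj₂ p | inj₁ q | _      = never , q , ℚ.≤-trans p q , ℚ.≤-refl
  ... | inj₂ p | inj₂ q | _      = always , ℚ.≤-refl , p , q

  attained-coin : Attained coin
  attained-coin f with largest f
  ... | a , p , q , r = a , (begin
    ra * f always + (rb * f onOdd + (rc * f never + 0ℚ))
      ≤⟨ ℚ.+-mono-≤ (*-monoˡ 0≤ra p) (ℚ.+-mono-≤ (*-monoˡ 0≤rb q) (ℚ.+-monoˡ-≤ 0ℚ (*-monoˡ 0≤rc r))) ⟩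
    ra * f a + (rb * f a + (rc * f a + 0ℚ))
      ≡⟨ solve 4 (λ a b c x → a :* x :+ (b :* x :+ (c :* x :+ con 0ℚ)) := (a :+ (b :+ c)) :* x) refl ra rb rc (f a) ⟩
    (ra + (rb + rc)) * f a
      ≡⟨ trans (cong (_* f a) coin-sum) (ℚ.*-identityˡ (f a)) ⟩
    f a ∎)
    where open ℚ.≤-Reasoning

opaque
  -- A dart rings for all parities with probability A / Q = 5 · 10⁻⁶ and for odd parity with (A + B) / Q = 5 · 10⁻⁴,
  -- values found by experiment.  Interval arithmetic loses about 0.6 decimal digits per round, whence the size of the denominator.
  rounds Q A B C numerator denominator : ℕ
  rounds      = 1900
  Q           = 1000000 ℕ.* 10 ℕ.^ 1244
  A           = 5 ℕ.* 10 ℕ.^ 1244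
  B           = 495 ℕ.* 10 ℕ.^ 1244
  C           = 999500 ℕ.* 10 ℕ.^ 1244
  numerator   = 8704
  denominator = 10000

  A+B+C≡Q : A ℕ.+ (B ℕ.+ C) ≡ Q
  A+B+C≡Q = refl

  Q≢0 : ℕ.NonZero Q
  Q≢0 = _

  computation : Arithmetic.exceeds Q (B ℕ.+ C) C numerator denominator
                  (Arithmetic.bound Q (B ℕ.+ C) C rounds (Arithmetic.initial Q (B ℕ.+ C) C)) ≡ true
  computation = refl

-- Twice the depth of an unfolding, since two unfoldings at one vertex must read disjoint labels. As
-- `height j` is 2^(j+1) - 2, this is 2^1902 - 2, a number that is never evaluated.
radius : ℕ
radius = suc (height rounds) ℕ.+ suc (height rounds)

module Conclusion {n} (G : Graph n) (subcubic : Subcubic G)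
                  (T : Cover.Action (Slots.τ G subcubic) (Slots.ττ G subcubic))
                  (copies-acyclic : Cover.Copies.NoShortCycle (Slots.τ G subcubic) (Slots.ττ G subcubic) T radius) where
  open Slots G subcubic
  open Cover τ ττ
  open import Data.Rational.Base using (_*_; _≤_)
  open Action T using (size; point)
  module Copy = Copies T

  N : ℕ
  N = size ℕ.* n

  split : Fin N → Copy.Vertex
  split = Fin.remQuot n

  merge : Copy.Vertex → Fin N
  merge (x , v) = Fin.combine {size} {n} x v

  σN : Fin N × Fin 3 → Fin N × Fin 3
  σN (w , i) = merge (proj₁ (Copy.σ (split w , i))) , proj₂ (Copy.σ (split w , i))

  split-merge : ∀ y → split (merge y) ≡ y
  split-merge (x , v) = Fin.remQuot-combine x v

  σσN : ∀ d → σN (σN d) ≡ d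
  σσN (w , i) = trans
    (cong (λ y → merge (proj₁ (Copy.σ (y , proj₂ (Copy.σ (split w , i))))) , proj₂ (Copy.σ (y , proj₂ (Copy.σ (split w , i))))) (split-merge (proj₁ (Copy.σ (split w , i)))))
    (trans (cong (λ e → merge (proj₁ e) , proj₂ e) (Copy.σσ (split w , i))) (cong (_, i) (Fin.combine-remQuot {size} n w)))

  acyclic : Walks.NoShortCycle σN σσN radius
  acyclic = ChainMap.acyclic-preimage {σ = σN} {σ′ = Copy.σ} σσN Copy.σσ split
    (λ w i → cong (_, proj₂ (Copy.σ (split w , i))) (sym (split-merge (proj₁ (Copy.σ (split w , i))))))
    copies-acyclic

  ε-data = reciprocal Q Q≢0
  module Certified = Soundness Q A B C A+B+C≡Q Q≢0 (proj₁ ε-data) (proj₁ (proj₂ ε-data)) (proj₂ (proj₂ ε-data))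
  open Certified using (val; weights-sum; 0≤val; expectation)
  open Law (val A) (val B) (val C) weights-sum using (coin; coins; prob-coin; prob-coins)
  open Labels (val A) (val B) (val C) weights-sum N σN σσN rounds
  open Simulation (Fin N)
  open Certificate N
  open CoinMaximum (val A) (val B) (val C) weights-sum (0≤val A) (0≤val B) (0≤val C)

  e : ℚ
  e = expectation fresh rounds

  E-remaining : ∀ v → E labels (λ ℓ → ι (remaining rounds (init ℓ) v)) ≡ e
  E-remaining v = trans (E-cong labels (λ ℓ → cong ι (remaining-total rounds (init ℓ) v)))
    (E-vertex acyclic (suc (height rounds)) v ℕ.≤-refl (λ t u w → ι (total rounds t u w)))

  prob-labels : IsProb labels
  prob-labels = prob-iid {μ = coins rounds} (prob-coins rounds) (N ℕ.* 3)

  attained-labels : Attained labels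
  attained-labels = attained-iid {μ = coins rounds} (attained-iid {μ = coin} attained-coin rounds) (N ℕ.* 3)

  totalGain : Labelling → ℚ
  totalGain ℓ = ι (sum (remaining rounds (init ℓ)))

  E-totalGain : E labels totalGain ≡ ι N * e
  E-totalGain = E-sum {μ = labels} prob-labels (λ ℓ → remaining rounds (init ℓ)) e E-remaining

  opaque
    best : ∃[ ℓ ] (E labels totalGain ≤ totalGain ℓ)
    best = attained-labels totalGain

  e-bound : ι numerator ≤ ι denominator * e
  e-bound = Certified.exceeds-sound numerator denominator rounds computation

  ℓ : Labelling
  ℓ = proj₁ best

  S : Fin N → Bool
  S = proj₁ (certificate rounds (init ℓ))

  valid : Valid (init ℓ) S
  valid = proj₁ (proj₂ (certificate rounds (init ℓ)))

  layer : Fin size → Subset n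
  layer x = Vec.tabulate λ v → S (Fin.combine {size} {n} x v)

  weight-init : ∀ w → weight (init ℓ) S w ≡ 2 ℕ.* b2n (S w)
  weight-init w = ℕ.+-identityʳ (2 ℕ.* b2n (S w))

  sum-layers : sum (weight (init ℓ) S) ≡ sum λ x → 2 ℕ.* ∣ layer x ∣
  sum-layers = trans (sum-cong-≗ weight-init) (trans (sum-combine size n (λ w → 2 ℕ.* b2n (S w)))
    (sum-cong-≗ λ x → trans (sym (sum-* {n} 2 (λ v → b2n (S (Fin.combine {size} {n} x v))))) (cong (2 ℕ.*_) (sym (∣tabulate∣ (λ v → S (Fin.combine {size} {n} x v)))))))

  total-bound : numerator ℕ.* N ℕ.≤ denominator ℕ.* sum (λ x → 2 ℕ.* ∣ layer x ∣)
  total-bound = ι-reflect (begin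
    ι (numerator ℕ.* N)                                  ≡⟨ ι-* numerator N ⟩
    ι numerator * ι N                                    ≤⟨ *-monoʳ (0≤ι N) e-bound ⟩
    ι denominator * e * ι N                              ≡⟨ trans (ℚ.*-assoc (ι denominator) e (ι N)) (cong (ι denominator *_) (ℚ.*-comm e (ι N))) ⟩
    ι denominator * (ι N * e)                            ≤⟨ *-monoˡ (0≤ι denominator) (ℚ.≤-trans (ℚ.≤-trans (ℚ.≤-reflexive (sym E-totalGain)) (proj₂ best))
                                                              (ι-mono (proj₂ (proj₂ (certificate rounds (init ℓ)))))) ⟩
    ι denominator * ι (sum (weight (init ℓ) S))          ≡⟨ sym (ι-* denominator (sum (weight (init ℓ) S))) ⟩
    ι (denominator ℕ.* sum (weight (init ℓ) S))          ≡⟨ cong (λ s → ι (denominator ℕ.* s)) sum-layers ⟩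
    ι (denominator ℕ.* sum (λ x → 2 ℕ.* ∣ layer x ∣))    ∎)
    where open ℚ.≤-Reasoning

  large-layer : ∃[ x ] numerator ℕ.* n ℕ.≤ denominator ℕ.* (2 ℕ.* ∣ layer x ∣)
  large-layer = choose size point (λ x → denominator ℕ.* (2 ℕ.* ∣ layer x ∣)) (ℕ.≤-trans (ℕ.≤-reflexive regroup)
      (ℕ.≤-trans total-bound (ℕ.≤-reflexive (sum-* denominator (λ x → 2 ℕ.* ∣ layer x ∣)))))
    where
    regroup : size ℕ.* (numerator ℕ.* n) ≡ numerator ℕ.* (size ℕ.* n)
    regroup = trans (sym (ℕ.*-assoc size numerator n)) (trans (cong (ℕ._* n) (ℕ.*-comm size numerator)) (ℕ.*-assoc numerator size n))
    choose : ∀ m → Fin m → (a : Fin m → ℕ) → m ℕ.* (numerator ℕ.* n) ℕ.≤ sum a → ∃[ x ] numerator ℕ.* n ℕ.≤ a x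
    choose (suc m) _ a h = pigeonhole m a (numerator ℕ.* n) h

  σN-edge : ∀ x {v w} → Adj G v w → σN (Fin.combine {size} {n} x v , rank v w) ≡ (Fin.combine {size} {n} x w , rank w v)
  σN-edge x {v} {w} a = trans (cong (λ y → merge (proj₁ (Copy.σ (y , rank v w))) , proj₂ (Copy.σ (y , rank v w))) (split-merge (x , v)))
    (cong₂ (λ b d → merge (Copy.moved b (v , rank v w) x , proj₁ d) , proj₂ d) (edge-real a) (τ-edge a))

  layer-member : ∀ x {v} → v ∈ layer x → S (Fin.combine {size} {n} x v) ≡ true
  layer-member x {v} h = trans (sym (lookup∘tabulate (λ v → S (Fin.combine {size} {n} x v)) v)) ([]=⇒lookup h)

  -- In the initial state every edge is even, and the edges of the graph stay within a copy.
  layer-independent : ∀ x → Independent G (layer x)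
  layer-independent x {u} {v} hu hv a with () ← trans (sym (layer-member x hv))
    (Valid.apart valid {Fin.combine {size} {n} x u , rank u v} {Fin.combine {size} {n} x v , rank v u} (cong (live even) (σN-edge x a)) (layer-member x hu))

open import Data.Integer.Base using (+_)

opaque
  unfolding numerator denominator

  -- Weights count a chosen vertex twice, so the computation was made for 0.8704, twice the desired
  -- density.
  fraction-bound : ∀ n s → numerator ℕ.* n ℕ.≤ denominator ℕ.* (2 ℕ.* s) →
                   (+ 4352 ℚ./ 10000) ℚ.* (+ n ℚ./ 1) ℚ.≤ (+ s ℚ./ 1)
  fraction-bound n s h = ℚ.toℚᵘ-cancel-≤ (begin
    ℚ.toℚᵘ ((+ 4352 ℚ./ 10000) ℚ.* (+ n ℚ./ 1))             ≃⟨ ℚ.toℚᵘ-homo-* (+ 4352 ℚ./ 10000) (+ n ℚ./ 1) ⟩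
    ℚ.toℚᵘ (+ 4352 ℚ./ 10000) ℚᵘ.* ℚ.toℚᵘ (+ n ℚ./ 1)       ≃⟨ ℚᵘ.*-cong (ℚ.toℚᵘ-fromℚᵘ (mkℚᵘ (+ 4352) 9999)) (ℚ.toℚᵘ-fromℚᵘ (mkℚᵘ (+ n) 0)) ⟩
    mkℚᵘ (+ 4352) 9999 ℚᵘ.* mkℚᵘ (+ n) 0                     ≤⟨ ℚᵘ.*≤* (integers (ℕ.*-cancelˡ-≤ 2 (subst₂ ℕ._≤_ lhs rhs h))) ⟩
    mkℚᵘ (+ s) 0                                             ≃⟨ ℚᵘ.≃-sym (ℚ.toℚᵘ-fromℚᵘ (mkℚᵘ (+ s) 0)) ⟩
    ℚ.toℚᵘ (+ s ℚ./ 1)                                       ∎)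
    where
    open ℚᵘ.≤-Reasoning
    lhs : 8704 ℕ.* n ≡ 2 ℕ.* (4352 ℕ.* n)
    lhs = ℕ.*-assoc 2 4352 n
    rhs : 10000 ℕ.* (2 ℕ.* s) ≡ 2 ℕ.* (s ℕ.* 10000)
    rhs = trans (ℕ.*-comm 10000 (2 ℕ.* s)) (ℕ.*-assoc 2 s 10000)
    integers : 4352 ℕ.* n ℕ.≤ s ℕ.* 10000 → (+ 4352 ℤ.* + n) ℤ.* + 1 ℤ.≤ + s ℤ.* + (10000 ℕ.* 1)
    integers k = subst₂ ℤ._≤_ (sym (trans (ℤ.*-identityʳ (+ 4352 ℤ.* + n)) (sym (ℤ.pos-* 4352 n)))) (ℤ.pos-* s 10000) (ℤ.+≤+ k)

open import Data.Integer.Base using (+_)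
open import Data.Nat.Base using (ℕ; _>_) renaming (_≤_ to _≤ℕ_)
open import Data.Rational.Base using (_/_; _*_; _≤_)
open import Relation.Nullary.Construct.Add.Supremum using (_⁺; [_])
open import Relation.Binary.Construct.Add.Supremum.NonStrict _≤ℕ_ using (_≤⁺_; [_]; _≤⊤⁺)

girth-bound : ∀ {n} {G : Graph n} {g γ} → IsGirth G γ → [ g ] ≤⁺ γ → ∀ {k} → Cycle G k → g ≤ℕ k
girth-bound {γ = [ _ ]} (_ , h) [ le ] c = ℕ.≤-trans le (h c)
girth-bound             h (_ ≤⊤⁺)      c = ⊥-elim (h c)

corollary2 : ∃[ g ] (g > 0 ×
    (∀ (n : ℕ) → n > 0 → (G : Graph n) → Subcubic G →
    (γ : ℕ ⁺) → IsGirth G γ → [ g ] ≤⁺ γ →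
    Σ[ S ∈ Subset n ] (Independent G S × (+ 4352 / 10000) * (+ n / 1) ≤ (+ ∣ S ∣ / 1))))
-- Closed walks of length up to and including `radius` have to be excluded, hence the successor.
corollary2 = suc radius , ℕ.s≤s ℕ.z≤n , λ n _ G subcubic γ isGirth le →
  let open Slots G subcubic using (τ; ττ; short-acyclic)
      open Cover τ ττ using (tower; tower-acyclic)
      real-acyclic = short-acyclic (girth-bound isGirth le) radius (ℕ.n<1+n radius)
      open Conclusion G subcubic (tower radius) (tower-acyclic radius real-acyclic radius ℕ.≤-refl)
      x , large = large-layer
  in layer x , layer-independent x , fraction-bound n ∣ layer x ∣ large
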